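{- Let $T \subset \mathbb{R}^2$ be a rational pseudointegral triangle that contains exactly one lattice point of $\mathbb{Z}^2$ in its interior, and let $b$ be the number of lattice points of $\mathbb{Z}^2$ on the boundary of $T$. Then $1 \le b \le 9$ and $b \neq 7$.
   Context: A polytope $P \subset \mathbb{R}^d$ is rational if all its vertices lie in $\mathbb{Q}^d$. A polytope $P\subset\mathbb{R}^d$ is pseudointegral (a PIP) if its Ehrhart function $t \mapsto |tP \cap \mathbb{Z}^d|$, $t \in \mathbb{Z}_{>0}$, where $tP=\{ta : a\in P\}$, agrees with a polynomial function of $t$. -}

module Defs where

open import Data.Nat using (ℕ; suc)
open import Data.Integer using (ℤ; +_)
open import Data.Rational using (ℚ; _/_; _+_; _*_; _-_; _≤_; _<_; 0ℚ; 1ℚ; ∣_∣)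
open import Data.Product using (Σ; ∃; _×_; _,_)
open import Data.List using (List; length; foldr)
open import Data.List.Membership.Propositional using (_∈_)
open import Data.List.Relation.Unary.Unique.Propositional using (Unique)
open import Function.Bundles using (_⇔_)
open import Relation.Binary.PropositionalEquality using (_≡_)
open import Relation.Nullary using (¬_)

Point : Set
Point = ℚ × ℚ

ι : ℤ → ℚ
ι z = z / 1

lat : ℤ × ℤ → Point
lat (x , y) = (ι x , ι y)

ℕ→ℚ : ℕ → ℚ
ℕ→ℚ n = (+ n) / 1

record Triangle : Set where
  constructor tri
  field
    v₁ v₂ v₃ : Point

open Triangle public

det : Triangle → ℚ
det (tri (a₁ , a₂) (b₁ , b₂) (c₁ , c₂)) =
  ((b₁ - a₁) * (c₂ - a₂)) - ((c₁ - a₁) * (b₂ - a₂))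

NonDegenerate : Triangle → Set
NonDegenerate T = ¬ (det T ≡ 0ℚ)

_∈T_ : Point → Triangle → Set
(x , y) ∈T tri (a₁ , a₂) (b₁ , b₂) (c₁ , c₂) =
  Σ ℚ λ l₁ → Σ ℚ λ l₂ → Σ ℚ λ l₃ →
    (0ℚ ≤ l₁) × (0ℚ ≤ l₂) × (0ℚ ≤ l₃) × (l₁ + (l₂ + l₃) ≡ 1ℚ) ×
    (x ≡ (l₁ * a₁) + ((l₂ * b₁) + (l₃ * c₁))) ×
    (y ≡ (l₁ * a₂) + ((l₂ * b₂) + (l₃ * c₂)))

_∈Dil[_]_ : Point → ℕ → Triangle → Set
(x , y) ∈Dil[ t ] T =
  Σ Point λ { (a₁ , a₂) → ((a₁ , a₂) ∈T T) × (x ≡ ℕ→ℚ t * a₁) × (y ≡ ℕ→ℚ t * a₂) }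

Interior : Point → Triangle → Set
Interior (x , y) T =
  Σ ℚ λ ε → (0ℚ < ε) ×
    ((u v : ℚ) → ∣ u - x ∣ < ε → ∣ v - y ∣ < ε → (u , v) ∈T T)

Boundary : Point → Triangle → Set
Boundary p T = (p ∈T T) × ¬ Interior p T

HasCard : (ℤ × ℤ → Set) → ℕ → Set
HasCard P n = Σ (List (ℤ × ℤ)) λ l →
  Unique l × (length l ≡ n) × ((z : ℤ × ℤ) → (z ∈ l) ⇔ P z)

evalPoly : List ℚ → ℚ → ℚ
evalPoly cs t = foldr (λ c acc → c + (t * acc)) 0ℚ cs

Pseudointegral : Triangle → Set
Pseudointegral T = Σ (List ℚ) λ cs → (t : ℕ) →
  Σ ℕ λ n → HasCard (λ z → lat z ∈Dil[ suc t ] T) n × (evalPoly cs (ℕ→ℚ (suc t)) ≡ ℕ→ℚ n)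

-- Let L(t) and I(t) count the lattice points of tT and of its interior, let D
-- clear the denominators of the vertices and let K/D² be twice the area of T.
-- Cutting up a parallelogram at a vertex of a dilate gives, for x = Ds,
--   K s² + 2 L(x - t) = L(2x - t) + I(t)   (t > 0),   K s² + 2 L(x) = L(2x) + 1.
-- For polynomial L the second relation forces L(x) = 1 + αx + (K/2D²) x², and
-- then the first says I(t) = L(-t).  As I(1) = 1, it follows that α = K/2D²,
-- I(t + 1) = L(t) and b = K/D².  So if z₀ is the interior lattice point, the
-- lattice points interior to (t + 1)T are exactly those of tT translated by z₀.
-- This forces the edge lines of T to be {nᵢ · (z - z₀) = -1} with integral nᵢ.
-- In terms of the positive integers wᵢ = nⱼ × nₖ the equation b = K/D² becomes
--   (w₁ + w₂ + w₃)² = b w₁ w₂ w₃,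
-- and Vieta jumping reduces it to a solution x ≤ y ≤ z ≤ x + y, where b x ≤ 9
-- and b = 7 is impossible.

module Submission where

-- For a merely rational triangle the lattice point count of the dilates is a priori only a
-- quasi-polynomial, so a cutting argument can compare only dilates whose factors agree modulo `D`.
-- Up to lattice translation, the dilates with factors `D * s - t` and `D * (s + s) - t` have the
-- same corner at a vertex, and what they leave of a parallelogram is a reflected open copy of the
-- t-th dilate. Pseudointegrality joins the residue classes: a single polynomial, known on the
-- multiples of `D` up to its linear coefficient, serves all of them. The normals become integral
-- through a gap. If an edge form took on some lattice vector a value that is not a multiple of its
-- value at z₀, then adding copies of z₀ and moving far along the edge would give an interior
-- lattice point of a large dilate that lies closer to the edge line than any translate by z₀ of a
-- point of the previous dilate. The final equation is an area formula: the triangle with nᵢ · z ≥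
-- -1 has twice the area (w₁ + w₂ + w₃)² / (w₁ w₂ w₃). The 9 is its value for w₁ = w₂ = w₃ = 1.

-- Finite cardinalities of predicates.

module Counting where
  open import Data.Nat using (ℕ; suc; _+_; _*_; _≤_; z≤n; s≤s)
  open import Data.Nat.Properties using (≤-antisym; ≤-trans; <-irrefl; ≤-reflexive)
  open import Data.Product using (Σ; ∃; _×_; _,_)
  open import Data.Product.Properties using (,-injectiveʳ)
  open import Data.Sum using (_⊎_; inj₁; inj₂)
  open import Data.Empty using (⊥-elim)
  open import Data.List using (List; []; _∷_; length; map; _++_; filter)
  open import Data.List.Properties using (length-map; length-++)
  open import Data.List.Membership.Propositional using (_∈_)
  open import Data.List.Membership.Propositional.Properties
    using (∈-++⁺ˡ; ∈-++⁺ʳ; ∈-++⁻; ∈-map⁺; ∈-map⁻; ∈-filter⁺; ∈-filter⁻)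
  open import Data.List.Membership.DecPropositional using (_∈?_)
  open import Data.List.Relation.Unary.Any using (here; there; _─_)
  open import Data.List.Relation.Unary.All using ([]; _∷_)
  open import Data.List.Relation.Unary.All.Properties using (¬Any⇒All¬; All¬⇒¬Any)
  open import Data.List.Relation.Unary.AllPairs using ([]; _∷_)
  open import Data.List.Relation.Unary.Unique.Propositional using (Unique)
  import Data.List.Relation.Unary.Unique.Propositional.Properties as Unique
  open import Function.Base using (_∘_)
  open import Function.Bundles using (_⇔_; mk⇔; Equivalence)
  open import Function.Properties.Equivalence using () renaming (trans to ⇔-trans)
  open import Relation.Binary.Definitions using (DecidableEquality)
  open import Relation.Binary.PropositionalEquality
  open import Relation.Nullary using (¬_; yes; no; contradiction)
  open import Relation.Unary using (Decidable)

  open Equivalence using (to; from)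

  private variable
    A B : Set
    P Q : A → Set
    m n : ℕ

  -- Over `ℤ × ℤ` this unfolds to `HasCard`, so the hypotheses of the theorem are themselves values
  -- of it; other index types are needed for changes of coordinates.
  Card : (A → Set) → ℕ → Set
  Card {A} P n = Σ (List A) λ l →
    Unique l × (length l ≡ n) × ((z : A) → (z ∈ l) ⇔ P z)

  length-─ : {x : A} {l : List A} (i : x ∈ l) → length l ≡ suc (length (l ─ i))
  length-─ (here _) = refl
  length-─ {l = _ ∷ _ ∷ _} (there i) = cong suc (length-─ i)

  ∈-─ : {x y : A} {l : List A} (i : x ∈ l) → y ≢ x → y ∈ l → y ∈ (l ─ i)
  ∈-─ (here refl) y≢x (here y≡x) = contradiction y≡x y≢x
  ∈-─ (here _) y≢x (there j) = j
  ∈-─ (there i) y≢x (here y≡x) = here y≡x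
  ∈-─ (there i) y≢x (there j) = there (∈-─ i y≢x j)

  unique-⊆-length : {l l′ : List A} → Unique l → (∀ {z} → z ∈ l → z ∈ l′) → length l ≤ length l′
  unique-⊆-length [] sub = z≤n
  unique-⊆-length {l = x ∷ l} {l′} (x∉l ∷ u) sub =
    ≤-trans (s≤s (unique-⊆-length u sub′)) (≤-reflexive (sym (length-─ i)))
    where
    i : x ∈ l′
    i = sub (here refl)
    sub′ : ∀ {z} → z ∈ l → z ∈ (l′ ─ i)
    sub′ z∈l = ∈-─ i (λ { refl → All¬⇒¬Any x∉l z∈l }) (sub (there z∈l))

  card-≤ : Card P m → Card Q n → (∀ z → P z → Q z) → m ≤ n
  card-≤ (l , u , refl , e) (l′ , u′ , refl , e′) sub =
    unique-⊆-length u λ {z} → from (e′ z) ∘ sub z ∘ to (e z)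

  card-unique : Card P m → Card P n → m ≡ n
  card-unique c d = ≤-antisym (card-≤ c d λ _ p → p) (card-≤ d c λ _ p → p)

  card-cong : (∀ z → P z → Q z) → (∀ z → Q z → P z) → Card P n → Card Q n
  card-cong f g (l , u , len , e) = l , u , len , λ z → ⇔-trans (e z) (mk⇔ (f z) (g z))

  card-⊎ : Card P m → Card Q n → (∀ z → P z → ¬ Q z) → Card (λ z → P z ⊎ Q z) (m + n)
  card-⊎ {P = P} {Q = Q} (l , u , refl , e) (l′ , u′ , refl , e′) disjoint =
    l ++ l′ ,
    Unique.++⁺ u u′ (λ {z} (i , j) → disjoint z (to (e z) i) (to (e′ z) j)) ,
    length-++ l ,
    λ z → mk⇔ (fwd z) (bwd z)
    where
    fwd : ∀ z → z ∈ (l ++ l′) → P z ⊎ Q z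
    fwd z i with ∈-++⁻ l i
    ... | inj₁ j = inj₁ (to (e z) j)
    ... | inj₂ j = inj₂ (to (e′ z) j)
    bwd : ∀ z → P z ⊎ Q z → z ∈ (l ++ l′)
    bwd z (inj₁ p) = ∈-++⁺ˡ (from (e z) p)
    bwd z (inj₂ q) = ∈-++⁺ʳ l (from (e′ z) q)

  card-bijection : (f : A → B) (g : B → A) → (∀ x → g (f x) ≡ x) → (∀ y → f (g y) ≡ y) →
    Card P n → Card (λ y → P (g y)) n
  card-bijection {P = P} f g gf fg (l , u , refl , e) =
    map f l ,
    Unique.map⁺ (λ {x} {y} fx≡fy → trans (sym (gf x)) (trans (cong g fx≡fy) (gf y))) u ,
    length-map f l ,
    λ y → mk⇔ (fwd y) (λ p → subst (_∈ map f l) (fg y) (∈-map⁺ f (from (e (g y)) p)))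
    where
    fwd : ∀ y → y ∈ map f l → P (g y)
    fwd y i with ∈-map⁻ f i
    ... | x , x∈l , refl = subst P (sym (gf x)) (to (e x) x∈l)

  card-filter : Decidable Q → Card P n → ∃ (Card (λ z → P z × Q z))
  card-filter {Q = Q} Q? (l , u , _ , e) =
    _ , filter Q? l , Unique.filter⁺ Q? u , refl ,
    λ z → mk⇔ (λ i → let (j , q) = ∈-filter⁻ Q? i in to (e z) j , q)
              (λ (p , q) → ∈-filter⁺ Q? (from (e z) p) q)

  card-empty : (∀ z → ¬ P z) → Card P 0
  card-empty none = [] , [] , refl , λ z → mk⇔ (λ ()) (λ p → ⊥-elim (none z p))

  card-singleton : (a : A) → P a → (∀ z → P z → z ≡ a) → Card P 1
  card-singleton a pa only =
    a ∷ [] , [] ∷ [] , refl , λ z → mk⇔ (λ { (here refl) → pa }) (λ p → here (only z p))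

  card-1⇒singleton : Card P 1 → Σ _ P
  card-1⇒singleton (a ∷ [] , _ , _ , e) = a , to (e a) (here refl)

  -- Pigeonhole: an element of `Q` missing from the list of `P`, put in front of it, would give a
  -- repetition-free list longer than that of `Q`. This is how an equality of lattice point counts
  -- becomes an equality of point sets.
  card-⊆-≡ : DecidableEquality A → {P Q : A → Set} → Card P n → Card Q n →
    (∀ z → P z → Q z) → ∀ z → Q z → P z
  card-⊆-≡ _≟_ (l , u , len , e) (l′ , u′ , len′ , e′) sub z q with _∈?_ _≟_ z l
  ... | yes i = to (e z) i
  ... | no z∉l = contradiction (≤-reflexive (trans len′ (sym len))) (λ le → <-irrefl refl (≤-trans longer le))
    where
    longer : suc (length l) ≤ length l′
    longer = unique-⊆-length (¬Any⇒All¬ l z∉l ∷ u)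
      λ { {w} (here refl) → from (e′ w) q ; {w} (there i) → from (e′ w) (sub w (to (e w) i)) }

  -- The fibre may move with its base point as long as its size is constant. This allows sheared
  -- coordinates, where the second range is offset by the first coordinate.
  card-fibred : {P : A → Set} {Q : A → B → Set} → Card P m → (∀ a → P a → Card (Q a) n) →
    Card (λ (a , b) → P a × Q a b) (m * n)
  card-fibred {n = n} {P = P} {Q} (l , u , refl , e) fibre =
    card-cong (λ (a , b) (i , q) → to (e a) i , q) (λ (a , b) (p , q) → from (e a) p , q)
      (go l u λ a i → fibre a (to (e a) i))
    where
    go : ∀ l → Unique l → (∀ a → a ∈ l → Card (Q a) n) → Card (λ (a , b) → a ∈ l × Q a b) (length l * n)
    go [] _ _ = card-empty λ { _ (() , _) }
    go (a ∷ l) (a∉l ∷ u) fib with fib a (here refl)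
    ... | l₁ , u₁ , len , e₁ =
      card-cong
        (λ { _ (inj₁ (refl , q)) → here refl , q ; _ (inj₂ (i , q)) → there i , q })
        (λ { _ (here refl , q) → inj₁ (refl , q) ; _ (there i , q) → inj₂ (i , q) })
        (card-⊎ first (go l u λ b i → fib b (there i)) λ { _ (refl , _) (i , _) → All¬⇒¬Any a∉l i })
      where
      first : Card (λ (b , c) → b ≡ a × Q b c) n
      first = map (a ,_) l₁ , Unique.map⁺ ,-injectiveʳ u₁ , trans (length-map _ l₁) len ,
        λ { (b , c) → mk⇔ (fwd b c) (λ { (refl , q) → ∈-map⁺ (a ,_) (from (e₁ c) q) }) }
        where
        fwd : ∀ b c → (b , c) ∈ map (a ,_) l₁ → b ≡ a × Q b c
        fwd b c i with ∈-map⁻ (a ,_) i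
        ... | d , d∈ , refl = refl , to (e₁ d) d∈

-- Certificates for integer inequalities.

module IntegerArithmetic where
  open import Data.Nat using (ℕ)
  import Data.Nat as ℕ
  open import Data.Integer
  open import Data.Integer.Properties
  open import Data.Integer.Tactic.RingSolver using (solve; solve-∀)
  open import Data.Empty using (⊥)
  open import Data.List using ([]; _∷_)
  open import Data.Sum using (_⊎_; inj₁; inj₂)
  open import Relation.Binary.PropositionalEquality
  open import Relation.Nullary using (yes; no)

  infixl 6 _⊕_
  infixl 7 _⊗_

  -- Linear arithmetic by certificates: every inequality is turned into the
  -- nonnegativity of a difference, these are combined by ⊕ and ⊗, and the
  -- combination is compared with the goal by the ring solver.
  ≤⇒0≤ : ∀ {i j} → i ≤ j → 0ℤ ≤ j - i
  ≤⇒0≤ = i≤j⇒0≤j-i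

  <⇒0≤ : ∀ {i j} → i < j → 0ℤ ≤ j - i - 1ℤ
  <⇒0≤ {i} {j} i<j = subst (0ℤ ≤_) (regroup i j) (i≤j⇒0≤j-i (i<j⇒suc[i]≤j i<j))
    where
    regroup : ∀ i j → j - (1ℤ + i) ≡ j - i - 1ℤ
    regroup = solve-∀

  ≡⇒0≤ : ∀ {i j} k → i ≡ j → 0ℤ ≤ k * (i - j)
  ≡⇒0≤ {i} k refl = ≤-reflexive (sym (trans (cong (k *_) (+-inverseʳ i)) (*-zeroʳ k)))

  _⊕_ : ∀ {a b} → 0ℤ ≤ a → 0ℤ ≤ b → 0ℤ ≤ a + b
  _⊕_ = +-mono-≤

  _⊗_ : ∀ {a b} → 0ℤ ≤ a → 0ℤ ≤ b → 0ℤ ≤ a * b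
  _⊗_ {+ m} {+ n} _ _ = subst (0ℤ ≤_) (pos-* m n) (+≤+ ℕ.z≤n)

  ℕ⇒0≤ : ∀ n → 0ℤ ≤ + n
  ℕ⇒0≤ n = +≤+ ℕ.z≤n

  ≤-cert : ∀ {a b c} → 0ℤ ≤ c → b - a ≡ c → a ≤ b
  ≤-cert p refl = 0≤i-j⇒j≤i p

  <-cert : ∀ {a b c} → 0ℤ ≤ c → b - a - 1ℤ ≡ c → a < b
  <-cert {a} {b} p refl = suc[i]≤j⇒i<j (0≤i-j⇒j≤i (subst (0ℤ ≤_) (regroup a b) p))
    where
    regroup : ∀ i j → j - i - 1ℤ ≡ j - (1ℤ + i)
    regroup = solve-∀

  -- The end of a Farkas refutation: hypotheses combined with nonnegative multipliers add up to a
  -- negative constant, where `n = 0` stands for -1.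
  ⊥-cert : ∀ {c n} → 0ℤ ≤ c → c ≡ -[1+ n ] → ⊥
  ⊥-cert () refl

  <⊎≥ : ∀ i j → i < j ⊎ j ≤ i
  <⊎≥ i j with i <? j
  ... | yes i<j = inj₁ i<j
  ... | no i≮j = inj₂ (≮⇒≥ i≮j)

  0<-* : ∀ {i j} → 0ℤ < i → 0ℤ < j → 0ℤ < i * j
  0<-* {i} {j} p q = <-cert (<⇒0≤ p ⊗ <⇒0≤ q ⊕ <⇒0≤ p ⊕ <⇒0≤ q) (solve (i ∷ j ∷ []))

  <-byContradiction : ∀ {i j} → (j ≤ i → ⊥) → i < j
  <-byContradiction f = ≰⇒> f

  ≤-byContradiction : ∀ {i j} → (j < i → ⊥) → i ≤ j
  ≤-byContradiction f = ≮⇒≥ f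

  1≤∧<2⇒≡1 : ∀ {i} → 0ℤ < i → i < + 2 → i ≡ 1ℤ
  1≤∧<2⇒≡1 {i} 0<i i<2 = ≤-antisym (≤-cert (<⇒0≤ i<2) (solve (i ∷ []))) (≤-cert (<⇒0≤ 0<i) (solve (i ∷ [])))

-- Descent for the Markov type equation.

module Markov where
  open IntegerArithmetic
  open import Data.Nat using (ℕ)
  import Data.Nat as ℕ
  open import Data.Integer
  open import Data.Integer.Properties
  open import Data.Integer.Tactic.RingSolver using (solve; solve-∀)
  open import Data.Empty using (⊥; ⊥-elim)
  open import Data.List using ([]; _∷_)
  open import Data.Product using (Σ; _×_; _,_)
  open import Data.Sum using ([_,_]′)
  open import Relation.Binary.PropositionalEquality

  record MarkovType (b x y z : ℤ) : Set where
    constructor markov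
    field square-sum : (x + y + z) * (x + y + z) ≡ b * (x * y * z)

  swap₁₂ : ∀ {b} x y z → MarkovType b x y z → MarkovType b y x z
  swap₁₂ {b} x y z (markov eq) = markov (trans (trans (l x y z) eq) (r b x y z))
    where
    l : ∀ x y z → (y + x + z) * (y + x + z) ≡ (x + y + z) * (x + y + z)
    l = solve-∀
    r : ∀ b x y z → b * (x * y * z) ≡ b * (y * x * z)
    r = solve-∀

  rotate : ∀ {b} x y z → MarkovType b x y z → MarkovType b y z x
  rotate {b} x y z (markov eq) = markov (trans (trans (l x y z) eq) (r b x y z))
    where
    l : ∀ x y z → (y + z + x) * (y + z + x) ≡ (x + y + z) * (x + y + z)
    l = solve-∀
    r : ∀ b x y z → b * (x * y * z) ≡ b * (y * z * x)
    r = solve-∀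

  -- It suffices that (x + y + z)² ≤ 9 y z. In terms of p = y - x and q = z - y the difference of
  -- the two sides has a single negative term -q², which is absorbed by x q because z ≤ x + y says q
  -- ≤ x. At x = y = z the difference vanishes, whence the 9.
  reduced-bound : ∀ {b x y z} → 0ℤ < x → x ≤ y → y ≤ z → z ≤ x + y → MarkovType b x y z → b * x ≤ + 9
  reduced-bound {b} {x} {y} {z} 0<x x≤y y≤z z≤x+y (markov eq) = ≤-byContradiction λ 9<bx → (⊥-cert {n = 0}
    (<⇒0≤ 9<bx ⊗ (0≤y ⊗ 0≤z) ⊕ ≡⇒0≤ 1ℤ eq ⊕ excess ⊕ (0≤y-1 ⊗ 0≤z-1 ⊕ 0≤y-1 ⊕ 0≤z-1))
    (identity b x y z))
    where
    0≤x = <⇒≤ 0<x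
    0≤y = ≤-trans 0≤x x≤y
    0≤z = ≤-trans 0≤y y≤z
    0≤y-1 = <⇒0≤ (<-≤-trans 0<x x≤y)
    0≤z-1 = <⇒0≤ (<-≤-trans 0<x (≤-trans x≤y y≤z))
    p q : ℤ
    p = y - x
    q = z - y
    0≤p : 0ℤ ≤ p
    0≤p = ≤⇒0≤ x≤y
    0≤q : 0ℤ ≤ q
    0≤q = ≤⇒0≤ y≤z
    excess : 0ℤ ≤ + 6 * (x * p) + + 5 * (p * p) + + 2 * (x * q) + + 5 * (p * q) + q * (x + y - z)
    excess = ℕ⇒0≤ 6 ⊗ (0≤x ⊗ 0≤p) ⊕ ℕ⇒0≤ 5 ⊗ (0≤p ⊗ 0≤p) ⊕ ℕ⇒0≤ 2 ⊗ (0≤x ⊗ 0≤q)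
      ⊕ ℕ⇒0≤ 5 ⊗ (0≤p ⊗ 0≤q) ⊕ 0≤q ⊗ ≤⇒0≤ z≤x+y
    identity : ∀ b x y z → (b * x - + 9 - 1ℤ) * (y * z) + 1ℤ * ((x + y + z) * (x + y + z) - b * (x * y * z))
      + (+ 6 * (x * (y - x)) + + 5 * ((y - x) * (y - x)) + + 2 * (x * (z - y)) + + 5 * ((y - x) * (z - y)) + (z - y) * (x + y - z))
      + ((y - 0ℤ - 1ℤ) * (z - 0ℤ - 1ℤ) + (y - 0ℤ - 1ℤ) + (z - 0ℤ - 1ℤ)) ≡ -[1+ 0 ]
    identity = solve-∀

  -- The difference 7 y² - (1 + 2 y)² equals (y - 2)(3 y + 2) + 3, so it is positive from y = 2 on;
  -- y = 1 gives 9 against 7.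
  no-root₀ : ∀ {y} → 0ℤ < y → MarkovType (+ 7) 1ℤ y y → ⊥
  no-root₀ {y} 0<y eq@(markov sq) = [ small , large ]′ (<⊎≥ y (+ 2))
    where
    9≢7 : MarkovType (+ 7) 1ℤ 1ℤ 1ℤ → ⊥
    9≢7 (markov ())
    small : y < + 2 → ⊥
    small y<2 = 9≢7 (subst (λ y → MarkovType (+ 7) 1ℤ y y) (1≤∧<2⇒≡1 0<y y<2) eq)
    identity : ∀ y → (y - + 2) * (+ 3 * y + + 2) + 1ℤ * ((1ℤ + y + y) * (1ℤ + y + y) - + 7 * (1ℤ * y * y)) ≡ -[1+ 2 ]
    identity = solve-∀
    large : + 2 ≤ y → ⊥
    large 2≤y = ⊥-cert {n = 2} (≤⇒0≤ 2≤y ⊗ (ℕ⇒0≤ 3 ⊗ <⇒≤ 0<y ⊕ ℕ⇒0≤ 2) ⊕ ≡⇒0≤ 1ℤ sq) (identity y)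

  -- The difference 7 y (y + 1) - (2 y + 2)² equals (y - 2)(3 y + 5) + 6; y = 1 gives 16 against 14.
  no-root₁ : ∀ {y} → 0ℤ < y → MarkovType (+ 7) 1ℤ y (y + 1ℤ) → ⊥
  no-root₁ {y} 0<y eq@(markov sq) = [ small , large ]′ (<⊎≥ y (+ 2))
    where
    16≢14 : MarkovType (+ 7) 1ℤ 1ℤ (+ 2) → ⊥
    16≢14 (markov ())
    small : y < + 2 → ⊥
    small y<2 = 16≢14 (subst (λ y → MarkovType (+ 7) 1ℤ y (y + 1ℤ)) (1≤∧<2⇒≡1 0<y y<2) eq)
    identity : ∀ y → (y - + 2) * (+ 3 * y + + 5)
      + 1ℤ * ((1ℤ + y + (y + 1ℤ)) * (1ℤ + y + (y + 1ℤ)) - + 7 * (1ℤ * y * (y + 1ℤ))) ≡ -[1+ 5 ]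
    identity = solve-∀
    large : + 2 ≤ y → ⊥
    large 2≤y = ⊥-cert {n = 5} (≤⇒0≤ 2≤y ⊗ (ℕ⇒0≤ 3 ⊗ <⇒≤ 0<y ⊕ ℕ⇒0≤ 5) ⊕ ≡⇒0≤ 1ℤ sq) (identity y)

  Conclusion : ℤ → Set
  Conclusion b = b ≤ + 9 × b ≢ + 7

  -- For b = 7 the bound b x ≤ 9 leaves x = 1, and then y ≤ z ≤ y + 1, so only the two families
  -- `no-root₀` and `no-root₁` remain.
  reduced-conclusion : ∀ {b} x y z → 0ℤ < x → x ≤ y → y ≤ z → z ≤ x + y → MarkovType b x y z → Conclusion b
  reduced-conclusion {b} x y z 0<x x≤y y≤z z≤x+y eq = b≤9 , λ b≡7 → b≢7 b≡7 bx≤9 eq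
    where
    bx≤9 = reduced-bound {b} 0<x x≤y y≤z z≤x+y eq
    b≤9 : b ≤ + 9
    b≤9 = ≤-byContradiction λ 9<b →
      ⊥-cert {n = 0} (≤⇒0≤ bx≤9 ⊕ <⇒0≤ 9<b ⊗ <⇒≤ 0<x ⊕ ℕ⇒0≤ 10 ⊗ <⇒0≤ 0<x) (identity b x)
      where
      identity : ∀ b x → + 9 - b * x + (b - + 9 - 1ℤ) * x + + 10 * (x - 0ℤ - 1ℤ) ≡ -[1+ 0 ]
      identity = solve-∀
    x≡1⇒⊥ : ∀ {x} → x ≡ 1ℤ → z ≤ x + y → MarkovType (+ 7) x y z → ⊥
    x≡1⇒⊥ refl z≤1+y eq = [ z≡y+1 , z≡y ]′ (<⊎≥ y z)
      where
      z≡y : z ≤ y → ⊥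
      z≡y z≤y = no-root₀ (<-≤-trans 0<x x≤y) (subst (MarkovType (+ 7) 1ℤ y) (≤-antisym z≤y y≤z) eq)
      z≡y+1 : y < z → ⊥
      z≡y+1 y<z = no-root₁ (<-≤-trans 0<x x≤y) (subst (MarkovType (+ 7) 1ℤ y) z≡ eq)
        where
        z≡ : z ≡ y + 1ℤ
        z≡ = ≤-antisym (≤-cert (≤⇒0≤ z≤1+y) (solve (y ∷ z ∷ []))) (≤-cert (<⇒0≤ y<z) (solve (y ∷ z ∷ [])))
    b≢7 : ∀ {b} → b ≡ + 7 → b * x ≤ + 9 → MarkovType b x y z → ⊥
    b≢7 refl 7x≤9 eq = x≡1⇒⊥ (1≤∧<2⇒≡1 0<x (<-byContradiction λ 2≤x →
        ⊥-cert {n = 4} (≤⇒0≤ 7x≤9 ⊕ ℕ⇒0≤ 7 ⊗ ≤⇒0≤ 2≤x) (identity x))) z≤x+y eq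
      where
      identity : ∀ x → + 9 - + 7 * x + + 7 * (x - + 2) ≡ -[1+ 4 ]
      identity = solve-∀

  -- Vieta jumping: the two roots of the equation as a quadratic in z have
  -- product (x + y)².
  vieta-jump : ∀ {b} x y z → 0ℤ < x → 0ℤ < y → x + y < z → MarkovType b x y z →
    Σ ℤ λ z′ → 0ℤ < z′ × z′ < z × MarkovType b x y z′
  vieta-jump {b} x y z 0<x 0<y x+y<z (markov eq) =
    w , w-positive product , smaller product , equation refl
    where
    -- The roots of the quadratic in z have the sum b x y - 2 (x + y).
    w : ℤ
    w = b * (x * y) - + 2 * (x + y) - z
    0<s : 0ℤ < x + y
    0<s = +-mono-< 0<x 0<y
    0<z : 0ℤ < z
    0<z = <-trans 0<s x+y<z
    product : (x + y) * (x + y) ≡ z * w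
    product = trans (l b x y z) (trans (cong (λ e → e - (+ 2 * (x + y) * z + z * z)) eq) (r b x y z))
      where
      l : ∀ b x y z → (x + y) * (x + y) ≡ (x + y + z) * (x + y + z) - (+ 2 * (x + y) * z + z * z)
      l = solve-∀
      r : ∀ b x y z → b * (x * y * z) - (+ 2 * (x + y) * z + z * z) ≡ z * (b * (x * y) - + 2 * (x + y) - z)
      r = solve-∀
    w-positive : ∀ {w} → (x + y) * (x + y) ≡ z * w → 0ℤ < w
    w-positive {w} product = <-byContradiction λ w≤0 → (⊥-cert {n = 0}
      (≤⇒0≤ w≤0 ⊗ <⇒≤ 0<z ⊕ ≡⇒0≤ -1ℤ product ⊕ <⇒0≤ (0<-* 0<s 0<s)) (identity (x + y) z w))
      where
      identity : ∀ s z w → (0ℤ - w) * z + -1ℤ * (s * s - z * w) + (s * s - 0ℤ - 1ℤ) ≡ -[1+ 0 ]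
      identity = solve-∀
    smaller : ∀ {w} → (x + y) * (x + y) ≡ z * w → w < z
    smaller {w} product = <-byContradiction λ z≤w → (⊥-cert {n = 0}
      (≤⇒0≤ z≤w ⊗ <⇒≤ 0<z ⊕ ≡⇒0≤ 1ℤ product ⊕ <⇒0≤ x+y<z ⊗ (<⇒≤ 0<z ⊕ <⇒≤ 0<s) ⊕ <⇒0≤ (+-mono-< 0<z 0<s))
      (identity (x + y) z w))
      where
      identity : ∀ s z w → (w - z) * z + 1ℤ * (s * s - z * w) + (z - s - 1ℤ) * (z + s) + (z + s - 0ℤ - 1ℤ) ≡ -[1+ 0 ]
      identity = solve-∀
    equation : ∀ {w} → w ≡ b * (x * y) - + 2 * (x + y) - z → MarkovType b x y w
    equation refl = markov (trans (l x y w) (trans (cong (λ e → e + (+ 2 * (x + y) * w + w * w)) product) (r b x y z)))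
      where
      l : ∀ x y w → (x + y + w) * (x + y + w) ≡ (x + y) * (x + y) + (+ 2 * (x + y) * w + w * w)
      l = solve-∀
      r : ∀ b x y z → let w = b * (x * y) - + 2 * (x + y) - z in
        z * w + (+ 2 * (x + y) * w + w * w) ≡ b * (x * y * w)
      r = solve-∀

  reduced-conclusion′ : ∀ {b} x y z → 0ℤ < x → 0ℤ < y → 0ℤ < z →
    x ≤ y + z → y ≤ z + x → z ≤ x + y → MarkovType b x y z → Conclusion b
  reduced-conclusion′ {b} x y z 0<x 0<y 0<z x≤ y≤ z≤ eq =
    [ (λ x≤y → [ (λ y≤z → reduced-conclusion x y z 0<x x≤y y≤z z≤ eq)
               , (λ z≤y → [ (λ x≤z → reduced-conclusion x z y 0<x x≤z z≤y (comm z x y≤) (swap₁₂ z x y (rotate y z x (rotate x y z eq))))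
                          , (λ z≤x → reduced-conclusion z x y 0<z z≤x x≤y y≤ (rotate y z x (rotate x y z eq)))
                          ]′ (≤-total x z))
               ]′ (≤-total y z))
    , (λ y≤x → [ (λ x≤z → reduced-conclusion y x z 0<y y≤x x≤z (comm x y z≤) (swap₁₂ x y z eq))
               , (λ z≤x → [ (λ y≤z → reduced-conclusion y z x 0<y y≤z z≤x x≤ (rotate x y z eq))
                          , (λ z≤y → reduced-conclusion z y x 0<z z≤y y≤x (comm y z x≤) (swap₁₂ y z x (rotate x y z eq)))
                          ]′ (≤-total y z))
               ]′ (≤-total x z))
    ]′ (≤-total x y)
    where
    comm : ∀ {i} j k → i ≤ j + k → i ≤ k + j
    comm j k = subst (_ ≤_) (+-comm j k)

  -- The number `n` bounds the sum and serves as fuel. An entry larger than the sum of the other two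
  -- is replaced by a smaller positive one with `b` unchanged; when there is no such entry, the
  -- triple is reduced up to order.
  markov-type-conclusion : ∀ {b} n x y z → 0ℤ < x → 0ℤ < y → 0ℤ < z → x + y + z ≤ + n → MarkovType b x y z → Conclusion b
  markov-type-conclusion ℕ.zero x y z 0<x 0<y 0<z ≤n eq =
    ⊥-elim (<-irrefl refl (<-≤-trans (+-mono-< (+-mono-< 0<x 0<y) 0<z) ≤n))
  markov-type-conclusion {b} (ℕ.suc n) x y z 0<x 0<y 0<z ≤n eq =
    [ (λ x+y<z → descend x y z 0<x 0<y x+y<z ≤n eq)
    , (λ z≤ → [ (λ y+z<x → descend y z x 0<y 0<z y+z<x (cycle x y z ≤n) (rotate x y z eq))
              , (λ x≤ → [ (λ z+x<y → descend z x y 0<z 0<x z+x<y (cycle y z x (cycle x y z ≤n)) (rotate y z x (rotate x y z eq)))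
                        , (λ y≤ → reduced-conclusion′ x y z 0<x 0<y 0<z x≤ y≤ z≤ eq)
                        ]′ (<⊎≥ (z + x) y))
              ]′ (<⊎≥ (y + z) x))
    ]′ (<⊎≥ (x + y) z)
    where
    cycle : ∀ x y z {k} → x + y + z ≤ k → y + z + x ≤ k
    cycle x y z = subst (_≤ _) (solve (x ∷ y ∷ z ∷ []))
    shrink : ∀ {x y z w} → w < z → x + y + z ≤ + ℕ.suc n → x + y + w ≤ + n
    shrink {x} {y} {z} {w} w<z ≤n = ≤-cert (<⇒0≤ w<z ⊕ ≤⇒0≤ ≤n) (identity x y z w (+ n))
      where
      identity : ∀ x y z w n → n - (x + y + w) ≡ z - w - 1ℤ + ((1ℤ + n) - (x + y + z))
      identity = solve-∀
    descend : ∀ x y z → 0ℤ < x → 0ℤ < y → x + y < z → x + y + z ≤ + ℕ.suc n → MarkovType b x y z → Conclusion b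
    descend x y z 0<x 0<y x+y<z ≤n eq =
      let w , 0<w , w<z , eq′ = vieta-jump x y z 0<x 0<y x+y<z eq in
      markov-type-conclusion n x y w 0<x 0<y 0<w (shrink {x} {y} w<z ≤n) eq′

-- Lattice points in a half-open parallelogram.

module LatticeParallelogram where
  open Counting
  open IntegerArithmetic
  open import Data.Nat using (ℕ)
  import Data.Nat as ℕ
  import Data.Nat.Properties as ℕ
  open import Data.Integer
  open import Data.Integer.Properties
  open import Data.Integer.DivMod using (_/_; _%_; a≡a%n+[a/n]*n; n%d<d)
  open import Data.Integer.Tactic.RingSolver using (solve-∀)
  open import Data.Empty using (⊥-elim)
  open import Data.Product using (∃; _×_; _,_)
  open import Data.Sum using (_⊎_; inj₁; inj₂; [_,_]′)
  open import Relation.Binary.PropositionalEquality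

  InRange : ℤ → ℤ → Set
  InRange M v = 0ℤ ≤ v × v < M

  cast-range : ∀ {M M′ v v′} → M ≡ M′ → v ≡ v′ → InRange M v → InRange M′ v′
  cast-range refl refl r = r

  multiple-in-window : ∀ {d} → 0ℤ < d → ∀ {i j e m} → InRange d (d * i + e - m) → InRange d (d * j + e - m) → i ≤ j
  multiple-in-window {d} 0<d {i} {j} {e} {m} (lo , hi) (lo′ , hi′) = ≤-byContradiction λ j<i →
    ⊥-cert {n = 0} (lo′ ⊕ <⇒0≤ hi ⊕ <⇒0≤ j<i ⊗ <⇒≤ 0<d) (identity d i j e m)
    where
    identity : ∀ d i j e m → d * j + e - m + (d - (d * i + e - m) - 1ℤ) + (i - j - 1ℤ) * d ≡ -[1+ 0 ]
    identity = solve-∀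

  window-count : ∀ {d} → 0ℤ < d → ∀ e m → Card (λ i → InRange d (d * i + e - m)) 1
  window-count {d} 0<d e m = card-singleton i₀ i₀-in λ i i-in →
    ≤-antisym (multiple-in-window 0<d i-in i₀-in) (multiple-in-window 0<d i₀-in i-in)
    where
    instance
      d≢0 : NonZero d
      d≢0 = >-nonZero 0<d
    i₀ : ℤ
    i₀ = - ((e - m) / d)
    remainder : d * i₀ + e - m ≡ + ((e - m) % d)
    remainder = trans (regroup d ((e - m) / d) e m)
      (trans (cong (_- ((e - m) / d) * d) (a≡a%n+[a/n]*n (e - m) d)) (cancel (+ ((e - m) % d)) ((e - m) / d * d)))
      where
      regroup : ∀ d q e m → d * (- q) + e - m ≡ (e - m) - q * d
      regroup = solve-∀
      cancel : ∀ a b → a + b - b ≡ a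
      cancel = solve-∀
    i₀-in : InRange d (d * i₀ + e - m)
    i₀-in = cast-range refl (sym remainder)
      (ℕ⇒0≤ _ , subst (+ ((e - m) % d) <_) (0≤i⇒+∣i∣≡i (<⇒≤ 0<d)) (+<+ (n%d<d (e - m) d)))

  -- The interval is a stack of n half-open windows of length `d`, each of which meets a residue
  -- class modulo `d` exactly once. The count is thus independent of the offset `e`.
  interval-count : ∀ {d} → 0ℤ < d → ∀ e n → Card (λ i → InRange (d * + n) (d * i + e)) n
  interval-count {d} 0<d e ℕ.zero = card-empty λ i (lo , hi) →
    <-irrefl refl (<-≤-trans hi (subst (_≤ d * i + e) (sym (*-zeroʳ d)) lo))
  interval-count {d} 0<d e (ℕ.suc n) =
    subst (Card _) (ℕ.+-comm n 1)
      (card-cong (λ i → [ below i , above i ]′) separate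
        (card-⊎ (interval-count 0<d e n) (window-count 0<d e (d * + n)) λ i (_ , hi) (lo , _) →
          ⊥-cert {n = 0} (<⇒0≤ hi ⊕ lo) (contra (d * i + e) (d * + n))))
    where
    contra : ∀ v m → m - v - 1ℤ + (v - m) ≡ -[1+ 0 ]
    contra = solve-∀
    below : ∀ i → InRange (d * + n) (d * i + e) → InRange (d * + ℕ.suc n) (d * i + e)
    below i (lo , hi) = lo , <-cert (<⇒0≤ hi ⊕ <⇒≤ 0<d) (identity d (+ n) (d * i + e))
      where
      identity : ∀ d n v → d * (1ℤ + n) - v - 1ℤ ≡ d * n - v - 1ℤ + d
      identity = solve-∀
    above : ∀ i → InRange d (d * i + e - d * + n) → InRange (d * + ℕ.suc n) (d * i + e)
    above i (lo , hi) = ≤-cert (lo ⊕ <⇒≤ 0<d ⊗ ℕ⇒0≤ n) (identity d (+ n) (d * i + e)) , <-cert (<⇒0≤ hi) (identity′ d (+ n) (d * i + e))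
      where
      identity : ∀ d n v → v - 0ℤ ≡ v - d * n + d * n
      identity = solve-∀
      identity′ : ∀ d n v → d * (1ℤ + n) - v - 1ℤ ≡ d - (v - d * n) - 1ℤ
      identity′ = solve-∀
    separate : ∀ i → InRange (d * + ℕ.suc n) (d * i + e) → InRange (d * + n) (d * i + e) ⊎ InRange d (d * i + e - d * + n)
    separate i (lo , hi) = [ (λ lt → inj₁ (lo , lt)) , (λ ge → inj₂ (≤⇒0≤ ge , <-cert (<⇒0≤ hi) (identity d (+ n) (d * i + e)))) ]′
      (<⊎≥ (d * i + e) (d * + n))
      where
      identity : ∀ d n v → d - (v - d * n) - 1ℤ ≡ d * (1ℤ + n) - v - 1ℤ
      identity = solve-∀

  record Bézout (p q : ℤ) : Set where
    constructor bézout
    field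
      {g a b r w} : ℤ
      p≡ga : p ≡ g * a
      q≡gb : q ≡ g * b
      ar+bw≡1 : a * r + b * w ≡ 1ℤ

  euclid-step : ∀ p q .{{_ : NonZero q}} → Bézout q (+ (p % q)) → Bézout p q
  euclid-step p q (bézout {g} {a} {b} {r} {w} q≡ga rem≡gb ar+bw≡1) =
    bézout {g = g} {b + k * a} {a} {w} {r - k * w}
      (trans (a≡a%n+[a/n]*n p q) (trans (cong₂ (λ m q → m + k * q) rem≡gb q≡ga) (regroup g a b k)))
      q≡ga
      (trans (regroup′ a b r w k) ar+bw≡1)
    where
    k = p / q
    regroup : ∀ g a b k → g * b + k * (g * a) ≡ g * (b + k * a)
    regroup = solve-∀
    regroup′ : ∀ a b r w k → (b + k * a) * w + a * (r - k * w) ≡ a * r + b * w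
    regroup′ = solve-∀

  bézout-identity : ∀ p q → Bézout p q
  bézout-identity p q = euclid ∣ q ∣ p q ℕ.≤-refl
    where
    euclid : ∀ n p q → ∣ q ∣ ℕ.≤ n → Bézout p q
    euclid n p (+ 0) _ = bézout {g = p} {1ℤ} {0ℤ} {1ℤ} {0ℤ} (sym (*-identityʳ p)) (sym (*-zeroʳ p)) refl
    euclid (ℕ.suc n) p q@(+[1+ _ ]) le =
      euclid-step p q (euclid n q (+ (p % q)) (ℕ.≤-pred (ℕ.≤-trans (n%d<d p q) le)))
    euclid (ℕ.suc n) p q@(-[1+ _ ]) le =
      euclid-step p q (euclid n q (+ (p % q)) (ℕ.≤-pred (ℕ.≤-trans (n%d<d p q) le)))

  bézout-neg : ∀ {p q} → Bézout p q → Bézout p q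
  bézout-neg (bézout {g} {a} {b} {r} {w} p≡ga q≡gb ar+bw≡1) =
    bézout {g = - g} {a = - a} {b = - b} {r = - r} {w = - w}
      (trans p≡ga (neg² g a)) (trans q≡gb (neg² g b)) (trans (cong₂ _+_ (sym (neg² a r)) (sym (neg² b w))) ar+bw≡1)
    where
    neg² : ∀ a b → a * b ≡ (- a) * (- b)
    neg² = solve-∀

  0<-cancelˡ : ∀ {g s} → 0ℤ < g → 0ℤ < g * s → 0ℤ < s
  0<-cancelˡ {g} {s} 0<g 0<gs = <-byContradiction λ s≤0 →
    ⊥-cert {n = 0} (<⇒≤ 0<g ⊗ ≤⇒0≤ s≤0 ⊕ <⇒0≤ 0<gs) (identity g s)
    where
    identity : ∀ g s → g * (0ℤ - s) + (g * s - 0ℤ - 1ℤ) ≡ -[1+ 0 ]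
    identity = solve-∀

  -- The half-open parallelogram spanned by e and e′ in the coordinates given by
  -- the linear forms (p , q) and (p′ , q′).
  record Parallelogram : Set where
    field
      p q p′ q′ e₁ e₂ e₁′ e₂′ M δ : ℤ
      0<M : 0ℤ < M
      0<δ : 0ℤ < δ
      det≡δ : p * q′ - q * p′ ≡ δ
      pe≡M : p * e₁ + q * e₂ ≡ M
      pe′≡0 : p * e₁′ + q * e₂′ ≡ 0ℤ
      p′e′≡M : p′ * e₁′ + q′ * e₂′ ≡ M

  module _ (Π : Parallelogram) where
    open Parallelogram Π

    Contains : ℤ → ℤ → ℤ × ℤ → Set
    Contains m m′ (x , y) = InRange M (p * x + q * y + m) × InRange M (p′ * x + q′ * y + m′)

    Count : Set
    Count = ∃ λ n → + n * δ ≡ M * M ×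
      (∀ m m′ → Card (Contains m m′) n)

    -- The coordinates j = a x + b y and i = r y - w x are unimodular since a r + b w = 1. In them
    -- the first form is g j and the second is δ′ i + κ j, so the points are fibred over j. With `S`
    -- the j-coordinate of e and `k` the i-coordinate of e′, there are S values of j and k values of
    -- i above each.
    count-positive : (B : Bézout p q) → 0ℤ < Bézout.g B → Count
    count-positive (bézout {g} {a} {b} {r} {w} refl refl ar+bw≡1) 0<g =
      ∣ S ∣ ℕ.* ∣ k ∣ , total , count
      where
      δ′ S k κ : ℤ
      δ′ = q′ * a - p′ * b
      S = a * e₁ + b * e₂
      k = r * e₂′ - w * e₁′
      κ = p′ * r + q′ * w
      gδ′≡δ : g * δ′ ≡ δ
      gδ′≡δ = trans (identity g a b p′ q′) det≡δ
        where
        identity : ∀ g a b p′ q′ → g * (q′ * a - p′ * b) ≡ g * a * q′ - g * b * p′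
        identity = solve-∀
      gS≡M : g * S ≡ M
      gS≡M = trans (identity g a b e₁ e₂) pe≡M
        where
        identity : ∀ g a b e₁ e₂ → g * (a * e₁ + b * e₂) ≡ g * a * e₁ + g * b * e₂
        identity = solve-∀
      ae′≡0 : a * e₁′ + b * e₂′ ≡ 0ℤ
      ae′≡0 = *-cancelˡ-≡ g _ _ {{>-nonZero 0<g}} (trans (identity g a b e₁′ e₂′) (trans pe′≡0 (sym (*-zeroʳ g))))
        where
        identity : ∀ g a b e₁ e₂ → g * (a * e₁ + b * e₂) ≡ g * a * e₁ + g * b * e₂
        identity = solve-∀
      -- The j-coordinate of e′ vanishes by `ae′≡0`, so the second form takes the value δ′ k at e′.
      δ′k≡M : δ′ * k ≡ M
      δ′k≡M = trans (identity a b r w p′ q′ e₁′ e₂′)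
        (trans (cong₂ (λ u v → u * (p′ * e₁′ + q′ * e₂′) - v * κ) ar+bw≡1 ae′≡0)
          (trans (simplify (p′ * e₁′ + q′ * e₂′) κ) p′e′≡M))
        where
        identity : ∀ a b r w p′ q′ e₁′ e₂′ → (q′ * a - p′ * b) * (r * e₂′ - w * e₁′) ≡
          (a * r + b * w) * (p′ * e₁′ + q′ * e₂′) - (a * e₁′ + b * e₂′) * (p′ * r + q′ * w)
        identity = solve-∀
        simplify : ∀ u κ → 1ℤ * u - 0ℤ * κ ≡ u
        simplify = solve-∀
      0<δ′ : 0ℤ < δ′
      0<δ′ = 0<-cancelˡ 0<g (subst (0ℤ <_) (sym gδ′≡δ) 0<δ)
      ∣S∣≡S : + ∣ S ∣ ≡ S
      ∣S∣≡S = 0≤i⇒+∣i∣≡i (<⇒≤ (0<-cancelˡ 0<g (subst (0ℤ <_) (sym gS≡M) 0<M)))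
      ∣k∣≡k : + ∣ k ∣ ≡ k
      ∣k∣≡k = 0≤i⇒+∣i∣≡i (<⇒≤ (0<-cancelˡ 0<δ′ (subst (0ℤ <_) (sym δ′k≡M) 0<M)))
      total : + (∣ S ∣ ℕ.* ∣ k ∣) * δ ≡ M * M
      total = trans (cong₂ _*_ (trans (pos-* ∣ S ∣ ∣ k ∣) (cong₂ _*_ ∣S∣≡S ∣k∣≡k)) (sym gδ′≡δ))
        (trans (identity S k g δ′) (cong₂ _*_ gS≡M δ′k≡M))
        where
        identity : ∀ S k g δ′ → (S * k) * (g * δ′) ≡ (g * S) * (δ′ * k)
        identity = solve-∀
      to-xy from-xy : ℤ × ℤ → ℤ × ℤ
      to-xy (j , i) = r * j - b * i , w * j + a * i
      from-xy (x , y) = a * x + b * y , r * y - w * x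
      unimodular : ∀ {u v} → v ≡ (a * r + b * w) * u → v ≡ u
      unimodular {u} eq = trans eq (trans (cong (_* u) ar+bw≡1) (*-identityˡ u))
      from-to : ∀ z → from-xy (to-xy z) ≡ z
      from-to (j , i) = cong₂ _,_ (unimodular (identity a b r w j i)) (unimodular (identity′ a b r w j i))
        where
        identity : ∀ a b r w j i → a * (r * j - b * i) + b * (w * j + a * i) ≡ (a * r + b * w) * j
        identity = solve-∀
        identity′ : ∀ a b r w j i → r * (w * j + a * i) - w * (r * j - b * i) ≡ (a * r + b * w) * i
        identity′ = solve-∀
      to-from : ∀ z → to-xy (from-xy z) ≡ z
      to-from (x , y) = cong₂ _,_ (unimodular (identity a b r w x y)) (unimodular (identity′ a b r w x y))
        where
        identity : ∀ a b r w x y → r * (a * x + b * y) - b * (r * y - w * x) ≡ (a * r + b * w) * x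
        identity = solve-∀
        identity′ : ∀ a b r w x y → w * (a * x + b * y) + a * (r * y - w * x) ≡ (a * r + b * w) * y
        identity′ = solve-∀
      count : ∀ m m′ → Card (Contains m m′) (∣ S ∣ ℕ.* ∣ k ∣)
      count m m′ =
        card-cong
          (λ (x , y) (R , R′) → cast-range gS (form x y) R , cast-range δ′k (form′ x y) R′)
          (λ (x , y) (R , R′) → cast-range (sym gS) (sym (form x y)) R , cast-range (sym δ′k) (sym (form′ x y)) R′)
          (card-bijection to-xy from-xy from-to to-from
            (card-fibred (interval-count 0<g m ∣ S ∣) λ j _ → interval-count 0<δ′ (κ * j + m′) ∣ k ∣))
        where
        gS : g * + ∣ S ∣ ≡ M
        gS = trans (cong (g *_) ∣S∣≡S) gS≡M
        δ′k : δ′ * + ∣ k ∣ ≡ M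
        δ′k = trans (cong (δ′ *_) ∣k∣≡k) δ′k≡M
        form : ∀ x y → g * (a * x + b * y) + m ≡ g * a * x + g * b * y + m
        form x y = identity g a b x y m
          where
          identity : ∀ g a b x y m → g * (a * x + b * y) + m ≡ g * a * x + g * b * y + m
          identity = solve-∀
        form′ : ∀ x y → δ′ * (r * y - w * x) + (κ * (a * x + b * y) + m′) ≡ p′ * x + q′ * y + m′
        form′ x y = trans (identity a b r w p′ q′ x y m′) (cong (_+ m′) (unimodular refl))
          where
          identity : ∀ a b r w p′ q′ x y m′ →
            (q′ * a - p′ * b) * (r * y - w * x) + ((p′ * r + q′ * w) * (a * x + b * y) + m′) ≡
            (a * r + b * w) * (p′ * x + q′ * y) + m′
          identity = solve-∀

    -- Euclid's algorithm leaves the sign of `g` open. A negative `g` is repaired by negating the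
    -- data, and `g = 0` would make the first form vanish although it takes the positive value `M`
    -- at e.
    parallelogram-count : Count
    parallelogram-count with bézout-identity p q
    ... | B@(bézout {+[1+ _ ]} _ _ _) = count-positive B (+<+ (ℕ.s≤s ℕ.z≤n))
    ... | B@(bézout { -[1+ _ ]} _ _ _) = count-positive (bézout-neg B) (+<+ (ℕ.s≤s ℕ.z≤n))
    ... | bézout {+ 0} {a} {b} p≡0 q≡0 _ = ⊥-elim (<-irrefl (sym M≡0) 0<M)
      where
      M≡0 : M ≡ 0ℤ
      M≡0 = trans (sym pe≡M) (trans (cong₂ (λ p q → p * e₁ + q * e₂) (trans p≡0 (*-zeroˡ a)) (trans q≡0 (*-zeroˡ b)))
        (cong₂ _+_ (*-zeroˡ e₁) (*-zeroˡ e₂)))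

-- Cutting up a parallelogram at a vertex.

module ParallelogramDissection where
  open Counting
  open IntegerArithmetic
  open LatticeParallelogram
  open import Data.Nat using (ℕ)
  import Data.Nat as ℕ
  import Data.Nat.Properties as ℕ
  open import Data.Integer
  open import Data.Integer.Properties
  open import Data.Integer.Tactic.RingSolver using (solve-∀)
  open import Data.Product using (_×_; _,_; proj₁)
  open import Data.Sum using (_⊎_; inj₁; inj₂; [_,_]′)
  open import Function.Base using (_∘_)
  open import Relation.Binary.PropositionalEquality
  open import Relation.Nullary using (¬_)

  -- `Opp k` is the interior of `Tri k` reflected in the origin.
  Tri Opp : ℤ → ℤ → ℤ → Set
  Tri k u v = 0ℤ ≤ u × 0ℤ ≤ v × u + v ≤ k
  Opp k u v = u < 0ℤ × v < 0ℤ × - k < u + v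

  cast₃ : {R : ℤ → ℤ → ℤ → Set} → ∀ {k k′ u u′ v v′} → k ≡ k′ → u ≡ u′ → v ≡ v′ → R k u v → R k′ u′ v′
  cast₃ refl refl refl r = r

  -- In coordinates (u , v) at a vertex: Square is a fundamental parallelogram,
  -- Large the triangle u + v ≤ 2M - N, Right and Upper its overhang over Square,
  -- and Corner the part of Square it misses, which is a reflected open triangle.
  module Dissection {M N : ℤ} (0≤M : 0ℤ ≤ M) where
    Square Right Upper Large Corner : ℤ → ℤ → Set
    Square u v = InRange M u × InRange M v
    Right u v = Tri (M - N) (u - M) v
    Upper u v = Tri (M - N) u (v - M)
    Large u v = Tri (M + M - N) u v
    Corner u v = Opp N (u - M) (v - M)

    square-right-disjoint : ∀ {u v} → Square u v → ¬ Right u v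
    square-right-disjoint {u} {v} ((_ , u<M) , _) (0≤u-M , _) = ⊥-cert {n = 0} (<⇒0≤ u<M ⊕ 0≤u-M) (identity u M)
      where
      identity : ∀ u m → m - u - 1ℤ + (u - m) ≡ -[1+ 0 ]
      identity = solve-∀

    square-upper-disjoint : ∀ {u v} → Square u v → ¬ Upper u v
    square-upper-disjoint {u} {v} (_ , (_ , v<M)) (_ , 0≤v-M , _) = ⊥-cert {n = 0} (<⇒0≤ v<M ⊕ 0≤v-M) (identity v M)
      where
      identity : ∀ u m → m - u - 1ℤ + (u - m) ≡ -[1+ 0 ]
      identity = solve-∀

    right⇒large : ∀ {u v} → Right u v → Large u v
    right⇒large {u} {v} (0≤u-M , 0≤v , le) = ≤-cert (0≤u-M ⊕ 0≤M) (identity u M) , 0≤v , ≤-cert (≤⇒0≤ le) (identity′ u v M N)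
      where
      identity : ∀ u m → u - 0ℤ ≡ u - m + m
      identity = solve-∀
      identity′ : ∀ u v m n → m + m - n - (u + v) ≡ m - n - (u - m + v)
      identity′ = solve-∀

    upper⇒large : ∀ {u v} → Upper u v → Large u v
    upper⇒large {u} {v} (0≤u , 0≤v-M , le) = 0≤u , ≤-cert (0≤v-M ⊕ 0≤M) (identity v M) , ≤-cert (≤⇒0≤ le) (identity′ u v M N)
      where
      identity : ∀ u m → u - 0ℤ ≡ u - m + m
      identity = solve-∀
      identity′ : ∀ u v m n → m + m - n - (u + v) ≡ m - n - (u + (v - m))
      identity′ = solve-∀

    large⇒right : ∀ {u v} → Large u v → M ≤ u → Right u v
    large⇒right {u} {v} (0≤u , 0≤v , le) M≤u = ≤⇒0≤ M≤u , 0≤v , ≤-cert (≤⇒0≤ le) (identity u v M N)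
      where
      identity : ∀ u v m n → m - n - (u - m + v) ≡ m + m - n - (u + v)
      identity = solve-∀

    large⇒upper : ∀ {u v} → Large u v → M ≤ v → Upper u v
    large⇒upper {u} {v} (0≤u , 0≤v , le) M≤v = 0≤u , ≤⇒0≤ M≤v , ≤-cert (≤⇒0≤ le) (identity u v M N)
      where
      identity : ∀ u v m n → m - n - (u + (v - m)) ≡ m + m - n - (u + v)
      identity = solve-∀

    -- The clause `u < M` separates the third piece from `Right` whatever the sign of `N`; for
    -- positive `N` it holds automatically on `Upper`, and for `N ≤ 0` the two overhangs can meet.
    large-split : ∀ {u v} → Large u v → Square u v ⊎ (Right u v ⊎ (Upper u v × u < M))
    large-split {u} {v} large@(0≤u , 0≤v , _) =
      [ (λ u<M → [ (λ v<M → inj₁ ((0≤u , u<M) , (0≤v , v<M)))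
                 , (λ M≤v → inj₂ (inj₂ (large⇒upper large M≤v , u<M))) ]′ (<⊎≥ v M))
      , (λ M≤u → inj₂ (inj₁ (large⇒right large M≤u))) ]′ (<⊎≥ u M)

    right-upper′-disjoint : ∀ {u v} → Right u v → ¬ (Upper u v × u < M)
    right-upper′-disjoint {u} {v} (0≤u-M , _) (_ , u<M) = ⊥-cert {n = 0} (<⇒0≤ u<M ⊕ 0≤u-M) (identity u M)
      where
      identity : ∀ u m → m - u - 1ℤ + (u - m) ≡ -[1+ 0 ]
      identity = solve-∀

    module Cornered (0<N : 0ℤ < N) (N≤M : N ≤ M) where

      right-upper-disjoint : ∀ {u v} → Right u v → ¬ Upper u v
      right-upper-disjoint {u} {v} (0≤u-M , _ , le) (_ , 0≤v-M , _) =
        ⊥-cert {n = 0} (0≤u-M ⊕ 0≤v-M ⊕ ≤⇒0≤ le ⊕ <⇒0≤ 0<N) (identity u v M N)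
        where
        identity : ∀ u v m n → u - m + (v - m) + (m - n - (u - m + v)) + (n - 0ℤ - 1ℤ) ≡ -[1+ 0 ]
        identity = solve-∀

      large-corner-disjoint : ∀ {u v} → Large u v → ¬ Corner u v
      large-corner-disjoint {u} {v} (_ , _ , le) (_ , _ , lt) = ⊥-cert {n = 0} (≤⇒0≤ le ⊕ <⇒0≤ lt) (identity u v M N)
        where
        identity : ∀ u v m n → m + m - n - (u + v) + (u - m + (v - m) - (- n) - 1ℤ) ≡ -[1+ 0 ]
        identity = solve-∀

      <-shift : ∀ u → u - M < 0ℤ → u < M
      <-shift u lt = <-cert (<⇒0≤ lt) (identity u M)
        where
        identity : ∀ u m → m - u - 1ℤ ≡ 0ℤ - (u - m) - 1ℤ
        identity = solve-∀

      shift-< : ∀ u → u < M → u - M < 0ℤ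
      shift-< u lt = <-cert (<⇒0≤ lt) (identity u M)
        where
        identity : ∀ u m → 0ℤ - (u - m) - 1ℤ ≡ m - u - 1ℤ
        identity = solve-∀

      corner⇒square : ∀ {u v} → Corner u v → Square u v
      corner⇒square {u} {v} (u< , v< , lt) =
        (≤-cert (<⇒0≤ lt ⊕ <⇒0≤ v< ⊕ ≤⇒0≤ N≤M ⊕ ℕ⇒0≤ 2) (identity u v M N) , <-shift u u<) ,
        (≤-cert (<⇒0≤ lt ⊕ <⇒0≤ u< ⊕ ≤⇒0≤ N≤M ⊕ ℕ⇒0≤ 2) (identity′ u v M N) , <-shift v v<)
        where
        identity : ∀ u v m n → u - 0ℤ ≡ u - m + (v - m) - (- n) - 1ℤ + (0ℤ - (v - m) - 1ℤ) + (m - n) + + 2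
        identity = solve-∀
        identity′ : ∀ u v m n → v - 0ℤ ≡ u - m + (v - m) - (- n) - 1ℤ + (0ℤ - (u - m) - 1ℤ) + (m - n) + + 2
        identity′ = solve-∀

      fwd : ∀ {u v} → Large u v ⊎ Corner u v → Square u v ⊎ (Right u v ⊎ Upper u v)
      fwd = [ [ inj₁ , inj₂ ∘ [ inj₁ , inj₂ ∘ proj₁ ]′ ]′ ∘ large-split , inj₁ ∘ corner⇒square ]′

      bwd : ∀ {u v} → Square u v ⊎ (Right u v ⊎ Upper u v) → Large u v ⊎ Corner u v
      bwd {u} {v} = [ square , inj₁ ∘ [ right⇒large , upper⇒large ]′ ]′
        where
        square : Square u v → Large u v ⊎ Corner u v
        square ((0≤u , u<M) , (0≤v , v<M)) =
          [ (λ lt → inj₂ (shift-< u u<M , shift-< v v<M , <-cert (<⇒0≤ lt) (identity u v M N)))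
          , (λ le → inj₁ (0≤u , 0≤v , le)) ]′ (<⊎≥ (M + M - N) (u + v))
          where
          identity : ∀ u v m n → u - m + (v - m) - (- n) - 1ℤ ≡ u + v - (m + m - n) - 1ℤ
          identity = solve-∀

      dissection : {A : Set} (u v : A → ℤ) → ∀ {n r s l c} →
        Card (λ z → Square (u z) (v z)) n → Card (λ z → Right (u z) (v z)) r → Card (λ z → Upper (u z) (v z)) s →
        Card (λ z → Large (u z) (v z)) l → Card (λ z → Corner (u z) (v z)) c → l ℕ.+ c ≡ n ℕ.+ (r ℕ.+ s)
      dissection u v square right upper large corner =
        card-unique
          (card-cong (λ z → fwd) (λ z → bwd) (card-⊎ large corner λ z → large-corner-disjoint))
          (card-⊎ square (card-⊎ right upper λ z → right-upper-disjoint)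
            λ z s → [ square-right-disjoint s , square-upper-disjoint s ]′)

    -- For `N ≤ 0` the large triangle covers all of `Square`, but `Right` and `Upper` overlap where
    -- `M ≤ u` on `Upper`. The overlap is assumed to be a single point, which is counted twice on
    -- the right and makes up the 1 on the left.
    dissection₀ : N ≤ 0ℤ → {A : Set} (u v : A → ℤ) → ∀ {n r s l} →
      Card (λ z → Square (u z) (v z)) n → Card (λ z → Right (u z) (v z)) r → Card (λ z → Upper (u z) (v z)) s →
      Card (λ z → Large (u z) (v z)) l → Card (λ z → Upper (u z) (v z) × M ≤ u z) 1 →
      l ℕ.+ 1 ≡ n ℕ.+ (r ℕ.+ s)
    dissection₀ N≤0 u v {n} {r} {s} {l} square right upper large corner
      with card-filter (λ z → u z <? M) upper
    ... | s′ , upper′ = trans (cong (ℕ._+ 1) l≡) (trans (ℕ.+-assoc n (r ℕ.+ s′) 1)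
        (cong (n ℕ.+_) (trans (ℕ.+-assoc r s′ 1) (cong (r ℕ.+_) s≡))))
      where
      l≡ : l ≡ n ℕ.+ (r ℕ.+ s′)
      l≡ = card-unique large (card-cong (λ z → [ square⇒large , [ right⇒large , upper⇒large ∘ proj₁ ]′ ]′) (λ z → large-split)
        (card-⊎ square (card-⊎ right upper′ λ z → right-upper′-disjoint)
          λ z s → [ square-right-disjoint s , square-upper-disjoint s ∘ proj₁ ]′))
        where
        square⇒large : ∀ {u v} → Square u v → Large u v
        square⇒large {u} {v} ((0≤u , u<M) , (0≤v , v<M)) = 0≤u , 0≤v , ≤-cert (<⇒0≤ u<M ⊕ <⇒0≤ v<M ⊕ ≤⇒0≤ N≤0 ⊕ ℕ⇒0≤ 2) (identity u v M N)
          where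
          identity : ∀ u v m n → m + m - n - (u + v) ≡ m - u - 1ℤ + (m - v - 1ℤ) + (0ℤ - n) + + 2
          identity = solve-∀
      s≡ : s′ ℕ.+ 1 ≡ s
      s≡ = card-unique (card-⊎ upper′ corner λ z (_ , lt) (_ , ge) → <-irrefl refl (<-≤-trans lt ge))
        (card-cong (λ z up → [ (λ lt → inj₁ (up , lt)) , (λ ge → inj₂ (up , ge)) ]′ (<⊎≥ (u z) M))
          (λ z → [ proj₁ , proj₁ ]′) upper)

-- Counting identities between dilates of a triangle.

module Reciprocity where
  open Counting
  open IntegerArithmetic
  open LatticeParallelogram
  open ParallelogramDissection
  open import Data.Nat using (ℕ)
  import Data.Nat as ℕ
  open import Data.Integer
  open import Data.Integer.Properties
  open import Data.Integer.Tactic.RingSolver using (solve-∀)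
  open import Data.Product using (∃; _×_; _,_)
  open import Function.Base using (_∘_)
  open import Relation.Binary.PropositionalEquality

  translate : ∀ {P : ℤ × ℤ → Set} {n} e₁ e₂ → Card P n → Card (λ (x , y) → P (x - e₁ , y - e₂)) n
  translate e₁ e₂ = card-bijection (λ (x , y) → x + e₁ , y + e₂) (λ (x , y) → x - e₁ , y - e₂)
    (λ (x , y) → cong₂ _,_ (cancel x e₁) (cancel y e₂)) (λ (x , y) → cong₂ _,_ (cancel′ x e₁) (cancel′ y e₂))
    where
    cancel : ∀ x e → x + e - e ≡ x
    cancel = solve-∀
    cancel′ : ∀ x e → x - e + e ≡ x
    cancel′ = solve-∀

  negate : ∀ {P : ℤ × ℤ → Set} {n} → Card P n → Card (λ (x , y) → P (- x , - y)) n
  negate = card-bijection (λ (x , y) → - x , - y) (λ (x , y) → - x , - y)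
    (λ (x , y) → cong₂ _,_ (neg-involutive x) (neg-involutive y)) (λ (x , y) → cong₂ _,_ (neg-involutive x) (neg-involutive y))

  -- The dilation factor `t` is a homogenising third coordinate: the form is linear in (x , y , t),
  -- and the t-th dilate is the slice of a cone at height `t`.
  value : ℤ → ℤ → ℤ → ℤ → ℤ × ℤ → ℤ
  value p q c t (x , y) = p * x + q * y + c * t

  -- The t-th dilate of the triangle with vertices a/D, b/D, c/D is the set of
  -- points at time t where the three linear forms are nonnegative; the i-th form
  -- vanishes on the edge opposite the i-th vertex.
  record IntegerTriangle : Set where
    field
      D K : ℤ
      p₁ q₁ r₁ p₂ q₂ r₂ p₃ q₃ r₃ : ℤ
      a₁ a₂ b₁ b₂ c₁ c₂ : ℤ
      0<D : 0ℤ < D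
      0<K : 0ℤ < K
      sum-p : p₁ + p₂ + p₃ ≡ 0ℤ
      sum-q : q₁ + q₂ + q₃ ≡ 0ℤ
      sum-r : r₁ + r₂ + r₃ ≡ K
      det₁₂ : p₁ * q₂ - q₁ * p₂ ≡ D * D * K
      det₂₃ : p₂ * q₃ - q₂ * p₃ ≡ D * D * K
      det₃₁ : p₃ * q₁ - q₃ * p₁ ≡ D * D * K
      2-at-a : p₂ * a₁ + q₂ * a₂ + r₂ * D ≡ 0ℤ
      3-at-a : p₃ * a₁ + q₃ * a₂ + r₃ * D ≡ 0ℤ
      1-at-b : p₁ * b₁ + q₁ * b₂ + r₁ * D ≡ 0ℤ
      2-at-b : p₂ * b₁ + q₂ * b₂ + r₂ * D ≡ K * D
      3-at-b : p₃ * b₁ + q₃ * b₂ + r₃ * D ≡ 0ℤ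
      1-at-c : p₁ * c₁ + q₁ * c₂ + r₁ * D ≡ 0ℤ
      2-at-c : p₂ * c₁ + q₂ * c₂ + r₂ * D ≡ 0ℤ
      3-at-c : p₃ * c₁ + q₃ * c₂ + r₃ * D ≡ K * D

    F₁ F₂ F₃ : ℤ → ℤ × ℤ → ℤ
    F₁ = value p₁ q₁ r₁
    F₂ = value p₂ q₂ r₂
    F₃ = value p₃ q₃ r₃

    In Int : ℤ → ℤ × ℤ → Set
    In t z = 0ℤ ≤ F₁ t z × 0ℤ ≤ F₂ t z × 0ℤ ≤ F₃ t z
    Int t z = 0ℤ < F₁ t z × 0ℤ < F₂ t z × 0ℤ < F₃ t z

    sum-F : ∀ t z → F₁ t z + F₂ t z + F₃ t z ≡ K * t
    sum-F t (x , y) = trans (identity p₁ q₁ r₁ p₂ q₂ r₂ p₃ q₃ r₃ x y t)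
      (trans (cong₂ _+_ (cong₂ (λ p q → p * x + q * y) sum-p sum-q) (cong (_* t) sum-r)) (identity′ x y (K * t)))
      where
      identity : ∀ p₁ q₁ r₁ p₂ q₂ r₂ p₃ q₃ r₃ x y t →
        p₁ * x + q₁ * y + r₁ * t + (p₂ * x + q₂ * y + r₂ * t) + (p₃ * x + q₃ * y + r₃ * t) ≡
        (p₁ + p₂ + p₃) * x + (q₁ + q₂ + q₃) * y + (r₁ + r₂ + r₃) * t
      identity = solve-∀
      identity′ : ∀ x y k → 0ℤ * x + 0ℤ * y + k ≡ k
      identity′ = solve-∀

    F₁-nonneg⇒ : ∀ {f₁ f₂ f₃ k} → f₁ + f₂ + f₃ ≡ k → 0ℤ ≤ f₁ → f₂ + f₃ ≤ k
    F₁-nonneg⇒ {f₁} {f₂} {f₃} refl 0≤f₁ = ≤-cert 0≤f₁ (identity f₁ f₂ f₃)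
      where
      identity : ∀ f₁ f₂ f₃ → f₁ + f₂ + f₃ - (f₂ + f₃) ≡ f₁
      identity = solve-∀

    F₁-nonneg⇐ : ∀ {f₁ f₂ f₃ k} → f₁ + f₂ + f₃ ≡ k → f₂ + f₃ ≤ k → 0ℤ ≤ f₁
    F₁-nonneg⇐ {f₁} {f₂} {f₃} refl le = ≤-cert (≤⇒0≤ le) (identity f₁ f₂ f₃)
      where
      identity : ∀ f₁ f₂ f₃ → f₁ - 0ℤ ≡ f₁ + f₂ + f₃ - (f₂ + f₃)
      identity = solve-∀

    In⇒Tri : ∀ t z → In t z → Tri (K * t) (F₂ t z) (F₃ t z)
    In⇒Tri t z (0≤₁ , 0≤₂ , 0≤₃) = 0≤₂ , 0≤₃ , F₁-nonneg⇒ (sum-F t z) 0≤₁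

    Tri⇒In : ∀ t z → Tri (K * t) (F₂ t z) (F₃ t z) → In t z
    Tri⇒In t z (0≤₂ , 0≤₃ , le) = F₁-nonneg⇐ (sum-F t z) le , 0≤₂ , 0≤₃

    Int⇒Opp : ∀ t z → Int t z → Opp (K * t) (- F₂ t z) (- F₃ t z)
    Int⇒Opp t z (0<₁ , 0<₂ , 0<₃) = neg-mono-< 0<₂ , neg-mono-< 0<₃ , go (sum-F t z) 0<₁
      where
      go : ∀ {f₁ f₂ f₃ k} → f₁ + f₂ + f₃ ≡ k → 0ℤ < f₁ → - k < - f₂ + - f₃
      go {f₁} {f₂} {f₃} {k} eq 0<f₁ = <-cert (<⇒0≤ 0<f₁ ⊕ ≡⇒0≤ -1ℤ eq) (identity f₁ f₂ f₃ k)
        where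
        identity : ∀ f₁ f₂ f₃ k → - f₂ + - f₃ - (- k) - 1ℤ ≡ f₁ - 0ℤ - 1ℤ + -1ℤ * (f₁ + f₂ + f₃ - k)
        identity = solve-∀

    Opp⇒Int : ∀ t z → Opp (K * t) (- F₂ t z) (- F₃ t z) → Int t z
    Opp⇒Int t z (<₂ , <₃ , lt) = go (sum-F t z) lt , neg-cancel-< <₂ , neg-cancel-< <₃
      where
      go : ∀ {f₁ f₂ f₃ k} → f₁ + f₂ + f₃ ≡ k → - k < - f₂ + - f₃ → 0ℤ < f₁
      go {f₁} {f₂} {f₃} {k} eq lt = <-cert (<⇒0≤ lt ⊕ ≡⇒0≤ 1ℤ eq) (identity f₁ f₂ f₃ k)
        where
        identity : ∀ f₁ f₂ f₃ k → f₁ - 0ℤ - 1ℤ ≡ - f₂ + - f₃ - (- k) - 1ℤ + 1ℤ * (f₁ + f₂ + f₃ - k)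
        identity = solve-∀

    -- Coordinates at the vertex a of the dilates with factor ≡ - t mod D, which
    -- are lattice translates of each other's corner at a.
    module Corner-at (s t : ℤ) where
      M N : ℤ
      M = K * D * s
      N = K * t

      u v : ℤ × ℤ → ℤ
      u = F₂ (- t)
      v = F₃ (- t)

      e₁ e₂ e₁′ e₂′ : ℤ
      e₁ = s * (b₁ - a₁)
      e₂ = s * (b₂ - a₂)
      e₁′ = s * (c₁ - a₁)
      e₂′ = s * (c₂ - a₂)

      difference : ∀ {p q r x y x′ y′ k k′} → p * x + q * y + r * D ≡ k → p * x′ + q * y′ + r * D ≡ k′ →
        p * (s * (x′ - x)) + q * (s * (y′ - y)) ≡ s * (k′ - k)
      difference {p} {q} {r} {x} {y} {x′} {y′} refl refl = identity p q r x y x′ y′ D s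
        where
        identity : ∀ p q r x y x′ y′ D s → p * (s * (x′ - x)) + q * (s * (y′ - y)) ≡
          s * (p * x′ + q * y′ + r * D - (p * x + q * y + r * D))
        identity = solve-∀

      full : s * (K * D - 0ℤ) ≡ M
      full = identity s K D
        where
        identity : ∀ s K D → s * (K * D - 0ℤ) ≡ K * D * s
        identity = solve-∀

      u-e : p₂ * e₁ + q₂ * e₂ ≡ M
      u-e = trans (difference {p₂} {q₂} {r₂} 2-at-a 2-at-b) full

      v-e : p₃ * e₁ + q₃ * e₂ ≡ 0ℤ
      v-e = trans (difference {p₃} {q₃} {r₃} 3-at-a 3-at-b) (*-zeroʳ s)

      u-e′ : p₂ * e₁′ + q₂ * e₂′ ≡ 0ℤ
      u-e′ = trans (difference {p₂} {q₂} {r₂} 2-at-a 2-at-c) (*-zeroʳ s)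

      v-e′ : p₃ * e₁′ + q₃ * e₂′ ≡ M
      v-e′ = trans (difference {p₃} {q₃} {r₃} 3-at-a 3-at-c) full

      value-shift : ∀ p q r {d₁ d₂ k} t → p * d₁ + q * d₂ ≡ k →
        ∀ ((x , y) : ℤ × ℤ) → value p q r t (x - d₁ , y - d₂) ≡ value p q r t (x , y) - k
      value-shift p q r {d₁} {d₂} t refl (x , y) = identity p q r x y d₁ d₂ t
        where
        identity : ∀ p q r x y d₁ d₂ t → p * (x - d₁) + q * (y - d₂) + r * t ≡ p * x + q * y + r * t - (p * d₁ + q * d₂)
        identity = solve-∀

      -- A form that vanishes at the vertex (d₁ , d₂) at height `D` is unchanged when k times that
      -- integral vector is added. Hence the dilates with factors D k - t can all be moved to one
      -- common corner by lattice translations.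
      value-vertex : ∀ p q r d₁ d₂ k → p * d₁ + q * d₂ + r * D ≡ 0ℤ → ∀ ((x , y) : ℤ × ℤ) →
        value p q r (D * k - t) (x - - (k * d₁) , y - - (k * d₂)) ≡ value p q r (- t) (x , y)
      value-vertex p q r d₁ d₂ k eq (x , y) =
        trans (identity p q r x y d₁ d₂ t k D) (trans (cong (λ e → p * x + q * y + r * - t + k * e) eq) (identity′ _ k))
        where
        identity : ∀ p q r x y d₁ d₂ t k D → p * (x - - (k * d₁)) + q * (y - - (k * d₂)) + r * (D * k - t) ≡
          p * x + q * y + r * - t + k * (p * d₁ + q * d₂ + r * D)
        identity = solve-∀
        identity′ : ∀ x k → x + k * 0ℤ ≡ x
        identity′ = solve-∀

      value-negate : ∀ p q r t ((x , y) : ℤ × ℤ) → - value p q r t (- x , - y) ≡ value p q r (- t) (x , y)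
      value-negate p q r t (x , y) = identity p q r t x y
        where
        identity : ∀ p q r t x y → - (p * - x + q * - y + r * t) ≡ p * x + q * y + r * - t
        identity = solve-∀

      minus-0 : ∀ x y {k} → x ≡ y - k → k ≡ 0ℤ → x ≡ y
      minus-0 x y eq refl = trans eq (+-identityʳ y)

      pull-back : (R : ℤ → ℤ → ℤ → Set) (f g f′ g′ : ℤ × ℤ → ℤ) → ∀ {k k′ n} →
        k ≡ k′ → (∀ z → f z ≡ f′ z) → (∀ z → g z ≡ g′ z) →
        Card (λ z → R k (f z) (g z)) n → Card (λ z → R k′ (f′ z) (g′ z)) n
      pull-back R f g f′ g′ k≡ f≡ g≡ = card-cong
        (λ z → cast₃ {R} k≡ (f≡ z) (g≡ z)) (λ z → cast₃ {R} (sym k≡) (sym (f≡ z)) (sym (g≡ z)))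

      closed-count : ∀ k {n} → Card (In (D * k - t)) n → Card (λ z → Tri (K * (D * k - t)) (u z) (v z)) n
      closed-count k card = pull-back Tri (F₂ (D * k - t) ∘ shift) (F₃ (D * k - t) ∘ shift) u v refl
        (value-vertex p₂ q₂ r₂ a₁ a₂ k 2-at-a) (value-vertex p₃ q₃ r₃ a₁ a₂ k 3-at-a)
        (translate (- (k * a₁)) (- (k * a₂)) (card-cong (In⇒Tri (D * k - t)) (Tri⇒In (D * k - t)) card))
        where
        shift : ℤ × ℤ → ℤ × ℤ
        shift (x , y) = x - - (k * a₁) , y - - (k * a₂)

      -- Moving the smaller dilate by e adds `M` to the first coordinate and leaves the second
      -- alone; in `upper-count` the vector e′ exchanges the two roles.
      right-count : ∀ {n} → Card (In (D * s - t)) n → Card (λ z → Tri (M - N) (u z - M) (v z)) n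
      right-count card = pull-back Tri (u ∘ shift) (v ∘ shift) (λ z → u z - M) v (identity K D s t)
        (value-shift p₂ q₂ r₂ (- t) u-e) (λ z → minus-0 (v (shift z)) (v z) (value-shift p₃ q₃ r₃ (- t) refl z) v-e)
        (translate e₁ e₂ (closed-count s card))
        where
        shift : ℤ × ℤ → ℤ × ℤ
        shift (x , y) = x - e₁ , y - e₂
        identity : ∀ K D s t → K * (D * s - t) ≡ K * D * s - K * t
        identity = solve-∀

      upper-count : ∀ {n} → Card (In (D * s - t)) n → Card (λ z → Tri (M - N) (u z) (v z - M)) n
      upper-count card = pull-back Tri (u ∘ shift) (v ∘ shift) u (λ z → v z - M) (identity K D s t)
        (λ z → minus-0 (u (shift z)) (u z) (value-shift p₂ q₂ r₂ (- t) refl z) u-e′) (value-shift p₃ q₃ r₃ (- t) v-e′)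
        (translate e₁′ e₂′ (closed-count s card))
        where
        shift : ℤ × ℤ → ℤ × ℤ
        shift (x , y) = x - e₁′ , y - e₂′
        identity : ∀ K D s t → K * (D * s - t) ≡ K * D * s - K * t
        identity = solve-∀

      large-count : ∀ {n} → Card (In (D * (s + s) - t)) n → Card (λ z → Tri (M + M - N) (u z) (v z)) n
      large-count card = pull-back Tri u v u v (identity K D s t) (λ z → refl) (λ z → refl) (closed-count (s + s) card)
        where
        identity : ∀ K D s t → K * (D * (s + s) - t) ≡ K * D * s + K * D * s - K * t
        identity = solve-∀

      -- Reflection in the origin turns the forms at height t into the negatives of `u` and `v`, and
      -- the translation by e + e′ then puts the reflected interior at the far corner (M , M) of the
      -- parallelogram.
      corner-count : ∀ {n} → Card (Int t) n → Card (λ z → Opp N (u z - M) (v z - M)) n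
      corner-count card = pull-back Opp (u ∘ shift) (v ∘ shift) (λ z → u z - M) (λ z → v z - M) refl
        (λ z → value-shift p₂ q₂ r₂ (- t) (sum-shift p₂ q₂ u-e u-e′ (+-identityʳ M)) z)
        (λ z → value-shift p₃ q₃ r₃ (- t) (sum-shift p₃ q₃ v-e v-e′ (+-identityˡ M)) z)
        (translate (e₁ + e₁′) (e₂ + e₂′)
          (pull-back Opp (-_ ∘ F₂ t ∘ flip) (-_ ∘ F₃ t ∘ flip) u v refl (value-negate p₂ q₂ r₂ t) (value-negate p₃ q₃ r₃ t)
            (negate (card-cong (Int⇒Opp t) (Opp⇒Int t) card))))
        where
        shift flip : ℤ × ℤ → ℤ × ℤ
        shift (x , y) = x - (e₁ + e₁′) , y - (e₂ + e₂′)
        flip (x , y) = - x , - y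
        sum-shift : ∀ p q {k k′ m} → p * e₁ + q * e₂ ≡ k → p * e₁′ + q * e₂′ ≡ k′ → k + k′ ≡ m →
          p * (e₁ + e₁′) + q * (e₂ + e₂′) ≡ m
        sum-shift p q refl refl refl = identity p q e₁ e₂ e₁′ e₂′
          where
          identity : ∀ p q e₁ e₂ e₁′ e₂′ → p * (e₁ + e₁′) + q * (e₂ + e₂′) ≡ p * e₁ + q * e₂ + (p * e₁′ + q * e₂′)
          identity = solve-∀

      module _ (0<s : 0ℤ < s) where
        0<M : 0ℤ < M
        0<M = 0<-* (0<-* 0<K 0<D) 0<s

        parallelogram : Parallelogram
        parallelogram = record
          { p = p₂ ; q = q₂ ; p′ = p₃ ; q′ = q₃ ; e₁ = e₁ ; e₂ = e₂ ; e₁′ = e₁′ ; e₂′ = e₂′ ; M = M ; δ = D * D * K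
          ; 0<M = 0<M ; 0<δ = 0<-* (0<-* 0<D 0<D) 0<K ; det≡δ = det₂₃
          ; pe≡M = u-e ; pe′≡0 = u-e′ ; p′e′≡M = v-e′ }

        square-count : ∃ λ n → + n ≡ K * s * s × Card (λ z → InRange M (u z) × InRange M (v z)) n
        square-count with parallelogram-count parallelogram
        ... | n , nδ≡M² , card = n , *-cancelʳ-≡ _ _ (D * D * K) {{>-nonZero (0<-* (0<-* 0<D 0<D) 0<K)}}
            (trans nδ≡M² (identity K D s)) , card (r₂ * - t) (r₃ * - t)
          where
          identity : ∀ K D s → K * D * s * (K * D * s) ≡ K * s * s * (D * D * K)
          identity = solve-∀

      coordinates-injective : ∀ z z′ → u z ≡ u z′ → v z ≡ v z′ → z ≡ z′
      coordinates-injective (x , y) (x′ , y′) u≡ v≡ = cong₂ _,_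
        (cancel (trans (identity p₂ q₂ (r₂ * - t) p₃ q₃ (r₃ * - t) x y)
          (trans (cong₂ (λ a b → (a - r₂ * - t) * q₃ - (b - r₃ * - t) * q₂) u≡ v≡) (sym (identity p₂ q₂ (r₂ * - t) p₃ q₃ (r₃ * - t) x′ y′)))))
        (cancel (trans (identity′ p₂ q₂ (r₂ * - t) p₃ q₃ (r₃ * - t) x y)
          (trans (cong₂ (λ a b → (b - r₃ * - t) * p₂ - (a - r₂ * - t) * p₃) u≡ v≡) (sym (identity′ p₂ q₂ (r₂ * - t) p₃ q₃ (r₃ * - t) x′ y′)))))
        where
        0<δ : 0ℤ < p₂ * q₃ - q₂ * p₃
        0<δ = subst (0ℤ <_) (sym det₂₃) (0<-* (0<-* 0<D 0<D) 0<K)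
        cancel : ∀ {a b} → (p₂ * q₃ - q₂ * p₃) * a ≡ (p₂ * q₃ - q₂ * p₃) * b → a ≡ b
        cancel = *-cancelˡ-≡ (p₂ * q₃ - q₂ * p₃) _ _ {{>-nonZero 0<δ}}
        identity : ∀ p q r p′ q′ r′ x y → (p * q′ - q * p′) * x ≡ (p * x + q * y + r - r) * q′ - (p′ * x + q′ * y + r′ - r′) * q
        identity = solve-∀
        identity′ : ∀ p q r p′ q′ r′ x y → (p * q′ - q * p′) * y ≡ (p′ * x + q′ * y + r′ - r′) * p - (p * x + q * y + r - r) * p′
        identity′ = solve-∀

      module _ (0<s : 0ℤ < s) {a b : ℕ} (small : Card (In (D * s - t)) a) (large : Card (In (D * (s + s) - t)) b) where

        open Dissection {M} {N} (<⇒≤ (0<M 0<s))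

        collect : ∀ c n {k} → + n ≡ k → b ℕ.+ c ≡ n ℕ.+ (a ℕ.+ a) → + b + + c ≡ k + (+ a + + a)
        collect c n refl eq = trans (sym (pos-+ b c)) (trans (cong +_ eq)
          (trans (pos-+ n (a ℕ.+ a)) (cong (_+_ (+ n)) (pos-+ a a))))

        interior-identity : 0ℤ < t → t ≤ D * s → ∀ {c} → Card (Int t) c → + b + + c ≡ K * s * s + (+ a + + a)
        interior-identity 0<t t≤Ds {c} interior = let n , n≡ , square = square-count 0<s in
          collect c n n≡ (dissection u v square (right-count small) (upper-count small) (large-count large) (corner-count interior))
          where
          N≤M : N ≤ M
          N≤M = ≤-cert (<⇒≤ 0<K ⊗ ≤⇒0≤ t≤Ds) (identity K D s t)
            where
            identity : ∀ K D s t → K * D * s - K * t ≡ K * (D * s - t)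
            identity = solve-∀
          open Cornered (0<-* 0<K 0<t) N≤M

        -- For t = 0 there is no corner left to count. Instead both overhangs contain the far corner
        -- e + e′ of the parallelogram, and share nothing else; this point is the 1.
        lattice-identity : t ≡ 0ℤ → + b + + 1 ≡ K * s * s + (+ a + + a)
        lattice-identity t≡0 = let n , n≡ , square = square-count 0<s in
          collect 1 n n≡ (dissection₀ (≤-reflexive N≡0) u v square (right-count small) (upper-count small) (large-count large)
            (card-singleton apex (upper-apex , ≤-reflexive (sym u-apex)) only-apex))
          where
          N≡0 : N ≡ 0ℤ
          N≡0 = trans (cong (K *_) t≡0) (*-zeroʳ K)
          apex : ℤ × ℤ
          apex = e₁ + e₁′ , e₂ + e₂′
          value-apex : ∀ p q r {k k′ m} → p * e₁ + q * e₂ ≡ k → p * e₁′ + q * e₂′ ≡ k′ → k + k′ ≡ m → value p q r (- t) apex ≡ m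
          value-apex p q r refl refl refl = trans (cong (λ t → p * (e₁ + e₁′) + q * (e₂ + e₂′) + r * - t) t≡0) (identity p q r e₁ e₂ e₁′ e₂′)
            where
            identity : ∀ p q r e₁ e₂ e₁′ e₂′ → p * (e₁ + e₁′) + q * (e₂ + e₂′) + r * 0ℤ ≡ p * e₁ + q * e₂ + (p * e₁′ + q * e₂′)
            identity = solve-∀
          u-apex : u apex ≡ M
          u-apex = value-apex p₂ q₂ r₂ u-e u-e′ (+-identityʳ M)
          v-apex : v apex ≡ M
          v-apex = value-apex p₃ q₃ r₃ v-e v-e′ (+-identityˡ M)
          upper-apex : Upper (u apex) (v apex)
          upper-apex = ≤-trans (<⇒≤ (0<M 0<s)) (≤-reflexive (sym u-apex)) , ≤⇒0≤ (≤-reflexive (sym v-apex)) ,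
            ≤-reflexive (top u-apex v-apex N≡0)
            where
            top : ∀ {u v m n} → u ≡ m → v ≡ m → n ≡ 0ℤ → u + (v - m) ≡ m - n
            top {u} refl refl refl = identity u
              where
              identity : ∀ u → u + (u - u) ≡ u - 0ℤ
              identity = solve-∀
          only-apex : ∀ z → Upper (u z) (v z) × M ≤ u z → z ≡ apex
          only-apex z ((_ , 0≤v-M , le) , M≤u) = coordinates-injective z apex
            (trans (u≡M (u z) (v z) M≤u 0≤v-M le N≡0) (sym u-apex)) (trans (v≡M (u z) (v z) M≤u 0≤v-M le N≡0) (sym v-apex))
            where
            u≡M : ∀ u v {m n} → m ≤ u → 0ℤ ≤ v - m → u + (v - m) ≤ m - n → n ≡ 0ℤ → u ≡ m
            u≡M u v {m} m≤u 0≤ le refl = ≤-antisym (≤-cert (0≤ ⊕ ≤⇒0≤ le) (identity u v m)) m≤u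
              where
              identity : ∀ u v m → m - u ≡ v - m + (m - 0ℤ - (u + (v - m)))
              identity = solve-∀
            v≡M : ∀ u v {m n} → m ≤ u → 0ℤ ≤ v - m → u + (v - m) ≤ m - n → n ≡ 0ℤ → v ≡ m
            v≡M u v {m} m≤u 0≤ le refl = ≤-antisym (≤-cert (≤⇒0≤ m≤u ⊕ ≤⇒0≤ le) (identity u v m)) (0≤i-j⇒j≤i 0≤)
              where
              identity : ∀ u v m → m - v ≡ u - m + (m - 0ℤ - (u + (v - m)))
              identity = solve-∀

-- Edge forms of a triangle with cleared denominators.

module TriangleForms where
  open Reciprocity
  open import Data.Integer
  open import Data.Integer.Tactic.RingSolver using (solve-∀)
  open import Relation.Binary.PropositionalEquality

  determinant : ℤ → ℤ → ℤ → ℤ → ℤ → ℤ → ℤ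
  determinant a₁ a₂ b₁ b₂ c₁ c₂ = (b₁ - a₁) * (c₂ - a₂) - (c₁ - a₁) * (b₂ - a₂)

  -- The first form is the cross product of c - b with D z - t b, where a, b, c are the numerators
  -- of the vertices over `D`; the others follow by cyclic permutation. So one set of identities,
  -- instantiated cyclically, proves all fields, and `turn` says that the determinant is cyclically
  -- invariant.
  integerTriangle : ∀ D a₁ a₂ b₁ b₂ c₁ c₂ → 0ℤ < D → 0ℤ < determinant a₁ a₂ b₁ b₂ c₁ c₂ → IntegerTriangle
  integerTriangle D a₁ a₂ b₁ b₂ c₁ c₂ 0<D 0<K = record
    { D = D ; K = determinant a₁ a₂ b₁ b₂ c₁ c₂
    ; p₁ = (b₂ - c₂) * D ; q₁ = (c₁ - b₁) * D ; r₁ = (c₂ - b₂) * b₁ - (c₁ - b₁) * b₂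
    ; p₂ = (c₂ - a₂) * D ; q₂ = (a₁ - c₁) * D ; r₂ = (a₂ - c₂) * c₁ - (a₁ - c₁) * c₂
    ; p₃ = (a₂ - b₂) * D ; q₃ = (b₁ - a₁) * D ; r₃ = (b₂ - a₂) * a₁ - (b₁ - a₁) * a₂
    ; a₁ = a₁ ; a₂ = a₂ ; b₁ = b₁ ; b₂ = b₂ ; c₁ = c₁ ; c₂ = c₂
    ; 0<D = 0<D ; 0<K = 0<K
    ; sum-p = sum-p a₂ b₂ c₂ D
    ; sum-q = sum-q a₁ b₁ c₁ D
    ; sum-r = sum-r a₁ a₂ b₁ b₂ c₁ c₂
    ; det₁₂ = trans (cross b₁ b₂ c₁ c₂ a₁ a₂ D) (cong (_*_ (D * D)) (turn a₁ a₂ b₁ b₂ c₁ c₂))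
    ; det₂₃ = trans (cross c₁ c₂ a₁ a₂ b₁ b₂ D) (cong (_*_ (D * D)) (trans (turn b₁ b₂ c₁ c₂ a₁ a₂) (turn a₁ a₂ b₁ b₂ c₁ c₂)))
    ; det₃₁ = cross a₁ a₂ b₁ b₂ c₁ c₂ D
    ; 2-at-a = end c₁ c₂ a₁ a₂ D
    ; 3-at-a = start a₁ a₂ b₁ b₂ D
    ; 1-at-b = start b₁ b₂ c₁ c₂ D
    ; 2-at-b = trans (opposite c₁ c₂ a₁ a₂ b₁ b₂ D) (cong (_* D) (trans (turn b₁ b₂ c₁ c₂ a₁ a₂) (turn a₁ a₂ b₁ b₂ c₁ c₂)))
    ; 3-at-b = end a₁ a₂ b₁ b₂ D
    ; 1-at-c = end b₁ b₂ c₁ c₂ D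
    ; 2-at-c = start c₁ c₂ a₁ a₂ D
    ; 3-at-c = opposite a₁ a₂ b₁ b₂ c₁ c₂ D
    }
    where
    sum-p : ∀ a b c D → (b - c) * D + (c - a) * D + (a - b) * D ≡ 0ℤ
    sum-p = solve-∀
    sum-q : ∀ a b c D → (c - b) * D + (a - c) * D + (b - a) * D ≡ 0ℤ
    sum-q = solve-∀
    sum-r : ∀ a₁ a₂ b₁ b₂ c₁ c₂ → (c₂ - b₂) * b₁ - (c₁ - b₁) * b₂ + ((a₂ - c₂) * c₁ - (a₁ - c₁) * c₂) +
      ((b₂ - a₂) * a₁ - (b₁ - a₁) * a₂) ≡ (b₁ - a₁) * (c₂ - a₂) - (c₁ - a₁) * (b₂ - a₂)
    sum-r = solve-∀
    turn : ∀ a₁ a₂ b₁ b₂ c₁ c₂ → (c₁ - b₁) * (a₂ - b₂) - (a₁ - b₁) * (c₂ - b₂) ≡ (b₁ - a₁) * (c₂ - a₂) - (c₁ - a₁) * (b₂ - a₂)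
    turn = solve-∀
    cross : ∀ a₁ a₂ b₁ b₂ c₁ c₂ D → (a₂ - b₂) * D * ((c₁ - b₁) * D) - (b₁ - a₁) * D * ((b₂ - c₂) * D) ≡
      D * D * ((b₁ - a₁) * (c₂ - a₂) - (c₁ - a₁) * (b₂ - a₂))
    cross = solve-∀
    start : ∀ a₁ a₂ b₁ b₂ D → (a₂ - b₂) * D * a₁ + (b₁ - a₁) * D * a₂ + ((b₂ - a₂) * a₁ - (b₁ - a₁) * a₂) * D ≡ 0ℤ
    start = solve-∀
    end : ∀ a₁ a₂ b₁ b₂ D → (a₂ - b₂) * D * b₁ + (b₁ - a₁) * D * b₂ + ((b₂ - a₂) * a₁ - (b₁ - a₁) * a₂) * D ≡ 0ℤ
    end = solve-∀
    opposite : ∀ a₁ a₂ b₁ b₂ c₁ c₂ D → (a₂ - b₂) * D * c₁ + (b₁ - a₁) * D * c₂ + ((b₂ - a₂) * a₁ - (b₁ - a₁) * a₂) * D ≡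
      ((b₁ - a₁) * (c₂ - a₂) - (c₁ - a₁) * (b₂ - a₂)) * D
    opposite = solve-∀

-- The integers as an ordered subring of the rationals.

module RationalEmbedding where
  open import Defs using (ι)
  open import Data.Integer using (ℤ; +_; 1ℤ)
  import Data.Integer as ℤ
  import Data.Integer.Properties as ℤ
  open import Data.Integer.Tactic.RingSolver using (solve-∀)
  open import Data.Rational
  open import Data.Rational.Properties
  open import Data.Rational.Unnormalised.Base using (mkℚᵘ; *≡*; *≤*; *<*)
  import Data.Rational.Unnormalised.Base as ℚᵘ
  import Data.Rational.Unnormalised.Properties as ℚᵘ
  open import Relation.Binary.PropositionalEquality

  ιᵘ : ∀ a → toℚᵘ (ι a) ℚᵘ.≃ mkℚᵘ a 0
  ιᵘ a = toℚᵘ-fromℚᵘ (mkℚᵘ a 0)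

  ι-+ : ∀ a b → ι (a ℤ.+ b) ≡ ι a + ι b
  ι-+ a b = toℚᵘ-injective (ℚᵘ.≃-trans (ιᵘ (a ℤ.+ b)) (ℚᵘ.≃-trans (*≡* (identity a b))
    (ℚᵘ.≃-sym (ℚᵘ.≃-trans (toℚᵘ-homo-+ (ι a) (ι b)) (ℚᵘ.+-cong (ιᵘ a) (ιᵘ b))))))
    where
    identity : ∀ a b → (a ℤ.+ b) ℤ.* 1ℤ ≡ (a ℤ.* 1ℤ ℤ.+ b ℤ.* 1ℤ) ℤ.* 1ℤ
    identity = solve-∀

  ι-* : ∀ a b → ι (a ℤ.* b) ≡ ι a * ι b
  ι-* a b = toℚᵘ-injective (ℚᵘ.≃-trans (ιᵘ (a ℤ.* b)) (ℚᵘ.≃-trans (*≡* refl)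
    (ℚᵘ.≃-sym (ℚᵘ.≃-trans (toℚᵘ-homo-* (ι a) (ι b)) (ℚᵘ.*-cong (ιᵘ a) (ιᵘ b))))))

  ι-neg : ∀ a → ι (ℤ.- a) ≡ - ι a
  ι-neg a = toℚᵘ-injective (ℚᵘ.≃-trans (ιᵘ (ℤ.- a)) (ℚᵘ.≃-sym (ℚᵘ.≃-trans (toℚᵘ-homo‿- (ι a)) (ℚᵘ.-‿cong (ιᵘ a)))))

  ι-minus : ∀ a b → ι (a ℤ.- b) ≡ ι a - ι b
  ι-minus a b = trans (ι-+ a (ℤ.- b)) (cong (_+_ (ι a)) (ι-neg b))

  ι-injective : ∀ {a b} → ι a ≡ ι b → a ≡ b
  ι-injective {a} {b} eq with ℚᵘ.≃-trans (ℚᵘ.≃-sym (ιᵘ a)) (ℚᵘ.≃-trans (ℚᵘ.≃-reflexive (cong toℚᵘ eq)) (ιᵘ b))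
  ... | *≡* e = trans (sym (ℤ.*-identityʳ a)) (trans e (ℤ.*-identityʳ b))

  ι-mono-≤ : ∀ {a b} → a ℤ.≤ b → ι a ≤ ι b
  ι-mono-≤ {a} {b} le = toℚᵘ-cancel-≤ (ℚᵘ.≤-respˡ-≃ (ℚᵘ.≃-sym (ιᵘ a)) (ℚᵘ.≤-respʳ-≃ (ℚᵘ.≃-sym (ιᵘ b)) (*≤* (ℤ.*-monoʳ-≤-nonNeg 1ℤ le))))

  ι-cancel-≤ : ∀ {a b} → ι a ≤ ι b → a ℤ.≤ b
  ι-cancel-≤ {a} {b} le with ℚᵘ.≤-respˡ-≃ (ιᵘ a) (ℚᵘ.≤-respʳ-≃ (ιᵘ b) (toℚᵘ-mono-≤ le))
  ... | *≤* e = subst₂ ℤ._≤_ (ℤ.*-identityʳ a) (ℤ.*-identityʳ b) e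

  ι-mono-< : ∀ {a b} → a ℤ.< b → ι a < ι b
  ι-mono-< {a} {b} a<b = ≰⇒> λ le → ℤ.<⇒≱ a<b (ι-cancel-≤ le)

  ι-cancel-< : ∀ {a b} → ι a < ι b → a ℤ.< b
  ι-cancel-< lt = ℤ.≰⇒> λ le → <-irrefl refl (<-≤-trans lt (ι-mono-≤ le))

-- Polynomials determined by a doubling relation.

module Polynomials where
  open import Defs using (evalPoly)
  open import Data.Nat using (ℕ)
  import Data.Nat as ℕ
  import Data.Nat.Properties as ℕ
  open import Data.Integer using (+_)
  open import Data.Rational
  open import Data.Rational.Properties
  open import Data.Rational.Solver using (module +-*-Solver)
  open +-*-Solver using (solve; _:+_; _:*_; _:-_; con; _:=_)
  open import Data.List using (List; []; _∷_; length)
  open import Data.List.Relation.Unary.All using (All; []; _∷_)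
  open import Data.Product using (∃; _,_)
  open import Relation.Binary.PropositionalEquality
  open import Relation.Nullary.Decidable using (from-yes)

  2ℚ : ℚ
  2ℚ = + 2 / 1

  *-cancelˡ-≢0 : ∀ {p q r} → p ≢ 0ℚ → p * q ≡ p * r → q ≡ r
  *-cancelˡ-≢0 {p} {q} {r} p≢0 eq =
    trans (inverse q) (trans (cong (1/ p *_) eq) (sym (inverse r)))
    where
    instance
      p-nonZero : NonZero p
      p-nonZero = ≢-nonZero p≢0
    inverse : ∀ q → q ≡ 1/ p * (p * q)
    inverse q = sym (trans (sym (*-assoc (1/ p) p q)) (trans (cong (_* q) (*-inverseˡ p)) (*-identityˡ q)))

  p*q≡0⇒q≡0 : ∀ {p q} → p ≢ 0ℚ → p * q ≡ 0ℚ → q ≡ 0ℚ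
  p*q≡0⇒q≡0 {p} p≢0 eq = *-cancelˡ-≢0 p≢0 (trans eq (sym (*-zeroʳ p)))

  -- The coefficients of w p(2x) - a p(x).
  doubling : ℚ → ℚ → List ℚ → List ℚ
  doubling a w [] = []
  doubling a w (c ∷ cs) = (w - a) * c ∷ doubling a (2ℚ * w) cs

  eval-doubling : ∀ a w cs x → evalPoly (doubling a w cs) x ≡ w * evalPoly cs (2ℚ * x) - a * evalPoly cs x
  eval-doubling a w [] x = solve 2 (λ a w → con 0ℚ := w :* con 0ℚ :- a :* con 0ℚ) refl a w
  eval-doubling a w (c ∷ cs) x = trans (cong (λ e → (w - a) * c + x * e) (eval-doubling a (2ℚ * w) cs x))
    (solve 6 (λ a w c x e e′ → (w :- a) :* c :+ x :* (con 2ℚ :* w :* e :- a :* e′) :=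
        w :* (c :+ con 2ℚ :* x :* e) :- a :* (c :+ x :* e′)) refl
      a w c x (evalPoly cs (2ℚ * x)) (evalPoly cs x))

  length-doubling : ∀ a w cs → length (doubling a w cs) ≡ length cs
  length-doubling a w [] = refl
  length-doubling a w (c ∷ cs) = cong ℕ.suc (length-doubling a (2ℚ * w) cs)

  -- The coefficient at degree i is multiplied by 2^i w - a, which is positive because 0 ≤ a < w.
  doubling-zero : ∀ {a w} → 0ℚ ≤ a → a < w → ∀ cs → All (_≡ 0ℚ) (doubling a w cs) → All (_≡ 0ℚ) cs
  doubling-zero 0≤a a<w [] [] = []
  doubling-zero {a} {w} 0≤a a<w (c ∷ cs) (z ∷ zs) =
    p*q≡0⇒q≡0 w-a≢0 z ∷ doubling-zero 0≤a (<-trans a<w w<2w) cs zs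
    where
    w-a≢0 : w - a ≢ 0ℚ
    w-a≢0 eq = <-irrefl (sym (trans (solve 2 (λ w a → w := w :- a :+ a) refl w a) (trans (cong (_+ a) eq) (+-identityˡ a)))) a<w
    w<2w : w < 2ℚ * w
    w<2w = subst₂ _<_ (+-identityʳ w) (solve 1 (λ w → w :+ w := con 2ℚ :* w) refl w)
      (+-monoʳ-< w (≤-<-trans 0≤a a<w))

  eval-zero : ∀ {cs} → All (_≡ 0ℚ) cs → ∀ x → evalPoly cs x ≡ 0ℚ
  eval-zero [] x = refl
  eval-zero (refl ∷ zs) x = trans (cong (λ e → 0ℚ + x * e) (eval-zero zs x)) (trans (+-identityˡ (x * 0ℚ)) (*-zeroʳ x))

  record Quadratic (cs : List ℚ) (κ : ℚ) : Set where
    constructor quadratic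
    field
      α₁ α₂ : ℚ
      2α₂≡κ : 2ℚ * α₂ ≡ κ
      eval≡ : ∀ x → evalPoly cs x ≡ 1ℚ + x * (α₁ + x * α₂)

  module _ (S : ℚ → Set) (x₀ : ℚ) (x₀∈S : S x₀) (S≢0 : ∀ {x} → S x → x ≢ 0ℚ) (S-double : ∀ {x} → S x → S (2ℚ * x)) where

    -- If p vanishes on S then so does (p(2x) - p(x)) / x, of smaller degree.
    vanishing : ∀ cs → (∀ {x} → S x → evalPoly cs x ≡ 0ℚ) → All (_≡ 0ℚ) cs
    vanishing cs = go (length cs) cs refl
      where
      go : ∀ n cs → length cs ≡ n → (∀ {x} → S x → evalPoly cs x ≡ 0ℚ) → All (_≡ 0ℚ) cs
      go _ [] _ _ = []
      go (ℕ.suc n) (c ∷ cs) len zero-on = c≡0 ∷ tail-zero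
        where
        quotient-zero : ∀ {x} → S x → evalPoly (doubling 1ℚ 2ℚ cs) x ≡ 0ℚ
        quotient-zero {x} x∈S = p*q≡0⇒q≡0 (S≢0 x∈S) (trans (cong (x *_) (eval-doubling 1ℚ 2ℚ cs x))
          (trans (solve 4 (λ c x e e′ → x :* (con 2ℚ :* e :- con 1ℚ :* e′) := (c :+ con 2ℚ :* x :* e) :- (c :+ x :* e′)) refl
              c x (evalPoly cs (2ℚ * x)) (evalPoly cs x))
            (cong₂ _-_ (zero-on (S-double x∈S)) (zero-on x∈S))))
        tail-zero : All (_≡ 0ℚ) cs
        tail-zero = doubling-zero {1ℚ} {2ℚ} (nonNegative⁻¹ 1ℚ) (from-yes (1ℚ <? 2ℚ)) cs
          (go n (doubling 1ℚ 2ℚ cs) (trans (length-doubling 1ℚ 2ℚ cs) (ℕ.suc-injective len)) quotient-zero)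
        c≡0 : c ≡ 0ℚ
        c≡0 = trans (sym (trans (cong (λ e → c + x₀ * e) (eval-zero tail-zero x₀))
          (trans (cong (_+_ c) (*-zeroʳ x₀)) (+-identityʳ c)))) (zero-on x₀∈S)

    split : ∀ cs → ∃ λ c₀ → ∃ λ c₁ → ∃ λ c₂ → ∃ λ rest →
      ∀ x → evalPoly cs x ≡ c₀ + x * (c₁ + x * (c₂ + x * evalPoly rest x))
    split [] = 0ℚ , 0ℚ , 0ℚ , [] , λ x →
      solve 1 (λ x → con 0ℚ := con 0ℚ :+ x :* (con 0ℚ :+ x :* (con 0ℚ :+ x :* con 0ℚ))) refl x
    split (a ∷ []) = a , 0ℚ , 0ℚ , [] , λ x →
      solve 2 (λ x a → a :+ x :* con 0ℚ := a :+ x :* (con 0ℚ :+ x :* (con 0ℚ :+ x :* con 0ℚ))) refl x a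
    split (a ∷ b ∷ []) = a , b , 0ℚ , [] , λ x →
      solve 3 (λ x a b → a :+ x :* (b :+ x :* con 0ℚ) := a :+ x :* (b :+ x :* (con 0ℚ :+ x :* con 0ℚ))) refl x a b
    split (a ∷ b ∷ c ∷ cs) = a , b , c , cs , λ x → refl

    -- In p(2x) - 2 p(x) the coefficient at degree i appears with the factor 2^i - 2, which is zero
    -- for i = 1 only. So the constant and quadratic coefficients are determined, the higher ones
    -- vanish, and the linear one stays free.
    doubling⇒quadratic : ∀ {κ} cs →
      (∀ {x} → S x → evalPoly cs (2ℚ * x) + 1ℚ ≡ κ * (x * x) + (evalPoly cs x + evalPoly cs x)) → Quadratic cs κ
    doubling⇒quadratic {κ} cs relation with split cs
    ... | c₀ , c₁ , c₂ , rest , eval-cs = conclude (vanishing defect defect-zero)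
      where
      -- The list `rest` begins at degree three, hence the factor 2³.
      8ℚ : ℚ
      8ℚ = + 8 / 1
      defect : List ℚ
      defect = (1ℚ - c₀) ∷ 0ℚ ∷ (2ℚ * c₂ - κ) ∷ doubling 2ℚ 8ℚ rest
      defect-zero : ∀ {x} → S x → evalPoly defect x ≡ 0ℚ
      defect-zero {x} x∈S = trans
        (trans (cong (λ e → (1ℚ - c₀) + x * (0ℚ + x * ((2ℚ * c₂ - κ) + x * e))) (eval-doubling 2ℚ 8ℚ rest x))
          (trans (solve 7 (λ c₀ c₁ c₂ κ x e e′ →
              (con 1ℚ :- c₀) :+ x :* (con 0ℚ :+ x :* ((con 2ℚ :* c₂ :- κ) :+ x :* (con 8ℚ :* e :- con 2ℚ :* e′))) :=
              ((c₀ :+ con 2ℚ :* x :* (c₁ :+ con 2ℚ :* x :* (c₂ :+ con 2ℚ :* x :* e))) :+ con 1ℚ) :-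
              (κ :* (x :* x) :+ ((c₀ :+ x :* (c₁ :+ x :* (c₂ :+ x :* e′))) :+ (c₀ :+ x :* (c₁ :+ x :* (c₂ :+ x :* e′))))))
              refl c₀ c₁ c₂ κ x (evalPoly rest (2ℚ * x)) (evalPoly rest x))
            (cong₂ (λ e e′ → (e + 1ℚ) - (κ * (x * x) + (e′ + e′))) (sym (eval-cs (2ℚ * x))) (sym (eval-cs x)))))
        (trans (cong (_- (κ * (x * x) + (evalPoly cs x + evalPoly cs x))) (relation x∈S)) (+-inverseʳ (κ * (x * x) + (evalPoly cs x + evalPoly cs x))))
      a-b≡0⇒a≡b : ∀ {a b} → a - b ≡ 0ℚ → a ≡ b
      a-b≡0⇒a≡b {a} {b} eq = trans (solve 2 (λ a b → a := a :- b :+ b) refl a b) (trans (cong (_+ b) eq) (+-identityˡ b))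
      conclude : All (_≡ 0ℚ) defect → Quadratic cs κ
      conclude (1-c₀≡0 ∷ _ ∷ 2c₂-κ≡0 ∷ zs) = quadratic c₁ c₂ (a-b≡0⇒a≡b 2c₂-κ≡0) λ x →
        trans (eval-cs x) (trans
          (cong₂ (λ c e → c + x * (c₁ + x * (c₂ + x * e))) (sym (a-b≡0⇒a≡b {1ℚ} {c₀} 1-c₀≡0)) (eval-zero rest-zero x))
          (cong (λ e → 1ℚ + x * (c₁ + x * e)) (trans (cong (_+_ c₂) (*-zeroʳ x)) (+-identityʳ c₂))))
        where
        rest-zero : All (_≡ 0ℚ) rest
        rest-zero = doubling-zero {2ℚ} {8ℚ} (nonNegative⁻¹ 2ℚ) (from-yes (2ℚ <? 8ℚ)) rest zs

-- The Ehrhart polynomial and the count of interior points.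

module Ehrhart where
  open import Defs using (ι; evalPoly)
  open Counting
  open IntegerArithmetic
  open RationalEmbedding
  open Polynomials
  open Reciprocity
  open import Data.Nat using (ℕ)
  import Data.Nat as ℕ
  open import Data.Integer using (ℤ; +_; 0ℤ; 1ℤ; +[1+_]; +<+)
  import Data.Integer as ℤ
  import Data.Integer.Properties as ℤ
  open import Data.Integer.Tactic.RingSolver using (solve-∀)
  open import Data.Rational
  open import Data.Rational.Properties
  open import Data.Rational.Solver using (module +-*-Solver)
  open +-*-Solver using (solve; _:+_; _:*_; _:-_; con; _:=_)
  open import Data.List using (List)
  open import Data.Product using (∃; _×_; _,_; proj₂)
  open import Function.Base using (_∘_)
  open import Relation.Binary.PropositionalEquality
  open import Relation.Nullary using (Dec)
  open import Relation.Nullary.Decidable using (_×-dec_)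

  module _ (Δ : IntegerTriangle) where
    open IntegerTriangle Δ

    Int⇒In : ∀ t z → Int t z → In t z
    Int⇒In t z (p , q , r) = ℤ.<⇒≤ p , ℤ.<⇒≤ q , ℤ.<⇒≤ r

    Int? : ∀ t z → Dec (Int t z)
    Int? t z = (0ℤ ℤ.<? F₁ t z) ×-dec ((0ℤ ℤ.<? F₂ t z) ×-dec (0ℤ ℤ.<? F₃ t z))

    interior-finite : ∀ {t n} → Card (In t) n → ∃ (Card (Int t))
    interior-finite {t} card with card-filter (Int? t) card
    ... | n , card′ = n , card-cong (λ z → proj₂) (λ z i → Int⇒In t z i , i) card′

    module _ (cs : List ℚ)
      (counts : (t : ℕ) → ∃ λ n → Card (In (+ ℕ.suc t)) n × evalPoly cs (ι (+ ℕ.suc t)) ≡ ι (+ n))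
      (one-interior : Card (Int 1ℤ) 1) where

      count : ∀ t → 0ℤ ℤ.< t → ∃ λ n → Card (In t) n × evalPoly cs (ι t) ≡ ι (+ n)
      count +[1+ t ] _ = counts t
      count (+ 0) (+<+ ())

      ιD≢0 : ι D ≢ 0ℚ
      ιD≢0 eq = ℤ.<-irrefl (sym (ι-injective {D} {0ℤ} eq)) 0<D

      1/D κ : ℚ
      1/D = (1/ ι D) {{≢-nonZero ιD≢0}}
      κ = ι K * (1/D * 1/D)

      κDD≡K : κ * (ι D * ι D) ≡ ι K
      κDD≡K = trans (solve 3 (λ k d e → k :* (e :* e) :* (d :* d) := k :* ((e :* d) :* (e :* d))) refl (ι K) (ι D) 1/D)
        (trans (cong (λ u → ι K * (u * u)) (*-inverseˡ (ι D) {{≢-nonZero ιD≢0}})) (*-identityʳ (ι K)))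

      ι-Kss : ∀ s → ι (K ℤ.* s ℤ.* s) ≡ κ * (ι D * ι s * (ι D * ι s))
      ι-Kss s = trans (trans (ι-* (K ℤ.* s) s) (cong (_* ι s) (ι-* K s)))
        (trans (cong (λ k → k * ι s * ι s) (sym κDD≡K))
          (solve 3 (λ k d s → k :* (d :* d) :* s :* s := k :* (d :* s :* (d :* s))) refl κ (ι D) (ι s)))

      ι-identity : ∀ s {a b c} → + b ℤ.+ + c ≡ K ℤ.* s ℤ.* s ℤ.+ (+ a ℤ.+ + a) →
        ι (+ b) + ι (+ c) ≡ κ * (ι D * ι s * (ι D * ι s)) + (ι (+ a) + ι (+ a))
      ι-identity s {a} {b} {c} eq = trans (sym (ι-+ (+ b) (+ c))) (trans (cong ι eq)
        (trans (ι-+ (K ℤ.* s ℤ.* s) (+ a ℤ.+ + a)) (cong₂ _+_ (ι-Kss s) (ι-+ (+ a) (+ a)))))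

      ι-time : ∀ s t → ι (D ℤ.* s ℤ.- t) ≡ ι D * ι s - ι t
      ι-time s t = trans (ι-minus (D ℤ.* s) t) (cong (_- ι t) (ι-* D s))

      ι-time₂ : ∀ s t → ι (D ℤ.* (s ℤ.+ s) ℤ.- t) ≡ 2ℚ * (ι D * ι s) - ι t
      ι-time₂ s t = trans (ι-time (s ℤ.+ s) t) (trans (cong (λ e → ι D * e - ι t) (ι-+ s s))
        (solve 3 (λ d s t → d :* (s :+ s) :- t := con 2ℚ :* (d :* s) :- t) refl (ι D) (ι s) (ι t)))

      private
        p : ℚ → ℚ
        p = evalPoly cs

      -- `lattice-identity` speaks about these dilation factors only. They are closed under doubling
      -- and avoid 0, so a polynomial vanishing on them is zero by `vanishing`.
      Multiple : ℚ → Set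
      Multiple x = ∃ λ s → 0ℤ ℤ.< s × x ≡ ι D * ι s

      multiple-double : ∀ {x} → Multiple x → Multiple (2ℚ * x)
      multiple-double {x} (s , 0<s , refl) = s ℤ.+ s , ℤ.+-mono-< 0<s 0<s ,
        trans (solve 2 (λ d s → con 2ℚ :* (d :* s) := d :* (s :+ s)) refl (ι D) (ι s)) (cong (ι D *_) (sym (ι-+ s s)))

      multiple-≢0 : ∀ {x} → Multiple x → x ≢ 0ℚ
      multiple-≢0 {x} (s , 0<s , refl) eq =
        ℤ.<-irrefl (sym (ι-injective {s} {0ℤ} (p*q≡0⇒q≡0 ιD≢0 eq))) 0<s

      lattice-relation : ∀ {x} → Multiple x → p (2ℚ * x) + 1ℚ ≡ κ * (x * x) + (p x + p x)
      lattice-relation (s , 0<s , refl) =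
        let 0<Ds = 0<-* 0<D 0<s
            0<2Ds = 0<-* 0<D (ℤ.+-mono-< 0<s 0<s)
            a , small , pa = count (D ℤ.* s ℤ.- 0ℤ) (subst (0ℤ ℤ.<_) (sym (ℤ.+-identityʳ (D ℤ.* s))) 0<Ds)
            b , large , pb = count (D ℤ.* (s ℤ.+ s) ℤ.- 0ℤ) (subst (0ℤ ℤ.<_) (sym (ℤ.+-identityʳ (D ℤ.* (s ℤ.+ s)))) 0<2Ds)
            x≡ = trans (ι-time s 0ℤ) (+-identityʳ (ι D * ι s))
            2x≡ = trans (ι-time₂ s 0ℤ) (+-identityʳ (2ℚ * (ι D * ι s)))
            a≡ = trans (cong p (sym x≡)) pa
            b≡ = trans (cong p (sym 2x≡)) pb
        in trans (cong (_+ 1ℚ) b≡) (trans (ι-identity s {a} {b} {1} (Corner-at.lattice-identity s 0ℤ 0<s small large refl))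
          (cong (λ e → κ * (ι D * ι s * (ι D * ι s)) + (e + e)) (sym a≡)))

      ehrhart-quadratic : Quadratic cs κ
      ehrhart-quadratic = doubling⇒quadratic Multiple (ι D * ι 1ℤ) (1ℤ , +<+ (ℕ.s≤s ℕ.z≤n) , refl)
        multiple-≢0 multiple-double {κ} cs lattice-relation

      open Quadratic ehrhart-quadratic

      -- The right-hand side is L(-t). For a quadratic L with 2 α₂ = κ, the variable x drops out of
      -- κ x² + 2 L(x - t) - L(2x - t).
      interior-count : ∀ t → 0ℤ ℤ.< t → ∀ {c} → Card (Int t) c → ι (+ c) ≡ 1ℚ - ι t * (α₁ - ι t * α₂)
      interior-count t 0<t {c} interior =
        let a , small , pa = count (D ℤ.* s ℤ.- t) 0<Ds-t
            b , large , pb = count (D ℤ.* (s ℤ.+ s) ℤ.- t) 0<2Ds-t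
            a≡ = trans (sym pa) (trans (eval≡ (ι (D ℤ.* s ℤ.- t))) (cong (λ x → 1ℚ + x * (α₁ + x * α₂)) (ι-time s t)))
            b≡ = trans (sym pb) (trans (eval≡ (ι (D ℤ.* (s ℤ.+ s) ℤ.- t))) (cong (λ x → 1ℚ + x * (α₁ + x * α₂)) (ι-time₂ s t)))
            identity = ι-identity s {a} {b} {c} (Corner-at.interior-identity s t 0<s small large 0<t (ℤ.<⇒≤ (minus-positive 0<Ds-t)) interior)
        in trans (isolate (ι (+ b)) (ι (+ c))) (trans (cong (_- ι (+ b)) identity)
          (trans (cong₂ (λ a b → κ * (ι D * ι s * (ι D * ι s)) + (a + a) - b) a≡ b≡)
            (trans (cong (λ k → k * (X * X) + (P (X - T) + P (X - T)) - P (2ℚ * X - T)) (sym 2α₂≡κ))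
              (solve 4 (λ x t α₁ α₂ → con 2ℚ :* α₂ :* (x :* x) :+
                  ((con 1ℚ :+ (x :- t) :* (α₁ :+ (x :- t) :* α₂)) :+ (con 1ℚ :+ (x :- t) :* (α₁ :+ (x :- t) :* α₂))) :-
                  (con 1ℚ :+ (con 2ℚ :* x :- t) :* (α₁ :+ (con 2ℚ :* x :- t) :* α₂)) :=
                  con 1ℚ :- t :* (α₁ :- t :* α₂)) refl X T α₁ α₂))))
        where
        -- The dilate with factor D s - t must have a positive factor; this choice works since D (t
        -- + 1) - t - 1 = (D - 1)(t + 1).
        s : ℤ
        s = t ℤ.+ 1ℤ
        X T : ℚ
        X = ι D * ι s
        T = ι t
        P : ℚ → ℚ
        P x = 1ℚ + x * (α₁ + x * α₂)
        0<s : 0ℤ ℤ.< s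
        0<s = ℤ.+-mono-< 0<t (+<+ (ℕ.s≤s ℕ.z≤n))
        0<Ds-t : 0ℤ ℤ.< D ℤ.* s ℤ.- t
        0<Ds-t = <-cert (<⇒0≤ 0<D ⊗ ℤ.<⇒≤ 0<s) (identity D t)
          where
          identity : ∀ D t → D ℤ.* (t ℤ.+ 1ℤ) ℤ.- t ℤ.- 0ℤ ℤ.- 1ℤ ≡ (D ℤ.- 0ℤ ℤ.- 1ℤ) ℤ.* (t ℤ.+ 1ℤ)
          identity = solve-∀
        0<2Ds-t : 0ℤ ℤ.< D ℤ.* (s ℤ.+ s) ℤ.- t
        0<2Ds-t = subst (0ℤ ℤ.<_) (identity D s t) (ℤ.+-mono-< (0<-* 0<D 0<s) 0<Ds-t)
          where
          identity : ∀ D s t → D ℤ.* s ℤ.+ (D ℤ.* s ℤ.- t) ≡ D ℤ.* (s ℤ.+ s) ℤ.- t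
          identity = solve-∀
        minus-positive : ∀ {i j} → 0ℤ ℤ.< i ℤ.- j → j ℤ.< i
        minus-positive {i} {j} lt = <-cert (<⇒0≤ lt) (identity i j)
          where
          identity : ∀ i j → i ℤ.- j ℤ.- 1ℤ ≡ i ℤ.- j ℤ.- 0ℤ ℤ.- 1ℤ
          identity = solve-∀
        isolate : ∀ b c → c ≡ b + c - b
        isolate = solve 2 (λ b c → c := b :+ c :- b) refl

      α₁≡α₂ : α₁ ≡ α₂
      α₁≡α₂ = trans (solve 2 (λ a b → a := b :+ con 1ℚ :- (con 1ℚ :- con 1ℚ :* (a :- con 1ℚ :* b))) refl α₁ α₂)
        (trans (cong (λ e → α₂ + 1ℚ - e) (sym (interior-count 1ℤ (+<+ (ℕ.s≤s ℕ.z≤n)) one-interior)))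
          (solve 1 (λ b → b :+ con 1ℚ :- con 1ℚ := b) refl α₂))

      -- The points of `In 1ℤ` are the b boundary points and the one interior point, so b + 1 = L(1)
      -- = 1 + α₁ + α₂ = 1 + κ.
      K≡bDD : ∀ {b} → Card (In 1ℤ) (b ℕ.+ 1) → K ≡ + b ℤ.* (D ℤ.* D)
      K≡bDD {b} card = let n , card′ , pn = counts 0 in
        ι-injective (trans (sym κDD≡K) (trans (cong (_* (ι D * ι D)) (sym (b≡κ (trans pn (cong (ι ∘ +_) (card-unique card′ card))))))
          (trans (cong (ι (+ b) *_) (sym (ι-* D D))) (sym (ι-* (+ b) (D ℤ.* D))))))
        where
        b≡κ : p (ι 1ℤ) ≡ ι (+ (b ℕ.+ 1)) → ι (+ b) ≡ κ
        b≡κ eq = trans (solve 1 (λ b → b := b :+ con 1ℚ :- con 1ℚ) refl (ι (+ b)))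
          (trans (cong (_- 1ℚ) (trans (sym (ι-+ (+ b) 1ℤ)) (trans (cong ι (sym (ℤ.pos-+ b 1))) (trans (sym eq) (eval≡ (ι 1ℤ))))))
            (trans (cong (λ c → 1ℚ + 1ℚ * (c + 1ℚ * α₂) - 1ℚ) α₁≡α₂)
              (trans (solve 1 (λ c → con 1ℚ :+ con 1ℚ :* (c :+ con 1ℚ :* c) :- con 1ℚ := con 2ℚ :* c) refl α₂) 2α₂≡κ)))

      -- With α₁ = α₂ = c the polynomial is 1 + c t (t + 1), which is symmetric about -1/2; hence
      -- L(-(t + 1)) = L(t).
      interior-of-next-dilate : ∀ t → 0ℤ ℤ.< t → ∃ λ n → Card (In t) n × Card (Int (t ℤ.+ 1ℤ)) n
      interior-of-next-dilate t 0<t =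
        let n , closed , pn = count t 0<t
            0<t+1 = ℤ.+-mono-< 0<t (+<+ (ℕ.s≤s ℕ.z≤n))
            _ , next , _ = count (t ℤ.+ 1ℤ) 0<t+1
            m , interior = interior-finite next
        in n , closed , subst (Card (Int (t ℤ.+ 1ℤ))) (ℤ.+-injective (ι-injective (trans (interior-count (t ℤ.+ 1ℤ) 0<t+1 interior)
          (trans (cong (λ T → 1ℚ - T * (α₁ - T * α₂)) (ι-+ t 1ℤ))
            (trans (cong (λ c → 1ℚ - (ι t + 1ℚ) * (c - (ι t + 1ℚ) * α₂)) α₁≡α₂)
              (trans (solve 2 (λ t c → con 1ℚ :- (t :+ con 1ℚ) :* (c :- (t :+ con 1ℚ) :* c) := con 1ℚ :+ t :* (c :+ t :* c)) refl (ι t) α₂)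
                (trans (cong (λ c → 1ℚ + ι t * (c + ι t * α₂)) (sym α₁≡α₂))
                  (trans (sym (eval≡ (ι t))) pn)))))))) interior

-- The gap between an edge line and the interior lattice points.

module Gaps where
  open IntegerArithmetic
  open Reciprocity
  open import Data.Nat using (ℕ)
  import Data.Nat as ℕ
  import Data.Nat.Properties as ℕ
  open import Data.Integer
  open import Data.Integer.Properties
  open import Data.Integer.DivMod using (_/_; _%_; a≡a%n+[a/n]*n; n%d<d)
  open import Data.Integer.Tactic.RingSolver using (solve-∀)
  open import Data.Empty using (⊥-elim)
  open import Data.Product using (∃; _×_; _,_)
  open import Relation.Binary.PropositionalEquality

  eventually-positive : ∀ a {g s} → 0ℤ < g → + ∣ a ∣ < s → 0ℤ < a + s * g
  eventually-positive a {g} {s} 0<g a<s =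
    <-cert (abs-bound a ⊕ <⇒0≤ a<s ⊕ <⇒0≤ 0<g ⊗ ≤-trans (+≤+ ℕ.z≤n) (<⇒≤ a<s)) (identity a g s (+ ∣ a ∣))
    where
    abs-bound : ∀ a → 0ℤ ≤ a + + ∣ a ∣
    abs-bound (+ n) = +≤+ ℕ.z≤n
    abs-bound (-[1+ n ]) = ≤-reflexive (sym (+-inverseˡ (+ ℕ.suc n)))
    identity : ∀ a g s k → a + s * g - 0ℤ - 1ℤ ≡ a + k + (s - k - 1ℤ) + (g - 0ℤ - 1ℤ) * s
    identity = solve-∀

  value-+ : ∀ p q r t t′ x y x′ y′ → value p q r (t + t′) (x + x′ , y + y′) ≡ value p q r t (x , y) + value p q r t′ (x′ , y′)
  value-+ = identity
    where
    identity : ∀ p q r t t′ x y x′ y′ → p * (x + x′) + q * (y + y′) + r * (t + t′) ≡ p * x + q * y + r * t + (p * x′ + q * y′ + r * t′)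
    identity = solve-∀

  value-previous : ∀ p q r t x y x₀ y₀ → value p q r t (x - x₀ , y - y₀) ≡ value p q r (t + 1ℤ) (x , y) - value p q r 1ℤ (x₀ , y₀)
  value-previous = identity
    where
    identity : ∀ p q r t x y x₀ y₀ → p * (x - x₀) + q * (y - y₀) + r * t ≡ p * x + q * y + r * (t + 1ℤ) - (p * x₀ + q * y₀ + r * 1ℤ)
    identity = solve-∀

  -- If no lattice point of a dilate lies strictly between the edge line of f and
  -- its parallel through the interior of the previous dilate, then f (without
  -- its constant term) takes only multiples of its value at z₀.
  module Gap
    (p q r p′ q′ r′ p″ q″ r″ x₀ y₀ w₁ w₂ τ : ℤ)
    (0<γ : 0ℤ < value p q r 1ℤ (x₀ , y₀))
    (gap : ∀ t z → 0ℤ < t → 0ℤ < value p q r (t + 1ℤ) z → 0ℤ < value p′ q′ r′ (t + 1ℤ) z →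
      0ℤ < value p″ q″ r″ (t + 1ℤ) z → value p q r 1ℤ (x₀ , y₀) ≤ value p q r (t + 1ℤ) z)
    (0<τ : 0ℤ < τ)
    (on-edge : value p q r τ (w₁ , w₂) ≡ 0ℤ)
    (inside′ : 0ℤ < value p′ q′ r′ τ (w₁ , w₂))
    (inside″ : 0ℤ < value p″ q″ r″ τ (w₁ , w₂))
    where

    γ : ℤ
    γ = value p q r 1ℤ (x₀ , y₀)

    instance
      γ≢0 : NonZero γ
      γ≢0 = >-nonZero 0<γ

    -- The vector (x , y) is taken at height 0. Adding k copies of z₀ at height 1 reduces the form
    -- modulo `γ`; adding s copies of the edge point at height `τ` leaves it fixed and makes the
    -- other two forms and the height positive. At the resulting point the form equals the
    -- remainder, which is below `γ`, so the gap forces it to be 0.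
    module _ (x y : ℤ) where
      n k : ℤ
      n = p * x + q * y
      k = - (n / γ)

      base : ℤ → ℤ → ℤ → ℤ
      base p q r = p * x + q * y + k * value p q r 1ℤ (x₀ , y₀)

      -- The sum exceeds each of the absolute values in it. The summand 2 makes even s - 1 exceed
      -- that of `k`, since k + s τ has to be at least 2 for `t` to be positive.
      s : ℤ
      s = + (2 ℕ.+ ∣ k ∣ ℕ.+ ∣ base p′ q′ r′ ∣ ℕ.+ ∣ base p″ q″ r″ ∣)

      point : ℤ × ℤ
      point = x + k * x₀ + s * w₁ , y + k * y₀ + s * w₂

      t : ℤ
      t = k + s * τ - 1ℤ

      value-point : ∀ p q r → value p q r (t + 1ℤ) point ≡ base p q r + s * value p q r τ (w₁ , w₂)
      value-point p q r = identity p q r x y k x₀ y₀ s w₁ w₂ τ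
        where
        identity : ∀ p q r x y k x₀ y₀ s w₁ w₂ τ →
          p * (x + k * x₀ + s * w₁) + q * (y + k * y₀ + s * w₂) + r * (k + s * τ - 1ℤ + 1ℤ) ≡
          p * x + q * y + k * (p * x₀ + q * y₀ + r * 1ℤ) + s * (p * w₁ + q * w₂ + r * τ)
        identity = solve-∀

      base-remainder : base p q r ≡ + (n % γ)
      base-remainder = trans (cong (λ m → m + k * γ) (a≡a%n+[a/n]*n n γ)) (identity (+ (n % γ)) (n / γ) γ)
        where
        identity : ∀ m d γ → m + d * γ + (- d) * γ ≡ m
        identity = solve-∀

      value-remainder : value p q r (t + 1ℤ) point ≡ + (n % γ)
      value-remainder = trans (value-point p q r) (trans (cong₂ (λ a b → a + s * b) base-remainder on-edge) (identity _ s))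
        where
        identity : ∀ m s → m + s * 0ℤ ≡ m
        identity = solve-∀

      k<s : + ∣ k ∣ + 1ℤ < s
      k<s = +<+ (ℕ.≤-trans (ℕ.≤-reflexive (cong ℕ.suc (ℕ.+-comm ∣ k ∣ 1)))
        (ℕ.≤-trans (ℕ.m≤m+n _ ∣ base p′ q′ r′ ∣) (ℕ.m≤m+n _ ∣ base p″ q″ r″ ∣)))

      base′<s : + ∣ base p′ q′ r′ ∣ < s
      base′<s = +<+ (ℕ.≤-trans (ℕ.+-monoˡ-≤ ∣ base p′ q′ r′ ∣ (ℕ.s≤s ℕ.z≤n)) (ℕ.m≤m+n _ ∣ base p″ q″ r″ ∣))

      base″<s : + ∣ base p″ q″ r″ ∣ < s
      base″<s = +<+ (ℕ.+-monoˡ-≤ ∣ base p″ q″ r″ ∣ (ℕ.s≤s ℕ.z≤n))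

      0<t : 0ℤ < t
      0<t = subst (0ℤ <_) (identity k s τ) (+-mono-<-≤ (eventually-positive k 0<τ k<s-1) (<⇒0≤ 0<τ))
        where
        k<s-1 : + ∣ k ∣ < s - 1ℤ
        k<s-1 = <-cert (<⇒0≤ k<s) (regroup (+ ∣ k ∣) s)
          where
          regroup : ∀ k s → s - 1ℤ - k - 1ℤ ≡ s - (k + 1ℤ) - 1ℤ
          regroup = solve-∀
        identity : ∀ k s τ → k + (s - 1ℤ) * τ + (τ - 0ℤ - 1ℤ) ≡ k + s * τ - 1ℤ
        identity = solve-∀

      remainder-zero : n % γ ≡ 0
      remainder-zero = no-gap (n % γ) (n%d<d n γ) value-remainder
        where
        no-gap : ∀ m → m ℕ.< ∣ γ ∣ → value p q r (t + 1ℤ) point ≡ + m → m ≡ 0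
        no-gap ℕ.zero _ _ = refl
        no-gap (ℕ.suc m) m<γ eq = ⊥-elim (<⇒≱ (subst (_< γ) (sym eq) (subst (+ ℕ.suc m <_) (0≤i⇒+∣i∣≡i (<⇒≤ 0<γ)) (+<+ m<γ)))
          (gap t point 0<t (subst (0ℤ <_) (sym eq) (+<+ (ℕ.s≤s ℕ.z≤n)))
            (subst (0ℤ <_) (sym (value-point p′ q′ r′)) (eventually-positive (base p′ q′ r′) inside′ base′<s))
            (subst (0ℤ <_) (sym (value-point p″ q″ r″)) (eventually-positive (base p″ q″ r″) inside″ base″<s))))

      multiple : p * x + q * y ≡ γ * (n / γ)
      multiple = trans (a≡a%n+[a/n]*n n γ) (trans (cong (λ m → + m + (n / γ) * γ) remainder-zero) (identity (n / γ) γ))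
        where
        identity : ∀ d γ → 0ℤ + d * γ ≡ γ * d
        identity = solve-∀

    p-multiple : ∃ λ m → p ≡ γ * m
    p-multiple = _ , trans (identity p q) (multiple 1ℤ 0ℤ)
      where
      identity : ∀ p q → p ≡ p * 1ℤ + q * 0ℤ
      identity = solve-∀

    q-multiple : ∃ λ m → q ≡ γ * m
    q-multiple = _ , trans (identity p q) (multiple 0ℤ 1ℤ)
      where
      identity : ∀ p q → q ≡ p * 0ℤ + q * 1ℤ
      identity = solve-∀

-- Integral edge normals and their weights.

module IntegralNormals where
  open Counting
  open IntegerArithmetic
  open Markov
  open Reciprocity
  open Gaps
  open import Data.Integer
  open import Data.Integer.Properties
  open import Data.Integer.Tactic.RingSolver using (solve-∀)
  open import Data.Product using (∃; _×_; _,_; proj₁; proj₂)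
  open import Data.Product.Properties using (≡-dec)
  open import Relation.Binary.PropositionalEquality

  -- With normals nᵢ = (pᵢ , qᵢ) / γᵢ, the numbers nⱼ × nₖ solve the Markov type equation.
  weights-markov : ∀ {b D K γ₁ γ₂ γ₃ w₁ w₂ w₃} → 0ℤ < D → 0ℤ < K → 0ℤ < γ₁ → 0ℤ < γ₂ → 0ℤ < γ₃ →
    γ₁ + γ₂ + γ₃ ≡ K → K ≡ b * (D * D) →
    γ₂ * γ₃ * w₁ ≡ D * D * K → γ₃ * γ₁ * w₂ ≡ D * D * K → γ₁ * γ₂ * w₃ ≡ D * D * K →
    MarkovType b w₁ w₂ w₃
  weights-markov {b} {D} {K} {γ₁} {γ₂} {γ₃} {w₁} {w₂} {w₃} 0<D 0<K 0<γ₁ 0<γ₂ 0<γ₃ Σγ≡K K≡bDD e₁ e₂ e₃ =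
    -- Multiplication by (γ₁ γ₂ γ₃)² puts every weight inside a product equal to E = D² K. The left
    -- side becomes (E K)² since the γᵢ add up to K, the right side b E³, and these agree by K = b
    -- D².
    markov (*-cancelˡ-≡ (G * G) _ _ {{>-nonZero (0<-* 0<G 0<G)}} (trans left (sym right)))
    where
    G E : ℤ
    G = γ₁ * γ₂ * γ₃
    E = D * D * K
    0<G : 0ℤ < G
    0<G = 0<-* (0<-* 0<γ₁ 0<γ₂) 0<γ₃
    left : G * G * ((w₁ + w₂ + w₃) * (w₁ + w₂ + w₃)) ≡ E * K * (E * K)
    left = trans (identity γ₁ γ₂ γ₃ w₁ w₂ w₃) (trans (cong (λ e → e * e) (total e₁ e₂ e₃)) (cong (λ k → E * k * (E * k)) Σγ≡K))
      where
      identity : ∀ γ₁ γ₂ γ₃ w₁ w₂ w₃ → γ₁ * γ₂ * γ₃ * (γ₁ * γ₂ * γ₃) * ((w₁ + w₂ + w₃) * (w₁ + w₂ + w₃)) ≡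
        (γ₁ * (γ₂ * γ₃ * w₁) + γ₂ * (γ₃ * γ₁ * w₂) + γ₃ * (γ₁ * γ₂ * w₃)) *
        (γ₁ * (γ₂ * γ₃ * w₁) + γ₂ * (γ₃ * γ₁ * w₂) + γ₃ * (γ₁ * γ₂ * w₃))
      identity = solve-∀
      distribute : ∀ γ₁ γ₂ γ₃ e → γ₁ * e + γ₂ * e + γ₃ * e ≡ e * (γ₁ + γ₂ + γ₃)
      distribute = solve-∀
      total : ∀ {e f g h} → e ≡ h → f ≡ h → g ≡ h → γ₁ * e + γ₂ * f + γ₃ * g ≡ h * (γ₁ + γ₂ + γ₃)
      total {h = h} refl refl refl = distribute γ₁ γ₂ γ₃ h
    right : G * G * (b * (w₁ * w₂ * w₃)) ≡ E * K * (E * K)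
    right = trans (identity b γ₁ γ₂ γ₃ w₁ w₂ w₃) (trans (total e₁ e₂ e₃)
      (trans (regroup b D K) (cong (λ k → E * K * (E * k)) (sym K≡bDD))))
      where
      identity : ∀ b γ₁ γ₂ γ₃ w₁ w₂ w₃ → γ₁ * γ₂ * γ₃ * (γ₁ * γ₂ * γ₃) * (b * (w₁ * w₂ * w₃)) ≡
        b * ((γ₂ * γ₃ * w₁) * (γ₃ * γ₁ * w₂) * (γ₁ * γ₂ * w₃))
      identity = solve-∀
      total : ∀ {e f g h} → e ≡ h → f ≡ h → g ≡ h → b * (e * f * g) ≡ b * (h * h * h)
      total refl refl refl = refl
      regroup : ∀ b D K → b * (D * D * K * (D * D * K) * (D * D * K)) ≡ D * D * K * K * (D * D * K * (b * (D * D)))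
      regroup = solve-∀

  module _ (Δ : IntegerTriangle) (x₀ y₀ : ℤ) (z₀-inside : IntegerTriangle.Int Δ 1ℤ (x₀ , y₀))
    (next-dilate : ∀ t → 0ℤ < t → ∃ λ n → Card (IntegerTriangle.In Δ t) n × Card (IntegerTriangle.Int Δ (t + 1ℤ)) n)
    where
    open IntegerTriangle Δ

    z₀ : ℤ × ℤ
    z₀ = x₀ , y₀

    γ₁ γ₂ γ₃ : ℤ
    γ₁ = F₁ 1ℤ z₀
    γ₂ = F₂ 1ℤ z₀
    γ₃ = F₃ 1ℤ z₀

    0<γ₁ : 0ℤ < γ₁
    0<γ₁ = proj₁ z₀-inside
    0<γ₂ : 0ℤ < γ₂
    0<γ₂ = proj₁ (proj₂ z₀-inside)
    0<γ₃ : 0ℤ < γ₃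
    0<γ₃ = proj₂ (proj₂ z₀-inside)

    move-up : ∀ p q r t → 0ℤ < value p q r 1ℤ z₀ → ∀ ((x , y) : ℤ × ℤ) → 0ℤ ≤ value p q r t (x - x₀ , y - y₀) → 0ℤ < value p q r (t + 1ℤ) (x , y)
    move-up p q r t 0<γ (x , y) 0≤v = raise (value-previous p q r t x y x₀ y₀) 0<γ 0≤v
      where
      raise : ∀ {u v w} → u ≡ v - w → 0ℤ < w → 0ℤ ≤ u → 0ℤ < v
      raise {v = v} {w} refl 0<w 0≤u = <-cert (<⇒0≤ 0<w ⊕ 0≤u) (identity v w)
        where
        identity : ∀ v w → v - 0ℤ - 1ℤ ≡ w - 0ℤ - 1ℤ + (v - w)
        identity = solve-∀

    move-down : ∀ p q r t ((x , y) : ℤ × ℤ) → 0ℤ ≤ value p q r t (x - x₀ , y - y₀) → value p q r 1ℤ z₀ ≤ value p q r (t + 1ℤ) (x , y)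
    move-down p q r t (x , y) 0≤v = 0≤i-j⇒j≤i (subst (0ℤ ≤_) (value-previous p q r t x y x₀ y₀) 0≤v)

    -- Translation by z₀ carries `In t` into `Int (t + 1ℤ)`, because the forms are additive and
    -- positive at z₀. Both sets have the same size, so the inclusion is an equality.
    interior-comes-from-previous : ∀ t → 0ℤ < t → ∀ ((x , y) : ℤ × ℤ) → Int (t + 1ℤ) (x , y) → In t (x - x₀ , y - y₀)
    interior-comes-from-previous t 0<t z interior = let n , closed , open′ = next-dilate t 0<t in
      card-⊆-≡ (≡-dec _≟_ _≟_) {λ (x , y) → In t (x - x₀ , y - y₀)} {Int (t + 1ℤ)} (translate x₀ y₀ closed) open′
        (λ z (f₁ , f₂ , f₃) → move-up p₁ q₁ r₁ t 0<γ₁ z f₁ , move-up p₂ q₂ r₂ t 0<γ₂ z f₂ , move-up p₃ q₃ r₃ t 0<γ₃ z f₃)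
        z interior

    0<KD : 0ℤ < K * D
    0<KD = 0<-* 0<K 0<D

    1-at-a : value p₁ q₁ r₁ D (a₁ , a₂) ≡ K * D
    1-at-a = drop-zeros (sum-F D (a₁ , a₂)) 2-at-a 3-at-a
      where
      drop-zeros : ∀ {u v w k} → u + v + w ≡ k → v ≡ 0ℤ → w ≡ 0ℤ → u ≡ k
      drop-zeros {u} refl refl refl = sym (trans (+-identityʳ (u + 0ℤ)) (+-identityʳ u))

    at-sum : ∀ p q r x y x′ y′ {k k′ m} → p * x + q * y + r * D ≡ k → p * x′ + q * y′ + r * D ≡ k′ → k + k′ ≡ m →
      value p q r (D + D) (x + x′ , y + y′) ≡ m
    at-sum p q r x y x′ y′ refl refl refl = value-+ p q r D D x y x′ y′

    positive-at-sum : ∀ p q r x y x′ y′ {k k′} → p * x + q * y + r * D ≡ k → p * x′ + q * y′ + r * D ≡ k′ → 0ℤ < k + k′ →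
      0ℤ < value p q r (D + D) (x + x′ , y + y′)
    positive-at-sum p q r x y x′ y′ e e′ = subst (0ℤ <_) (sym (at-sum p q r x y x′ y′ e e′ refl))

    0<KD+0 : 0ℤ < K * D + 0ℤ
    0<KD+0 = subst (0ℤ <_) (sym (+-identityʳ (K * D))) 0<KD

    0<0+KD : 0ℤ < 0ℤ + K * D
    0<0+KD = subst (0ℤ <_) (sym (+-identityˡ (K * D))) 0<KD

    -- The edge point is twice the midpoint of an edge: b + c at height D + D is a lattice point in
    -- the relative interior of the edge of that dilate, where the first form is 0 and the other two
    -- are K D.
    module Gap₁ = Gap p₁ q₁ r₁ p₂ q₂ r₂ p₃ q₃ r₃ x₀ y₀ (b₁ + c₁) (b₂ + c₂) (D + D) 0<γ₁
      (λ t z 0<t i₁ i₂ i₃ → move-down p₁ q₁ r₁ t z (proj₁ (interior-comes-from-previous t 0<t z (i₁ , i₂ , i₃))))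
      (+-mono-< 0<D 0<D) (at-sum p₁ q₁ r₁ b₁ b₂ c₁ c₂ 1-at-b 1-at-c refl)
      (positive-at-sum p₂ q₂ r₂ b₁ b₂ c₁ c₂ 2-at-b 2-at-c 0<KD+0) (positive-at-sum p₃ q₃ r₃ b₁ b₂ c₁ c₂ 3-at-b 3-at-c 0<0+KD)

    module Gap₂ = Gap p₂ q₂ r₂ p₃ q₃ r₃ p₁ q₁ r₁ x₀ y₀ (c₁ + a₁) (c₂ + a₂) (D + D) 0<γ₂
      (λ t z 0<t i₂ i₃ i₁ → move-down p₂ q₂ r₂ t z (proj₁ (proj₂ (interior-comes-from-previous t 0<t z (i₁ , i₂ , i₃)))))
      (+-mono-< 0<D 0<D) (at-sum p₂ q₂ r₂ c₁ c₂ a₁ a₂ 2-at-c 2-at-a refl)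
      (positive-at-sum p₃ q₃ r₃ c₁ c₂ a₁ a₂ 3-at-c 3-at-a 0<KD+0) (positive-at-sum p₁ q₁ r₁ c₁ c₂ a₁ a₂ 1-at-c 1-at-a 0<0+KD)

    module Gap₃ = Gap p₃ q₃ r₃ p₁ q₁ r₁ p₂ q₂ r₂ x₀ y₀ (a₁ + b₁) (a₂ + b₂) (D + D) 0<γ₃
      (λ t z 0<t i₃ i₁ i₂ → move-down p₃ q₃ r₃ t z (proj₂ (proj₂ (interior-comes-from-previous t 0<t z (i₁ , i₂ , i₃)))))
      (+-mono-< 0<D 0<D) (at-sum p₃ q₃ r₃ a₁ a₂ b₁ b₂ 3-at-a 3-at-b refl)
      (positive-at-sum p₁ q₁ r₁ a₁ a₂ b₁ b₂ 1-at-a 1-at-b 0<KD+0) (positive-at-sum p₂ q₂ r₂ a₁ a₂ b₁ b₂ 2-at-a 2-at-b 0<0+KD)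

    weight : ∀ γ γ′ m n m′ n′ {p q p′ q′ e} → p * q′ - q * p′ ≡ e →
      p ≡ γ * m → q ≡ γ * n → p′ ≡ γ′ * m′ → q′ ≡ γ′ * n′ → γ * γ′ * (m * n′ - n * m′) ≡ e
    weight γ γ′ m n m′ n′ refl refl refl refl refl = identity γ γ′ m n m′ n′
      where
      identity : ∀ γ γ′ m n m′ n′ → γ * γ′ * (m * n′ - n * m′) ≡ γ * m * (γ′ * n′) - γ * n * (γ′ * m′)
      identity = solve-∀

    0<-weight : ∀ {g w} → 0ℤ < g → g * w ≡ D * D * K → 0ℤ < w
    0<-weight {g} {w} 0<g eq = <-byContradiction λ w≤0 → ⊥-cert {n = 0}
      (<⇒≤ 0<g ⊗ ≤⇒0≤ w≤0 ⊕ ≡⇒0≤ 1ℤ eq ⊕ <⇒0≤ (0<-* (0<-* 0<D 0<D) 0<K)) (identity g w (D * D * K))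
      where
      identity : ∀ g w e → g * (0ℤ - w) + 1ℤ * (g * w - e) + (e - 0ℤ - 1ℤ) ≡ -[1+ 0 ]
      identity = solve-∀

    bound : ∀ {b} → K ≡ b * (D * D) → Conclusion b
    bound {b} K≡bDD =
      let m₁ , p₁≡ = Gap₁.p-multiple ; n₁ , q₁≡ = Gap₁.q-multiple
          m₂ , p₂≡ = Gap₂.p-multiple ; n₂ , q₂≡ = Gap₂.q-multiple
          m₃ , p₃≡ = Gap₃.p-multiple ; n₃ , q₃≡ = Gap₃.q-multiple
      in conclude (m₂ * n₃ - n₂ * m₃) (m₃ * n₁ - n₃ * m₁) (m₁ * n₂ - n₁ * m₂)
        (weight γ₂ γ₃ m₂ n₂ m₃ n₃ det₂₃ p₂≡ q₂≡ p₃≡ q₃≡) (weight γ₃ γ₁ m₃ n₃ m₁ n₁ det₃₁ p₃≡ q₃≡ p₁≡ q₁≡) (weight γ₁ γ₂ m₁ n₁ m₂ n₂ det₁₂ p₁≡ q₁≡ p₂≡ q₂≡)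
      where
      conclude : ∀ w₁ w₂ w₃ → γ₂ * γ₃ * w₁ ≡ D * D * K → γ₃ * γ₁ * w₂ ≡ D * D * K → γ₁ * γ₂ * w₃ ≡ D * D * K → Conclusion b
      conclude w₁ w₂ w₃ e₁ e₂ e₃ = markov-type-conclusion ∣ w₁ + w₂ + w₃ ∣ w₁ w₂ w₃ 0<w₁ 0<w₂ 0<w₃
        (≤-reflexive (sym (0≤i⇒+∣i∣≡i (<⇒≤ (+-mono-< (+-mono-< 0<w₁ 0<w₂) 0<w₃)))))
        (weights-markov 0<D 0<K 0<γ₁ 0<γ₂ 0<γ₃ (trans (sum-F 1ℤ z₀) (*-identityʳ K)) K≡bDD e₁ e₂ e₃)
        where
        0<w₁ = 0<-weight (0<-* 0<γ₂ 0<γ₃) e₁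
        0<w₂ = 0<-weight (0<-* 0<γ₃ 0<γ₁) e₂
        0<w₃ = 0<-weight (0<-* 0<γ₁ 0<γ₂) e₃

-- Membership and interior of a rational triangle in terms of signed areas.

module Geometry where
  open import Defs
  open import Data.Rational
  open import Data.Rational.Properties
  open import Data.Rational.Solver using (module +-*-Solver)
  open +-*-Solver using (solve; _:+_; _:*_; _:-_; :-_; con; _:=_)
  open import Data.Product using (Σ; ∃; _×_; _,_; proj₁; proj₂)
  open import Data.Sum using ([_,_]′)
  open import Relation.Binary.PropositionalEquality

  0≤-* : ∀ {p q} → 0ℚ ≤ p → 0ℚ ≤ q → 0ℚ ≤ p * q
  0≤-* {p} {q} 0≤p 0≤q = subst (_≤ p * q) (*-zeroʳ p) (*-monoˡ-≤-nonNeg p {{nonNegative 0≤p}} 0≤q)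

  0<-*ℚ : ∀ {p q} → 0ℚ < p → 0ℚ < q → 0ℚ < p * q
  0<-*ℚ {p} {q} 0<p 0<q = subst (_< p * q) (*-zeroʳ p) (*-monoʳ-<-pos p {{positive 0<p}} 0<q)

  0≤-cancel : ∀ {p q} → 0ℚ < p → 0ℚ ≤ p * q → 0ℚ ≤ q
  0≤-cancel {p} {q} 0<p 0≤pq = *-cancelˡ-≤-pos p {{positive 0<p}} (subst (_≤ p * q) (sym (*-zeroʳ p)) 0≤pq)

  0<-cancel : ∀ {p q} → 0ℚ < p → 0ℚ < p * q → 0ℚ < q
  0<-cancel {p} {q} 0<p 0<pq = ≰⇒> λ q≤0 → <-irrefl refl
    (<-≤-trans 0<pq (subst (p * q ≤_) (*-zeroʳ p) (*-monoˡ-≤-nonNeg p {{nonNegative (<⇒≤ 0<p)}} q≤0)))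

  reciprocal : ∀ {p} → 0ℚ < p → ∃ λ q → 0ℚ < q × p * q ≡ 1ℚ
  reciprocal {p} 0<p = q , positive⁻¹ q {{1/pos⇒pos p {{positive 0<p}}}} , *-inverseʳ p {{pos⇒nonZero p {{positive 0<p}}}}
    where
    q : ℚ
    q = (1/ p) {{pos⇒nonZero p {{positive 0<p}}}}

  p≤∣p∣ : ∀ p → p ≤ ∣ p ∣
  p≤∣p∣ p = [ (λ 0≤p → ≤-reflexive (sym (0≤p⇒∣p∣≡p 0≤p))) , (λ p≤0 → ≤-trans p≤0 (0≤∣p∣ p)) ]′ (≤-total 0ℚ p)

  -- Twice the signed area of the triangle bcp.
  area : Point → Point → Point → ℚ
  area (b₁ , b₂) (c₁ , c₂) (x , y) = (c₁ - b₁) * (y - b₂) - (c₂ - b₂) * (x - b₁)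

  -- The signed area is affine in the point, so an offset below ε in each coordinate changes it by
  -- at most ε times the sum norm of c - b.
  area-perturbed : ∀ b c x y {ε h k} → ∣ h ∣ < ε → ∣ k ∣ < ε →
    area b c (x , y) - (∣ proj₁ c - proj₁ b ∣ + ∣ proj₂ c - proj₂ b ∣) * ε ≤ area b c (x + h , y + k)
  area-perturbed (b₁ , b₂) (c₁ , c₂) x y {ε} {h} {k} ∣h∣<ε ∣k∣<ε =
    subst₂ _≤_ (sym (regroup g A B ε)) (sym (expand b₁ b₂ c₁ c₂ x y h k))
      (+-monoʳ-≤ g (+-mono-≤ (lower α k ∣k∣<ε) (neg-antimono-≤ (upper β h ∣h∣<ε))))
    where
    α β A B g : ℚ
    α = c₁ - b₁
    β = c₂ - b₂
    A = ∣ α ∣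
    B = ∣ β ∣
    g = α * (y - b₂) - β * (x - b₁)
    regroup : ∀ g A B ε → g - (A + B) * ε ≡ g + ((- (A * ε)) + (- (B * ε)))
    regroup = solve 4 (λ g A B ε → g :- (A :+ B) :* ε := g :+ ((:- (A :* ε)) :+ (:- (B :* ε)))) refl
    expand : ∀ b₁ b₂ c₁ c₂ x y h k → (c₁ - b₁) * (y + k - b₂) - (c₂ - b₂) * (x + h - b₁) ≡
      ((c₁ - b₁) * (y - b₂) - (c₂ - b₂) * (x - b₁)) + ((c₁ - b₁) * k + (- ((c₂ - b₂) * h)))
    expand = solve 8 (λ b₁ b₂ c₁ c₂ x y h k → (c₁ :- b₁) :* (y :+ k :- b₂) :- (c₂ :- b₂) :* (x :+ h :- b₁) :=
      ((c₁ :- b₁) :* (y :- b₂) :- (c₂ :- b₂) :* (x :- b₁)) :+ ((c₁ :- b₁) :* k :+ (:- ((c₂ :- b₂) :* h)))) refl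
    upper : ∀ a h → ∣ h ∣ < ε → a * h ≤ ∣ a ∣ * ε
    upper a h ∣h∣<ε = ≤-trans (p≤∣p∣ (a * h)) (≤-trans (≤-reflexive (∣p*q∣≡∣p∣*∣q∣ a h))
      (*-monoˡ-≤-nonNeg ∣ a ∣ {{∣-∣-nonNeg a}} (<⇒≤ ∣h∣<ε)))
    lower : ∀ a h → ∣ h ∣ < ε → - (∣ a ∣ * ε) ≤ a * h
    lower a h ∣h∣<ε = subst (- (∣ a ∣ * ε) ≤_) (solve 2 (λ a h → :- ((:- a) :* h) := a :* h) refl a h)
      (neg-antimono-≤ (subst (λ m → - a * h ≤ m * ε) (∣-p∣≡∣p∣ a) (upper (- a) h ∣h∣<ε)))

  area-open : ∀ b c x y → 0ℚ < area b c (x , y) → Σ ℚ λ ε → 0ℚ < ε ×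
    (∀ u v → ∣ u - x ∣ < ε → ∣ v - y ∣ < ε → 0ℚ ≤ area b c (u , v))
  area-open b@(b₁ , b₂) c@(c₁ , c₂) x y 0<g = neighbourhood (reciprocal 0<m)
    where
    S m g : ℚ
    S = ∣ c₁ - b₁ ∣ + ∣ c₂ - b₂ ∣
    -- The radius is ε = g / (1 + S), for which g - S ε = ε is still positive; the summand 1 keeps
    -- the divisor positive.
    m = 1ℚ + S
    g = area b c (x , y)
    0<m : 0ℚ < m
    0<m = subst (_< m) (+-identityʳ 0ℚ) (+-mono-<-≤ (positive⁻¹ 1ℚ) (subst (_≤ S) (+-identityʳ 0ℚ) (+-mono-≤ (0≤∣p∣ (c₁ - b₁)) (0≤∣p∣ (c₂ - b₂)))))
    neighbourhood : (∃ λ q → 0ℚ < q × m * q ≡ 1ℚ) → Σ ℚ λ ε → 0ℚ < ε ×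
      (∀ u v → ∣ u - x ∣ < ε → ∣ v - y ∣ < ε → 0ℚ ≤ area b c (u , v))
    neighbourhood (q , 0<q , mq≡1) = g * q , 0<-*ℚ 0<g 0<q , λ u v u-near v-near →
      subst₂ (λ u v → 0ℚ ≤ area b c (u , v)) (restore x u) (restore y v)
        (≤-trans (<⇒≤ (0<-*ℚ 0<g 0<q)) (≤-trans (≤-reflexive remaining) (area-perturbed b c x y u-near v-near)))
      where
      restore : ∀ x u → x + (u - x) ≡ u
      restore = solve 2 (λ x u → x :+ (u :- x) := u) refl
      remaining : g * q ≡ g - S * (g * q)
      remaining = trans (solve 3 (λ g q S → g :* q := g :* ((con 1ℚ :+ S) :* q) :- S :* (g :* q)) refl g q S)
        (cong (_- S * (g * q)) (trans (cong (g *_) mq≡1) (*-identityʳ g)))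

  -- Moving p = (x , y) slightly away from a leaves it in the half-plane, while
  -- area (p + δ (p - a)) = (1 + δ) area p - δ area a.
  area-strict : ∀ a b c x y {ε} → 0ℚ < area b c a → 0ℚ < ε →
    (∀ u v → ∣ u - x ∣ < ε → ∣ v - y ∣ < ε → 0ℚ ≤ area b c (u , v)) → 0ℚ < area b c (x , y)
  area-strict a@(a₁ , a₂) b@(b₁ , b₂) c@(c₁ , c₂) x y {ε} 0<area 0<ε inside = strict (reciprocal 0<m)
    where
    A B m : ℚ
    A = ∣ x - a₁ ∣
    B = ∣ y - a₂ ∣
    m = 1ℚ + (A + B)
    0<m : 0ℚ < m
    0<m = subst (_< m) (+-identityʳ 0ℚ) (+-mono-<-≤ (positive⁻¹ 1ℚ) (subst (_≤ A + B) (+-identityʳ 0ℚ) (+-mono-≤ (0≤∣p∣ (x - a₁)) (0≤∣p∣ (y - a₂)))))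
    strict : (∃ λ q → 0ℚ < q × m * q ≡ 1ℚ) → 0ℚ < area b c (x , y)
    strict (q , 0<q , mq≡1) = 0<-cancel 0<1+δ (<-≤-trans (0<-*ℚ 0<δ 0<area)
      (≤-trans (subst (_≤ δ * area b c a + area b c p′) (+-identityʳ (δ * area b c a)) (+-monoʳ-≤ (δ * area b c a) moved))
        (≤-reflexive (sym (identity a₁ a₂ b₁ b₂ c₁ c₂ x y δ)))))
      where
      δ : ℚ
      δ = ε * q
      0<δ : 0ℚ < δ
      0<δ = 0<-*ℚ 0<ε 0<q
      0<1+δ : 0ℚ < 1ℚ + δ
      0<1+δ = subst (_< 1ℚ + δ) (+-identityʳ 0ℚ) (+-mono-< (positive⁻¹ 1ℚ) 0<δ)
      p′ : Point
      p′ = x + δ * (x - a₁) , y + δ * (y - a₂)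
      small : ∀ d → ∣ d ∣ < m → ∣ δ * d ∣ < ε
      small d d<m = subst₂ _<_ (sym (trans (∣p*q∣≡∣p∣*∣q∣ δ d) (cong (_* ∣ d ∣) (0≤p⇒∣p∣≡p (<⇒≤ 0<δ)))))
        (trans (solve 3 (λ ε q m → ε :* q :* m := ε :* (m :* q)) refl ε q m) (trans (cong (ε *_) mq≡1) (*-identityʳ ε)))
        (*-monoʳ-<-pos δ {{positive 0<δ}} d<m)
      A<m : A < m
      A<m = subst (_< m) (+-identityˡ A) (+-mono-<-≤ (positive⁻¹ 1ℚ) (subst (_≤ A + B) (+-identityʳ A) (+-monoʳ-≤ A (0≤∣p∣ (y - a₂)))))
      B<m : B < m
      B<m = subst (_< m) (+-identityˡ B) (+-mono-<-≤ (positive⁻¹ 1ℚ) (subst (_≤ A + B) (+-identityˡ B) (+-monoˡ-≤ B (0≤∣p∣ (x - a₁)))))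
      added : ∀ x d → (x + d) - x ≡ d
      added = solve 2 (λ x d → (x :+ d) :- x := d) refl
      moved : 0ℚ ≤ area b c p′
      moved = inside (x + δ * (x - a₁)) (y + δ * (y - a₂)) (subst (λ d → ∣ d ∣ < ε) (sym (added x (δ * (x - a₁)))) (small (x - a₁) A<m))
        (subst (λ d → ∣ d ∣ < ε) (sym (added y (δ * (y - a₂)))) (small (y - a₂) B<m))
      identity : ∀ a₁ a₂ b₁ b₂ c₁ c₂ x y δ → (1ℚ + δ) * ((c₁ - b₁) * (y - b₂) - (c₂ - b₂) * (x - b₁)) ≡
        δ * ((c₁ - b₁) * (a₂ - b₂) - (c₂ - b₂) * (a₁ - b₁)) +
        ((c₁ - b₁) * (y + δ * (y - a₂) - b₂) - (c₂ - b₂) * (x + δ * (x - a₁) - b₁))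
      identity = solve 9 (λ a₁ a₂ b₁ b₂ c₁ c₂ x y δ → (con 1ℚ :+ δ) :* ((c₁ :- b₁) :* (y :- b₂) :- (c₂ :- b₂) :* (x :- b₁)) :=
        δ :* ((c₁ :- b₁) :* (a₂ :- b₂) :- (c₂ :- b₂) :* (a₁ :- b₁)) :+
        ((c₁ :- b₁) :* (y :+ δ :* (y :- a₂) :- b₂) :- (c₂ :- b₂) :* (x :+ δ :* (x :- a₁) :- b₁))) refl

  module _ (T : Triangle) (0<det : 0ℚ < det T) where
    private
      a b c : Point
      a = v₁ T
      b = v₂ T
      c = v₃ T

    Inside Strict : Point → Set
    Inside p = 0ℚ ≤ area b c p × 0ℚ ≤ area c a p × 0ℚ ≤ area a b p
    Strict p = 0ℚ < area b c p × 0ℚ < area c a p × 0ℚ < area a b p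

    -- Barycentric coordinates are area ratios: each one times `det T` is twice the signed area
    -- spanned by p and the opposite edge.
    ∈T⇒Inside : ∀ p → p ∈T T → Inside p
    ∈T⇒Inside (x , y) (l₁ , l₂ , l₃ , 0≤l₁ , 0≤l₂ , 0≤l₃ , Σl≡1 , refl , refl) =
      subst (0ℚ ≤_) (trans (cong (_* det T) l₁≡) (trans (identity₁ a₁ a₂ b₁ b₂ c₁ c₂ l₂ l₃) (cong at₁ (sym l₁≡)))) (0≤-* 0≤l₁ 0≤det) ,
      subst (0ℚ ≤_) (trans (identity₂ a₁ a₂ b₁ b₂ c₁ c₂ l₂ l₃) (cong at₂ (sym l₁≡))) (0≤-* 0≤l₂ 0≤det) ,
      subst (0ℚ ≤_) (trans (identity₃ a₁ a₂ b₁ b₂ c₁ c₂ l₂ l₃) (cong at₃ (sym l₁≡))) (0≤-* 0≤l₃ 0≤det)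
      where
      a₁ = proj₁ a
      a₂ = proj₂ a
      b₁ = proj₁ b
      b₂ = proj₂ b
      c₁ = proj₁ c
      c₂ = proj₂ c
      0≤det = <⇒≤ 0<det
      at₁ at₂ at₃ : ℚ → ℚ
      at₁ l = area b c (l * a₁ + (l₂ * b₁ + l₃ * c₁) , l * a₂ + (l₂ * b₂ + l₃ * c₂))
      at₂ l = area c a (l * a₁ + (l₂ * b₁ + l₃ * c₁) , l * a₂ + (l₂ * b₂ + l₃ * c₂))
      at₃ l = area a b (l * a₁ + (l₂ * b₁ + l₃ * c₁) , l * a₂ + (l₂ * b₂ + l₃ * c₂))
      -- The identities use that the coordinates add up to one, so l₁ is eliminated before they are
      -- stated as ring identities.
      l₁≡ : l₁ ≡ 1ℚ - (l₂ + l₃)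
      l₁≡ = trans (solve 2 (λ l m → l := l :+ m :- m) refl l₁ (l₂ + l₃)) (cong (_- (l₂ + l₃)) Σl≡1)
      identity₁ : ∀ a₁ a₂ b₁ b₂ c₁ c₂ l₂ l₃ → let l = 1ℚ - (l₂ + l₃) in
        l * ((b₁ - a₁) * (c₂ - a₂) - (c₁ - a₁) * (b₂ - a₂)) ≡
        (c₁ - b₁) * (l * a₂ + (l₂ * b₂ + l₃ * c₂) - b₂) - (c₂ - b₂) * (l * a₁ + (l₂ * b₁ + l₃ * c₁) - b₁)
      identity₁ = solve 8 (λ a₁ a₂ b₁ b₂ c₁ c₂ l₂ l₃ → let l = con 1ℚ :- (l₂ :+ l₃) in
        l :* ((b₁ :- a₁) :* (c₂ :- a₂) :- (c₁ :- a₁) :* (b₂ :- a₂)) :=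
        (c₁ :- b₁) :* (l :* a₂ :+ (l₂ :* b₂ :+ l₃ :* c₂) :- b₂) :- (c₂ :- b₂) :* (l :* a₁ :+ (l₂ :* b₁ :+ l₃ :* c₁) :- b₁)) refl
      identity₂ : ∀ a₁ a₂ b₁ b₂ c₁ c₂ l₂ l₃ → let l = 1ℚ - (l₂ + l₃) in
        l₂ * ((b₁ - a₁) * (c₂ - a₂) - (c₁ - a₁) * (b₂ - a₂)) ≡
        (a₁ - c₁) * (l * a₂ + (l₂ * b₂ + l₃ * c₂) - c₂) - (a₂ - c₂) * (l * a₁ + (l₂ * b₁ + l₃ * c₁) - c₁)
      identity₂ = solve 8 (λ a₁ a₂ b₁ b₂ c₁ c₂ l₂ l₃ → let l = con 1ℚ :- (l₂ :+ l₃) in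
        l₂ :* ((b₁ :- a₁) :* (c₂ :- a₂) :- (c₁ :- a₁) :* (b₂ :- a₂)) :=
        (a₁ :- c₁) :* (l :* a₂ :+ (l₂ :* b₂ :+ l₃ :* c₂) :- c₂) :- (a₂ :- c₂) :* (l :* a₁ :+ (l₂ :* b₁ :+ l₃ :* c₁) :- c₁)) refl
      identity₃ : ∀ a₁ a₂ b₁ b₂ c₁ c₂ l₂ l₃ → let l = 1ℚ - (l₂ + l₃) in
        l₃ * ((b₁ - a₁) * (c₂ - a₂) - (c₁ - a₁) * (b₂ - a₂)) ≡
        (b₁ - a₁) * (l * a₂ + (l₂ * b₂ + l₃ * c₂) - a₂) - (b₂ - a₂) * (l * a₁ + (l₂ * b₁ + l₃ * c₁) - a₁)
      identity₃ = solve 8 (λ a₁ a₂ b₁ b₂ c₁ c₂ l₂ l₃ → let l = con 1ℚ :- (l₂ :+ l₃) in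
        l₃ :* ((b₁ :- a₁) :* (c₂ :- a₂) :- (c₁ :- a₁) :* (b₂ :- a₂)) :=
        (b₁ :- a₁) :* (l :* a₂ :+ (l₂ :* b₂ :+ l₃ :* c₂) :- a₂) :- (b₂ :- a₂) :* (l :* a₁ :+ (l₂ :* b₁ :+ l₃ :* c₁) :- a₁)) refl

    Inside⇒∈T : ∀ p → Inside p → p ∈T T
    Inside⇒∈T p@(x , y) (0≤g₁ , 0≤g₂ , 0≤g₃) = barycentric (reciprocal 0<det)
      where
      a₁ = proj₁ a
      a₂ = proj₂ a
      b₁ = proj₁ b
      b₂ = proj₂ b
      c₁ = proj₁ c
      c₂ = proj₂ c
      barycentric : (∃ λ q → 0ℚ < q × det T * q ≡ 1ℚ) → p ∈T T
      barycentric (q , 0<q , dq≡1) =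
        area b c p * q , area c a p * q , area a b p * q ,
        0≤-* 0≤g₁ (<⇒≤ 0<q) , 0≤-* 0≤g₂ (<⇒≤ 0<q) , 0≤-* 0≤g₃ (<⇒≤ 0<q) ,
        trans (sum a₁ a₂ b₁ b₂ c₁ c₂ x y q) dq≡1 ,
        sym (trans (first a₁ a₂ b₁ b₂ c₁ c₂ x y q) (trans (cong (_* x) dq≡1) (*-identityˡ x))) ,
        sym (trans (second a₁ a₂ b₁ b₂ c₁ c₂ x y q) (trans (cong (_* y) dq≡1) (*-identityˡ y)))
        where
        sum : ∀ a₁ a₂ b₁ b₂ c₁ c₂ x y q →
          ((c₁ - b₁) * (y - b₂) - (c₂ - b₂) * (x - b₁)) * q +
          (((a₁ - c₁) * (y - c₂) - (a₂ - c₂) * (x - c₁)) * q + ((b₁ - a₁) * (y - a₂) - (b₂ - a₂) * (x - a₁)) * q) ≡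
          ((b₁ - a₁) * (c₂ - a₂) - (c₁ - a₁) * (b₂ - a₂)) * q
        sum = solve 9 (λ a₁ a₂ b₁ b₂ c₁ c₂ x y q →
          ((c₁ :- b₁) :* (y :- b₂) :- (c₂ :- b₂) :* (x :- b₁)) :* q :+
          (((a₁ :- c₁) :* (y :- c₂) :- (a₂ :- c₂) :* (x :- c₁)) :* q :+ ((b₁ :- a₁) :* (y :- a₂) :- (b₂ :- a₂) :* (x :- a₁)) :* q) :=
          ((b₁ :- a₁) :* (c₂ :- a₂) :- (c₁ :- a₁) :* (b₂ :- a₂)) :* q) refl
        first : ∀ a₁ a₂ b₁ b₂ c₁ c₂ x y q →
          ((c₁ - b₁) * (y - b₂) - (c₂ - b₂) * (x - b₁)) * q * a₁ +
          (((a₁ - c₁) * (y - c₂) - (a₂ - c₂) * (x - c₁)) * q * b₁ + ((b₁ - a₁) * (y - a₂) - (b₂ - a₂) * (x - a₁)) * q * c₁) ≡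
          ((b₁ - a₁) * (c₂ - a₂) - (c₁ - a₁) * (b₂ - a₂)) * q * x
        first = solve 9 (λ a₁ a₂ b₁ b₂ c₁ c₂ x y q →
          ((c₁ :- b₁) :* (y :- b₂) :- (c₂ :- b₂) :* (x :- b₁)) :* q :* a₁ :+
          (((a₁ :- c₁) :* (y :- c₂) :- (a₂ :- c₂) :* (x :- c₁)) :* q :* b₁ :+ ((b₁ :- a₁) :* (y :- a₂) :- (b₂ :- a₂) :* (x :- a₁)) :* q :* c₁) :=
          ((b₁ :- a₁) :* (c₂ :- a₂) :- (c₁ :- a₁) :* (b₂ :- a₂)) :* q :* x) refl
        second : ∀ a₁ a₂ b₁ b₂ c₁ c₂ x y q →
          ((c₁ - b₁) * (y - b₂) - (c₂ - b₂) * (x - b₁)) * q * a₂ +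
          (((a₁ - c₁) * (y - c₂) - (a₂ - c₂) * (x - c₁)) * q * b₂ + ((b₁ - a₁) * (y - a₂) - (b₂ - a₂) * (x - a₁)) * q * c₂) ≡
          ((b₁ - a₁) * (c₂ - a₂) - (c₁ - a₁) * (b₂ - a₂)) * q * y
        second = solve 9 (λ a₁ a₂ b₁ b₂ c₁ c₂ x y q →
          ((c₁ :- b₁) :* (y :- b₂) :- (c₂ :- b₂) :* (x :- b₁)) :* q :* a₂ :+
          (((a₁ :- c₁) :* (y :- c₂) :- (a₂ :- c₂) :* (x :- c₁)) :* q :* b₂ :+ ((b₁ :- a₁) :* (y :- a₂) :- (b₂ :- a₂) :* (x :- a₁)) :* q :* c₂) :=
          ((b₁ :- a₁) :* (c₂ :- a₂) :- (c₁ :- a₁) :* (b₂ :- a₂)) :* q :* y) refl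

    -- At the vertex opposite to an edge the signed area of that edge is `det T`, which is positive;
    -- thus `area-strict` applies to all three edges.
    Interior⇒Strict : ∀ p → Interior p T → Strict p
    Interior⇒Strict (x , y) (ε , 0<ε , near) =
      area-strict a b c x y (subst (0ℚ <_) (det₁ a₁ a₂ b₁ b₂ c₁ c₂) 0<det) 0<ε (λ u v hu hv → proj₁ (∈T⇒Inside (u , v) (near u v hu hv))) ,
      area-strict b c a x y (subst (0ℚ <_) (det₂ a₁ a₂ b₁ b₂ c₁ c₂) 0<det) 0<ε (λ u v hu hv → proj₁ (proj₂ (∈T⇒Inside (u , v) (near u v hu hv)))) ,
      area-strict c a b x y (subst (0ℚ <_) (det₃ a₁ a₂ b₁ b₂ c₁ c₂) 0<det) 0<ε (λ u v hu hv → proj₂ (proj₂ (∈T⇒Inside (u , v) (near u v hu hv))))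
      where
      a₁ = proj₁ a
      a₂ = proj₂ a
      b₁ = proj₁ b
      b₂ = proj₂ b
      c₁ = proj₁ c
      c₂ = proj₂ c
      det₁ : ∀ a₁ a₂ b₁ b₂ c₁ c₂ → (b₁ - a₁) * (c₂ - a₂) - (c₁ - a₁) * (b₂ - a₂) ≡ (c₁ - b₁) * (a₂ - b₂) - (c₂ - b₂) * (a₁ - b₁)
      det₁ = solve 6 (λ a₁ a₂ b₁ b₂ c₁ c₂ → (b₁ :- a₁) :* (c₂ :- a₂) :- (c₁ :- a₁) :* (b₂ :- a₂) := (c₁ :- b₁) :* (a₂ :- b₂) :- (c₂ :- b₂) :* (a₁ :- b₁)) refl
      det₂ : ∀ a₁ a₂ b₁ b₂ c₁ c₂ → (b₁ - a₁) * (c₂ - a₂) - (c₁ - a₁) * (b₂ - a₂) ≡ (a₁ - c₁) * (b₂ - c₂) - (a₂ - c₂) * (b₁ - c₁)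
      det₂ = solve 6 (λ a₁ a₂ b₁ b₂ c₁ c₂ → (b₁ :- a₁) :* (c₂ :- a₂) :- (c₁ :- a₁) :* (b₂ :- a₂) := (a₁ :- c₁) :* (b₂ :- c₂) :- (a₂ :- c₂) :* (b₁ :- c₁)) refl
      det₃ : ∀ a₁ a₂ b₁ b₂ c₁ c₂ → (b₁ - a₁) * (c₂ - a₂) - (c₁ - a₁) * (b₂ - a₂) ≡ (b₁ - a₁) * (c₂ - a₂) - (b₂ - a₂) * (c₁ - a₁)
      det₃ = solve 6 (λ a₁ a₂ b₁ b₂ c₁ c₂ → (b₁ :- a₁) :* (c₂ :- a₂) :- (c₁ :- a₁) :* (b₂ :- a₂) := (b₁ :- a₁) :* (c₂ :- a₂) :- (b₂ :- a₂) :* (c₁ :- a₁)) refl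

    Strict⇒Interior : ∀ p → Strict p → Interior p T
    Strict⇒Interior (x , y) (0<g₁ , 0<g₂ , 0<g₃) =
      let ε₁ , 0<ε₁ , near₁ = area-open b c x y 0<g₁
          ε₂ , 0<ε₂ , near₂ = area-open c a x y 0<g₂
          ε₃ , 0<ε₃ , near₃ = area-open a b x y 0<g₃
          ≤₁ = p⊓q≤p ε₁ (ε₂ ⊓ ε₃)
          ≤₂ = ≤-trans (p⊓q≤q ε₁ (ε₂ ⊓ ε₃)) (p⊓q≤p ε₂ ε₃)
          ≤₃ = ≤-trans (p⊓q≤q ε₁ (ε₂ ⊓ ε₃)) (p⊓q≤q ε₂ ε₃)
      in ε₁ ⊓ (ε₂ ⊓ ε₃) , <-⊓ 0<ε₁ (<-⊓ 0<ε₂ 0<ε₃) , λ u v hu hv → Inside⇒∈T (u , v)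
        ( near₁ u v (<-≤-trans hu ≤₁) (<-≤-trans hv ≤₁)
        , near₂ u v (<-≤-trans hu ≤₂) (<-≤-trans hv ≤₂)
        , near₃ u v (<-≤-trans hu ≤₃) (<-≤-trans hv ≤₃))
      where
      <-⊓ : ∀ {p q} → 0ℚ < p → 0ℚ < q → 0ℚ < p ⊓ q
      <-⊓ {p} {q} 0<p 0<q = [ (λ p≤q → subst (0ℚ <_) (sym (p≤q⇒p⊓q≡p p≤q)) 0<p)
                            , (λ q≤p → subst (0ℚ <_) (sym (p≥q⇒p⊓q≡q q≤p)) 0<q) ]′ (≤-total p q)

-- From the rational triangle to the integer forms.

module Denominators where
  open import Defs
  open Counting
  open IntegerArithmetic
  open RationalEmbedding
  open Reciprocity
  open TriangleForms
  open Ehrhart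
  open IntegralNormals using (bound)
  open Markov using (Conclusion)
  open Geometry
  open import Data.Nat using (ℕ)
  import Data.Nat as ℕ
  open import Data.Integer using (ℤ; +_; 0ℤ; 1ℤ; +<+)
  import Data.Integer as ℤ
  import Data.Integer.Properties as ℤ
  open import Data.Integer.Tactic.RingSolver using (solve-∀)
  open import Data.Rational
  open import Data.Rational.Properties
  open import Data.Rational.Unnormalised.Base using (mkℚᵘ; *≡*)
  import Data.Rational.Unnormalised.Properties as ℚᵘ
  open import Data.Rational.Solver using (module +-*-Solver)
  open +-*-Solver using (solve; _:+_; _:*_; _:-_; _:=_)
  open import Data.Product using (Σ; ∃; _×_; _,_; proj₁; proj₂)
  open import Data.Sum using (_⊎_; inj₁; inj₂; [_,_]′)
  open import Function.Base using (_∘_)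
  open import Relation.Binary.PropositionalEquality
  open import Relation.Nullary using (Dec; yes; no; contradiction)

  numerator : ∀ q → q * ι (↧ q) ≡ ι (↥ q)
  numerator q@record{} = toℚᵘ-injective (ℚᵘ.≃-trans (toℚᵘ-homo-* q (ι (↧ q)))
    (ℚᵘ.≃-trans (ℚᵘ.*-cong (ℚᵘ.≃-refl {toℚᵘ q}) (ιᵘ (↧ q))) (ℚᵘ.≃-trans (*≡* (identity (↥ q) (↧ q))) (ℚᵘ.≃-sym (ιᵘ (↥ q))))))
    where
    identity : ∀ n d → n ℤ.* d ℤ.* 1ℤ ≡ n ℤ.* (d ℤ.* 1ℤ)
    identity = solve-∀

  Clears : ℤ → Point → Set
  Clears D (x , y) = Σ (ℤ × ℤ) λ (X , Y) → x * ι D ≡ ι X × y * ι D ≡ ι Y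

  clears-multiple : ∀ D E p → Clears D p → Clears (D ℤ.* E) p
  clears-multiple D E (x , y) ((X , Y) , x≡ , y≡) = (X ℤ.* E , Y ℤ.* E) , scale x X x≡ , scale y Y y≡
    where
    scale : ∀ q n → q * ι D ≡ ι n → q * ι (D ℤ.* E) ≡ ι (n ℤ.* E)
    scale q n eq = trans (cong (q *_) (ι-* D E)) (trans (sym (*-assoc q (ι D) (ι E))) (trans (cong (_* ι E) eq) (sym (ι-* n E))))

  clears-point : ∀ p → ∃ λ D → 0ℤ ℤ.< D × Clears D p
  clears-point (x , y) = ↧ x ℤ.* ↧ y , 0<-* (ℤ.positive⁻¹ (↧ x)) (ℤ.positive⁻¹ (↧ y)) ,
    (↥ x ℤ.* ↧ y , ↥ y ℤ.* ↧ x) , scale x (↧ y) , trans (cong (λ d → y * ι d) (ℤ.*-comm (↧ x) (↧ y))) (scale y (↧ x))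
    where
    scale : ∀ q e → q * ι (↧ q ℤ.* e) ≡ ι (↥ q ℤ.* e)
    scale q e = trans (cong (q *_) (ι-* (↧ q) e)) (trans (sym (*-assoc q (ι (↧ q)) (ι e))) (trans (cong (_* ι e) (numerator q)) (sym (ι-* (↥ q) e))))

  common-denominator : ∀ p q r → ∃ λ D → 0ℤ ℤ.< D × Clears D p × Clears D q × Clears D r
  common-denominator p q r =
    let D , 0<D , P = clears-point p
        E , 0<E , Q = clears-point q
        F , 0<F , R = clears-point r
    in D ℤ.* E ℤ.* F , 0<-* (0<-* 0<D 0<E) 0<F ,
       clears-multiple (D ℤ.* E) F p (clears-multiple D E p P) ,
       clears-multiple (D ℤ.* E) F q (subst (λ m → Clears m q) (ℤ.*-comm E D) (clears-multiple E D q Q)) ,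
       subst (λ m → Clears m r) (ℤ.*-comm F (D ℤ.* E)) (clears-multiple F (D ℤ.* E) r R)


  module _ (T : Triangle) (0<det : 0ℚ < det T) (D : ℤ) (0<D : 0ℤ ℤ.< D)
    (clears-a : Clears D (v₁ T)) (clears-b : Clears D (v₂ T)) (clears-c : Clears D (v₃ T)) where
    private
      A₁ A₂ B₁ B₂ C₁ C₂ : ℤ
      A₁ = proj₁ (proj₁ clears-a)
      A₂ = proj₂ (proj₁ clears-a)
      B₁ = proj₁ (proj₁ clears-b)
      B₂ = proj₂ (proj₁ clears-b)
      C₁ = proj₁ (proj₁ clears-c)
      C₂ = proj₂ (proj₁ clears-c)
      d : ℚ
      d = ι D

    0<d : 0ℚ < d
    0<d = ι-mono-< 0<D

    ι-scaled-difference : ∀ p q P Q → p * d ≡ ι P → q * d ≡ ι Q → ι (P ℤ.- Q) ≡ (p - q) * d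
    ι-scaled-difference p q P Q p≡ q≡ = trans (ι-minus P Q) (trans (cong₂ _-_ (sym p≡) (sym q≡))
      (solve 3 (λ p q d → p :* d :- q :* d := (p :- q) :* d) refl p q d))

    ι-cross : ∀ P Q R S {p q r s} → ι P ≡ p → ι Q ≡ q → ι R ≡ r → ι S ≡ s → ι (P ℤ.* Q ℤ.- R ℤ.* S) ≡ p * q - r * s
    ι-cross P Q R S refl refl refl refl = trans (ι-minus (P ℤ.* Q) (R ℤ.* S)) (cong₂ _-_ (ι-* P Q) (ι-* R S))

    0<K : 0ℤ ℤ.< determinant A₁ A₂ B₁ B₂ C₁ C₂
    0<K = ι-cancel-< {0ℤ} (subst (0ℚ <_)
      (sym (trans (ι-cross (B₁ ℤ.- A₁) (C₂ ℤ.- A₂) (C₁ ℤ.- A₁) (B₂ ℤ.- A₂)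
          (ι-scaled-difference (proj₁ (v₂ T)) (proj₁ (v₁ T)) B₁ A₁ b₁≡ a₁≡) (ι-scaled-difference (proj₂ (v₃ T)) (proj₂ (v₁ T)) C₂ A₂ c₂≡ a₂≡) (ι-scaled-difference (proj₁ (v₃ T)) (proj₁ (v₁ T)) C₁ A₁ c₁≡ a₁≡) (ι-scaled-difference (proj₂ (v₂ T)) (proj₂ (v₁ T)) B₂ A₂ b₂≡ a₂≡))
        (solve 5 (λ p q r s d → p :* d :* (q :* d) :- r :* d :* (s :* d) := d :* d :* (p :* q :- r :* s)) refl
          (proj₁ (v₂ T) - proj₁ (v₁ T)) (proj₂ (v₃ T) - proj₂ (v₁ T)) (proj₁ (v₃ T) - proj₁ (v₁ T)) (proj₂ (v₂ T) - proj₂ (v₁ T)) d)))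
      (0<-*ℚ (0<-*ℚ 0<d 0<d) 0<det))
      where
      a₁≡ = proj₁ (proj₂ clears-a)
      a₂≡ = proj₂ (proj₂ clears-a)
      b₁≡ = proj₁ (proj₂ clears-b)
      b₂≡ = proj₂ (proj₂ clears-b)
      c₁≡ = proj₁ (proj₂ clears-c)
      c₂≡ = proj₂ (proj₂ clears-c)

    Δ : IntegerTriangle
    Δ = integerTriangle D A₁ A₂ B₁ B₂ C₁ C₂ 0<D 0<K

    open IntegerTriangle Δ using (F₁; F₂; F₃; In; Int)

    -- At z = t (u , v) the integer form is D² t times the rational signed area at (u , v). For
    -- positive t the factor is positive, so weak and strict signs agree and both membership and
    -- interior carry over.
    ι-value : ∀ ((b₁ , b₂) (c₁ , c₂) (u , v) : Point) B₁ B₂ C₁ C₂ t x y → b₁ * d ≡ ι B₁ → b₂ * d ≡ ι B₂ → c₁ * d ≡ ι C₁ → c₂ * d ≡ ι C₂ →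
      ι x ≡ ι t * u → ι y ≡ ι t * v →
      ι (value ((B₂ ℤ.- C₂) ℤ.* D) ((C₁ ℤ.- B₁) ℤ.* D) ((C₂ ℤ.- B₂) ℤ.* B₁ ℤ.- (C₁ ℤ.- B₁) ℤ.* B₂) t (x , y)) ≡
        d * d * ι t * area (b₁ , b₂) (c₁ , c₂) (u , v)
    ι-value (b₁ , b₂) (c₁ , c₂) (u , v) B₁ B₂ C₁ C₂ t x y b₁≡ b₂≡ c₁≡ c₂≡ x≡ y≡ =
      trans (cong ι (regroup B₁ B₂ C₁ C₂ D t x y))
        (trans (ι-cross (C₁ ℤ.- B₁) (D ℤ.* y ℤ.- t ℤ.* B₂) (C₂ ℤ.- B₂) (D ℤ.* x ℤ.- t ℤ.* B₁)
            (ι-scaled-difference c₁ b₁ C₁ B₁ c₁≡ b₁≡) (ι-cross D y t B₂ refl y≡ refl (sym b₂≡))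
            (ι-scaled-difference c₂ b₂ C₂ B₂ c₂≡ b₂≡) (ι-cross D x t B₁ refl x≡ refl (sym b₁≡)))
          (identity b₁ b₂ c₁ c₂ u v d (ι t)))
      where
      regroup : ∀ B₁ B₂ C₁ C₂ D t x y →
        (B₂ ℤ.- C₂) ℤ.* D ℤ.* x ℤ.+ (C₁ ℤ.- B₁) ℤ.* D ℤ.* y ℤ.+ ((C₂ ℤ.- B₂) ℤ.* B₁ ℤ.- (C₁ ℤ.- B₁) ℤ.* B₂) ℤ.* t ≡
        (C₁ ℤ.- B₁) ℤ.* (D ℤ.* y ℤ.- t ℤ.* B₂) ℤ.- (C₂ ℤ.- B₂) ℤ.* (D ℤ.* x ℤ.- t ℤ.* B₁)
      regroup = solve-∀
      identity : ∀ b₁ b₂ c₁ c₂ u v d t →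
        (c₁ - b₁) * d * (d * (t * v) - t * (b₂ * d)) - (c₂ - b₂) * d * (d * (t * u) - t * (b₁ * d)) ≡
        d * d * t * ((c₁ - b₁) * (v - b₂) - (c₂ - b₂) * (u - b₁))
      identity = solve 8 (λ b₁ b₂ c₁ c₂ u v d t →
        (c₁ :- b₁) :* d :* (d :* (t :* v) :- t :* (b₂ :* d)) :- (c₂ :- b₂) :* d :* (d :* (t :* u) :- t :* (b₁ :* d)) :=
        d :* d :* t :* ((c₁ :- b₁) :* (v :- b₂) :- (c₂ :- b₂) :* (u :- b₁))) refl

    module At (t : ℤ) (0<t : 0ℤ ℤ.< t) (x y : ℤ) (u v : ℚ) (x≡ : ι x ≡ ι t * u) (y≡ : ι y ≡ ι t * v) where
      factor : ℚ
      factor = d * d * ι t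
      0<factor : 0ℚ < factor
      0<factor = 0<-*ℚ (0<-*ℚ 0<d 0<d) (ι-mono-< 0<t)
      a₁≡ = proj₁ (proj₂ clears-a)
      a₂≡ = proj₂ (proj₂ clears-a)
      b₁≡ = proj₁ (proj₂ clears-b)
      b₂≡ = proj₂ (proj₂ clears-b)
      c₁≡ = proj₁ (proj₂ clears-c)
      c₂≡ = proj₂ (proj₂ clears-c)

      ι-F₁ : ι (F₁ t (x , y)) ≡ factor * area (v₂ T) (v₃ T) (u , v)
      ι-F₁ = ι-value (v₂ T) (v₃ T) (u , v) B₁ B₂ C₁ C₂ t x y b₁≡ b₂≡ c₁≡ c₂≡ x≡ y≡
      ι-F₂ : ι (F₂ t (x , y)) ≡ factor * area (v₃ T) (v₁ T) (u , v)
      ι-F₂ = ι-value (v₃ T) (v₁ T) (u , v) C₁ C₂ A₁ A₂ t x y c₁≡ c₂≡ a₁≡ a₂≡ x≡ y≡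
      ι-F₃ : ι (F₃ t (x , y)) ≡ factor * area (v₁ T) (v₂ T) (u , v)
      ι-F₃ = ι-value (v₁ T) (v₂ T) (u , v) A₁ A₂ B₁ B₂ t x y a₁≡ a₂≡ b₁≡ b₂≡ x≡ y≡

      ≥-from : ∀ {n g} → ι n ≡ factor * g → 0ℚ ≤ g → 0ℤ ℤ.≤ n
      ≥-from {n} eq 0≤g = ι-cancel-≤ {0ℤ} {n} (subst (0ℚ ≤_) (sym eq) (0≤-* (<⇒≤ 0<factor) 0≤g))
      ≥-to : ∀ {n g} → ι n ≡ factor * g → 0ℤ ℤ.≤ n → 0ℚ ≤ g
      ≥-to eq 0≤n = 0≤-cancel 0<factor (subst (0ℚ ≤_) eq (ι-mono-≤ 0≤n))
      >-from : ∀ {n g} → ι n ≡ factor * g → 0ℚ < g → 0ℤ ℤ.< n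
      >-from {n} eq 0<g = ι-cancel-< {0ℤ} {n} (subst (0ℚ <_) (sym eq) (0<-*ℚ 0<factor 0<g))
      >-to : ∀ {n g} → ι n ≡ factor * g → 0ℤ ℤ.< n → 0ℚ < g
      >-to eq 0<n = 0<-cancel 0<factor (subst (0ℚ <_) eq (ι-mono-< 0<n))

      Inside⇒In : Inside T 0<det (u , v) → In t (x , y)
      Inside⇒In (f , g , h) = ≥-from ι-F₁ f , ≥-from ι-F₂ g , ≥-from ι-F₃ h
      In⇒Inside : In t (x , y) → Inside T 0<det (u , v)
      In⇒Inside (f , g , h) = ≥-to ι-F₁ f , ≥-to ι-F₂ g , ≥-to ι-F₃ h
      Strict⇒Int : Strict T 0<det (u , v) → Int t (x , y)
      Strict⇒Int (f , g , h) = >-from ι-F₁ f , >-from ι-F₂ g , >-from ι-F₃ h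
      Int⇒Strict : Int t (x , y) → Strict T 0<det (u , v)
      Int⇒Strict (f , g , h) = >-to ι-F₁ f , >-to ι-F₂ g , >-to ι-F₃ h

    Dil⇒In : ∀ t z → lat z ∈Dil[ ℕ.suc t ] T → In (+ ℕ.suc t) z
    Dil⇒In t (x , y) ((u , v) , inside , x≡ , y≡) =
      At.Inside⇒In (+ ℕ.suc t) (+<+ (ℕ.s≤s ℕ.z≤n)) x y u v x≡ y≡ (∈T⇒Inside T 0<det (u , v) inside)

    In⇒Dil : ∀ t z → In (+ ℕ.suc t) z → lat z ∈Dil[ ℕ.suc t ] T
    In⇒Dil t (x , y) inside = divide (reciprocal (ι-mono-< {0ℤ} {+ ℕ.suc t} (+<+ (ℕ.s≤s ℕ.z≤n))))
      where
      τ : ℚ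
      τ = ι (+ ℕ.suc t)
      divide : (∃ λ q → 0ℚ < q × τ * q ≡ 1ℚ) → lat (x , y) ∈Dil[ ℕ.suc t ] T
      divide (q , _ , τq≡1) = (q * ι x , q * ι y) ,
        Inside⇒∈T T 0<det (q * ι x , q * ι y)
          (At.In⇒Inside (+ ℕ.suc t) (+<+ (ℕ.s≤s ℕ.z≤n)) x y (q * ι x) (q * ι y) (restore (ι x)) (restore (ι y)) inside) ,
        restore (ι x) , restore (ι y)
        where
        restore : ∀ r → r ≡ τ * (q * r)
        restore r = sym (trans (sym (*-assoc τ q r)) (trans (cong (_* r) τq≡1) (*-identityˡ r)))

    module At-1 (z : ℤ × ℤ) = At 1ℤ (+<+ (ℕ.s≤s ℕ.z≤n)) (proj₁ z) (proj₂ z) (ι (proj₁ z)) (ι (proj₂ z))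
      (sym (*-identityˡ (ι (proj₁ z)))) (sym (*-identityˡ (ι (proj₂ z))))

    Interior⇒Int : ∀ z → Interior (lat z) T → Int 1ℤ z
    Interior⇒Int z = At-1.Strict⇒Int z ∘ Interior⇒Strict T 0<det (lat z)

    Int⇒Interior : ∀ z → Int 1ℤ z → Interior (lat z) T
    Int⇒Interior z = Strict⇒Interior T 0<det (lat z) ∘ At-1.Int⇒Strict z

    boundary-count-bounds : Pseudointegral T → HasCard (λ z → Interior (lat z) T) 1 →
      ∀ b → HasCard (λ z → Boundary (lat z) T) b → (1 ℕ.≤ b) × (b ℕ.≤ 9) × (b ≢ 7)
    boundary-count-bounds (cs , polynomial) one-interior b boundary = natural (positive-b b K≡ 0<K) (bound Δ (proj₁ z₀) (proj₂ z₀) z₀-inside next {+ b} K≡)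
      where
      one : Card (Int 1ℤ) 1
      one = card-cong Interior⇒Int Int⇒Interior one-interior
      z₀ : ℤ × ℤ
      z₀ = proj₁ (card-1⇒singleton one)
      z₀-inside : Int 1ℤ z₀
      z₀-inside = proj₂ (card-1⇒singleton one)
      counts : (t : ℕ) → ∃ λ n → Card (In (+ ℕ.suc t)) n × evalPoly cs (ι (+ ℕ.suc t)) ≡ ι (+ n)
      counts t = let n , card , eq = polynomial t in n , card-cong (Dil⇒In t) (In⇒Dil t) card , eq
      next : ∀ t → 0ℤ ℤ.< t → ∃ λ n → Card (In t) n × Card (Int (t ℤ.+ 1ℤ)) n
      next = interior-of-next-dilate Δ cs counts one
      total : Card (In 1ℤ) (b ℕ.+ 1)
      total = card-cong
        (λ z → [ (λ (inside , _) → At-1.Inside⇒In z (∈T⇒Inside T 0<det (lat z) inside)) , Int⇒In Δ 1ℤ z ∘ Interior⇒Int z ]′)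
        (λ z inside → split z inside (Int? Δ 1ℤ z))
        (card-⊎ boundary one-interior λ z (_ , ¬interior) → ¬interior)
        where
        -- `Boundary` contains a negation, so the points of the triangle split into boundary and
        -- interior only by a decision, which the signs of the integer forms provide.
        split : ∀ z → In 1ℤ z → Dec (Int 1ℤ z) → Boundary (lat z) T ⊎ Interior (lat z) T
        split z inside (yes int) = inj₂ (Int⇒Interior z int)
        split z inside (no ¬int) = inj₁ (Inside⇒∈T T 0<det (lat z) (At-1.In⇒Inside z inside) , ¬int ∘ Interior⇒Int z)
      K≡ : IntegerTriangle.K Δ ≡ + b ℤ.* (D ℤ.* D)
      K≡ = K≡bDD Δ cs counts one {b} total
      -- The lower bound is positivity of the area: b = 0 would give K = b D² = 0.
      positive-b : ∀ b {k} → k ≡ + b ℤ.* (D ℤ.* D) → 0ℤ ℤ.< k → 1 ℕ.≤ b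
      positive-b (ℕ.suc b) _ _ = ℕ.s≤s ℕ.z≤n
      positive-b ℕ.zero k≡ 0<k = contradiction (trans k≡ (ℤ.*-zeroˡ (D ℤ.* D))) (ℤ.<⇒≢ 0<k ∘ sym)
      natural : 1 ℕ.≤ b → Conclusion (+ b) → (1 ℕ.≤ b) × (b ℕ.≤ 9) × (b ≢ 7)
      natural 1≤b (b≤9 , b≢7) = 1≤b , ℤ.drop‿+≤+ b≤9 , λ b≡7 → b≢7 (cong (λ n → + n) b≡7)

-- Reduction to positive orientation.

module Orientation where
  open import Defs
  open Counting using (card-cong)
  open Denominators
  open import Data.Nat using (ℕ; _≤_)
  import Data.Rational as ℚ
  import Data.Rational.Properties as ℚ
  open import Data.Rational.Solver using (module +-*-Solver)
  open +-*-Solver using (solve; _:+_; _:*_; _:-_; :-_; _:=_)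
  open import Data.Product using (_×_; _,_)
  open import Relation.Binary.PropositionalEquality
  open import Data.Rational using (0ℚ)

  -- Exchanging two vertices changes the sign of the determinant but not the set of points, so every
  -- hypothesis transfers to the triangle of opposite orientation.
  swap : Triangle → Triangle
  swap (tri a b c) = tri a c b

  swap-∈T : ∀ T p → p ∈T T → p ∈T swap T
  swap-∈T (tri (a₁ , a₂) (b₁ , b₂) (c₁ , c₂)) _ (l₁ , l₂ , l₃ , 0≤l₁ , 0≤l₂ , 0≤l₃ , sum , x≡ , y≡) =
    l₁ , l₃ , l₂ , 0≤l₁ , 0≤l₃ , 0≤l₂ ,
    trans (cong (l₁ ℚ.+_) (ℚ.+-comm l₃ l₂)) sum ,
    trans x≡ (cong ((l₁ ℚ.* a₁) ℚ.+_) (ℚ.+-comm (l₂ ℚ.* b₁) (l₃ ℚ.* c₁))) ,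
    trans y≡ (cong ((l₁ ℚ.* a₂) ℚ.+_) (ℚ.+-comm (l₂ ℚ.* b₂) (l₃ ℚ.* c₂)))

  swap-Dil : ∀ T t p → p ∈Dil[ t ] T → p ∈Dil[ t ] swap T
  swap-Dil T t p (a , a∈T , eqs) = a , swap-∈T T a a∈T , eqs

  swap-Interior : ∀ T p → Interior p T → Interior p (swap T)
  swap-Interior T p (ε , 0<ε , near) = ε , 0<ε , λ u v u-near v-near → swap-∈T T (u , v) (near u v u-near v-near)

  swap-Boundary : ∀ T p → Boundary p T → Boundary p (swap T)
  swap-Boundary T p (p∈T , ¬interior) = swap-∈T T p p∈T , λ interior → ¬interior (swap-Interior (swap T) p interior)

  det-swap : ∀ T → det (swap T) ≡ ℚ.- det T
  det-swap (tri (a₁ , a₂) (b₁ , b₂) (c₁ , c₂)) = solve 6 (λ a₁ a₂ b₁ b₂ c₁ c₂ →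
    (c₁ :- a₁) :* (b₂ :- a₂) :- (b₁ :- a₁) :* (c₂ :- a₂) :=
    :- ((b₁ :- a₁) :* (c₂ :- a₂) :- (c₁ :- a₁) :* (b₂ :- a₂))) refl a₁ a₂ b₁ b₂ c₁ c₂

  positively-oriented : ∀ T → 0ℚ ℚ.< det T → Pseudointegral T → HasCard (λ z → Interior (lat z) T) 1 →
    ∀ b → HasCard (λ z → Boundary (lat z) T) b → (1 ≤ b) × (b ≤ 9) × (b ≢ 7)
  positively-oriented T 0<det =
    let D , 0<D , A , B , C = common-denominator (v₁ T) (v₂ T) (v₃ T)
    in boundary-count-bounds T 0<det D 0<D A B C

open import Defs
open import Data.Nat using (ℕ; _≤_)
import Data.Nat as ℕ
open import Data.Product using (_×_; _,_)
open import Data.Rational using (0ℚ)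
import Data.Rational as ℚ
import Data.Rational.Properties as ℚ
open import Relation.Binary.Definitions using (tri<; tri≈; tri>)
open import Relation.Binary.PropositionalEquality using (_≢_; sym; subst)
open import Relation.Nullary using (contradiction)
open Counting using (card-cong)
open Orientation

theorem1p1 : (T : Triangle) → NonDegenerate T → Pseudointegral T →
    HasCard (λ z → Interior (lat z) T) 1 →
    (b : ℕ) → HasCard (λ z → Boundary (lat z) T) b →
    (1 ≤ b) × (b ≤ 9) × (b ≢ 7)
theorem1p1 T det≢0 polynomial@(cs , values) interior b boundary with ℚ.<-cmp (det T) 0ℚ
... | tri≈ _ det≡0 _ = contradiction det≡0 det≢0
... | tri> _ _ 0<det = positively-oriented T 0<det polynomial interior b boundary
... | tri< det<0 _ _ = positively-oriented (swap T) (subst (0ℚ ℚ.<_) (sym (det-swap T)) (ℚ.neg-antimono-< det<0))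
  (cs , λ t → let n , card , eq = values t in
    n , card-cong (λ z → swap-Dil T (ℕ.suc t) (lat z)) (λ z → swap-Dil (swap T) (ℕ.suc t) (lat z)) card , eq)
  (card-cong (λ z → swap-Interior T (lat z)) (λ z → swap-Interior (swap T) (lat z)) interior)
  b (card-cong (λ z → swap-Boundary T (lat z)) (λ z → swap-Boundary (swap T) (lat z)) boundary)
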